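{- Let $k$ be a positive integer and let $G$ be a graph such that $|E(G)|$ and every vertex degree $d_G(v)$ are divisible by $k$. Let $Q$ be the set of all vertices $v$ with $d_G(v)/k$ odd. If $d_G(X)\ge 3k-2$ for every vertex set $X$ with $|X\cap Q|$ odd, then $G$ can be edge-decomposed into $k$ factors $G_1,\ldots,G_k$ such that $d_{G_i}(v)=d_G(v)/k$ for each $i$ and each vertex $v$.
   Context: Graphs are finite and may have loops and multiple edges; a loop contributes $2$ to the degree. For a vertex set $X$, $d_G(X)$ denotes the number of edges with exactly one end in $X$. A factor is a spanning subgraph; "edge-decomposed into factors" means the edge set is partitioned into the edge sets of spanning subgraphs. -}

module Defs where

open import Data.Nat using (ℕ; zero; suc; _+_; _*_; NonZero; _/_; parity)
open import Data.Nat.Divisibility using (_∣_)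
open import Data.Parity.Base using (1ℙ)
open import Data.Parity.Properties using () renaming (_≟_ to _≟ℙ_)
open import Data.Fin using (Fin; _≟_)
open import Data.Bool using (Bool; true; false; if_then_else_; _∧_; _xor_)
open import Data.Product using (_×_; proj₁; proj₂)
open import Relation.Nullary.Decidable using (⌊_⌋)
open import Relation.Binary.PropositionalEquality using (_≡_)

-- A finite multigraph (loops and parallel edges allowed):
-- vertices Fin nV, edges Fin nE, each edge has an (unordered) pair of ends.
record Graph : Set where
  field
    nV : ℕ
    nE : ℕ
    ends : Fin nE → Fin nV × Fin nV
open Graph public

count : {m : ℕ} → (Fin m → Bool) → ℕ
count {zero}  p = 0
count {suc m} p = (if p Fin.zero then 1 else 0) + count (λ i → p (Fin.suc i))

Odd : ℕ → Set
Odd n = parity n ≡ 1ℙ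

|E| : Graph → ℕ
|E| G = nE G

-- degree of v in the spanning subgraph of G with edge set S (a loop counts 2)
degIn : (G : Graph) → (Fin (nE G) → Bool) → Fin (nV G) → ℕ
degIn G S v =
  count (λ e → S e ∧ ⌊ proj₁ (ends G e) ≟ v ⌋) +
  count (λ e → S e ∧ ⌊ proj₂ (ends G e) ≟ v ⌋)

deg : (G : Graph) → Fin (nV G) → ℕ
deg G = degIn G (λ _ → true)

degSet : (G : Graph) → (Fin (nV G) → Bool) → ℕ
degSet G X = count (λ e → X (proj₁ (ends G e)) xor X (proj₂ (ends G e)))

inQ : (G : Graph) (k : ℕ) .{{_ : NonZero k}} → Fin (nV G) → Bool
inQ G k v = ⌊ parity (deg G v / k) ≟ℙ 1ℙ ⌋

-- G is oriented such that all out-degrees, and hence all in-degrees, are divisible by k. Splitting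
-- each vertex into an out-copy and an in-copy gives a bipartite graph whose degrees are divisible
-- by k, and its edges can be coloured with k colours such that each colour takes the k-th part of
-- each degree: the colours are the factors.
--
-- The orientation is found by the method of Lovász, Thomassen, Wu and Zhang, in graphs with a root
-- whose edges are already oriented. Every set of other vertices must be able to have p outgoing
-- and q ingoing edges with p, q ≥ k - 1, where p is prescribed modulo k. A set with more than one
-- vertex that does not allow p, q ≥ k is contracted: first its outside is oriented, and then its
-- inside, with the outside as the new root. If there is no such set, every set with more than one
-- vertex survives the deletion of one oriented edge or the splitting off of two edges, so only the
-- single vertices stand in the way. A vertex with p = q is exempt from the condition and can be
-- split off completely. Otherwise a vertex tolerates the loss of an outgoing or of an ingoing
-- edge. An edge from a vertex of the first kind to one of the second kind is deleted; if all
-- vertices are of the first kind, one of them is brought to the second kind by additional root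
-- edges.
--
-- The small cuts of G itself separate sets for which p = q is possible. Contracting a minimal one
-- leaves no such cut inside, apart from those around exempt vertices.

module Submission where

open import Defs
open import Data.Nat
open import Data.Nat.Properties
open import Data.Nat.DivMod using (n/1≡n; m%n<n; m≡m%n+[m/n]*n; m/n*n≡m; [m+kn]%n≡m%n)
open import Data.Nat.Divisibility using (_∣_)
open import Data.Nat.Induction using (<-wellFounded)
open import Data.Nat.Tactic.RingSolver using (solve-∀)
open import Data.Bool using (Bool; true; false; if_then_else_; _∧_; _∨_; _xor_; not)
open import Data.Bool.Properties using (∧-comm; ∧-identityʳ; ∧-zeroʳ; ∨-zeroʳ) renaming (_≟_ to _≟B_)
open import Data.Fin using (Fin)
open import Data.Fin.Properties using (any?) renaming (_≟_ to _≟F_)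
open import Data.Fin.Subset.Properties using (anySubset?)
open import Data.List using (List; []; _∷_; _++_; map; filterᵇ; length; replicate; concatMap; tabulate)
open import Data.List.Properties using (length-tabulate; ∷-injectiveˡ; ∷-injectiveʳ)
open import Data.List.Relation.Unary.All using (All; []; _∷_; universal)
import Data.List.Relation.Unary.All as All
import Data.List.Relation.Unary.All.Properties as All
open import Data.Parity.Base using (0ℙ; 1ℙ) renaming (_+_ to _+ℙ_)
open import Data.Parity.Properties using (+-homo-+) renaming (_≟_ to _≟ℙ_)
open import Data.Product using (Σ; ∃; _×_; _,_; proj₁; proj₂; swap)
open import Data.Sum using (_⊎_; inj₁; inj₂)
import Data.Sum as Sum
open import Data.Sum.Properties using (≡-dec)
open import Data.Vec using () renaming (lookup to lookupᵛ; tabulate to tabulateᵛ)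
open import Data.Vec.Properties using (lookup∘tabulate)
open import Function using (_∘_)
open import Induction.WellFounded using (Acc; acc)
open import Relation.Binary.Definitions using (DecidableEquality)
open import Relation.Binary.PropositionalEquality
open import Relation.Nullary using (¬_; Dec; yes; no; contradiction)
open import Relation.Nullary.Decidable using (⌊_⌋; ¬?; _×-dec_; decidable-stable; map′)

-- The bound 3k - 2 enters once: among the k values of p from k - 1 to 2k - 2 one has the demanded
-- residue, and a cut of 3k - 2 edges then leaves q at least k - 1. If X meets Q evenly, its degree
-- sum is an even multiple of k, so half of the cut is an admissible p = q, however small it is.
-- This dichotomy is what contractions of a graph without a root inherit. A set that does not allow
-- p, q ≥ k can be cut off because moving k edges from one direction to the other keeps the residue:
-- neither p nor q reaches 2k, and not both reach k. A root with so few edges cannot alone meet the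
-- demands on both sides of a partition, so some other edge crosses. This supplies the edge to be
-- deleted. Nearly even orientations serve twice: they settle the case where p = q is possible at
-- every vertex, and, applied to two colour classes, they replace the alternating paths in the edge
-- colouring.

true≢false : ∀ {x} → x ≡ true → x ≢ false
true≢false refl ()

∧-true : ∀ {x y} → x ∧ y ≡ true → x ≡ true × y ≡ true
∧-true {true} {true} _ = refl , refl

∧-intro : ∀ {x y} → x ≡ true → y ≡ true → x ∧ y ≡ true
∧-intro refl refl = refl

⌊⌋-true : {P : Set} (d : Dec P) → P → ⌊ d ⌋ ≡ true
⌊⌋-true (yes _) _ = refl
⌊⌋-true (no ¬p) p = contradiction p ¬p

⌊⌋-false : {P : Set} (d : Dec P) → ¬ P → ⌊ d ⌋ ≡ false
⌊⌋-false (yes p) ¬p = contradiction p ¬p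
⌊⌋-false (no _)  _  = refl

⌊⌋⇒ : {P : Set} (d : Dec P) → ⌊ d ⌋ ≡ true → P
⌊⌋⇒ (yes p) _ = p

⌊⌋⇒¬ : {P : Set} (d : Dec P) → ⌊ d ⌋ ≡ false → ¬ P
⌊⌋⇒¬ (no ¬p) _ = ¬p

-- Residues modulo k

module Mod (K : ℕ) where

  k : ℕ
  k = suc K

  infix 4 _≋_
  -- Multiples of k on both sides keep symmetry and cancellation free of truncated subtraction.
  record _≋_ (x y : ℕ) : Set where
    constructor cong-by
    field
      i j : ℕ
      eq  : x + i * k ≡ y + j * k

  ≡⇒≋ : ∀ {x y} → x ≡ y → x ≋ y
  ≡⇒≋ refl = cong-by 0 0 refl

  ≋-refl : ∀ {x} → x ≋ x
  ≋-refl = ≡⇒≋ refl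

  ≋-sym : ∀ {x y} → x ≋ y → y ≋ x
  ≋-sym (cong-by i j eq) = cong-by j i (sym eq)

  ≋-trans : ∀ {x y z} → x ≋ y → y ≋ z → x ≋ z
  ≋-trans {x} {y} {z} (cong-by i j p) (cong-by l m q) = cong-by (i + l) (m + j) (begin
    x + (i + l) * k      ≡⟨ ring₁ x i l k ⟩
    (x + i * k) + l * k  ≡⟨ cong (_+ l * k) p ⟩
    (y + j * k) + l * k  ≡⟨ ring₂ y j l k ⟩
    (y + l * k) + j * k  ≡⟨ cong (_+ j * k) q ⟩
    (z + m * k) + j * k  ≡⟨ ring₁ z m j k ⟨
    z + (m + j) * k      ∎)
    where
    open ≡-Reasoning
    ring₁ : ∀ x i l k → x + (i + l) * k ≡ (x + i * k) + l * k
    ring₁ = solve-∀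
    ring₂ : ∀ y j l k → (y + j * k) + l * k ≡ (y + l * k) + j * k
    ring₂ = solve-∀

  ≋-+ : ∀ {x y u v} → x ≋ y → u ≋ v → x + u ≋ y + v
  ≋-+ {x} {y} {u} {v} (cong-by i j p) (cong-by l m q) = cong-by (i + l) (j + m) (begin
    x + u + (i + l) * k        ≡⟨ ring x u i l k ⟩
    (x + i * k) + (u + l * k)  ≡⟨ cong₂ _+_ p q ⟩
    (y + j * k) + (v + m * k)  ≡⟨ ring y v j m k ⟨
    y + v + (j + m) * k        ∎)
    where
    open ≡-Reasoning
    ring : ∀ x u i l k → x + u + (i + l) * k ≡ (x + i * k) + (u + l * k)
    ring = solve-∀

  ≋-cancelʳ : ∀ z {x y} → x + z ≋ y + z → x ≋ y
  ≋-cancelʳ z {x} {y} (cong-by i j eq) = cong-by i j (+-cancelʳ-≡ z _ _ (begin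
    x + i * k + z  ≡⟨ ring x z (i * k) ⟩
    x + z + i * k  ≡⟨ eq ⟩
    y + z + j * k  ≡⟨ ring y z (j * k) ⟨
    y + j * k + z  ∎))
    where
    open ≡-Reasoning
    ring : ∀ x z w → x + w + z ≡ x + z + w
    ring = solve-∀

  ≋-drop : ∀ i {x} → x + i * k ≋ x
  ≋-drop i {x} = cong-by 0 i (+-identityʳ _)

  k*≋0 : ∀ i → i * k ≋ 0
  k*≋0 i = ≋-drop i {0}

  ≋-gap : ∀ {x y} → x ≋ y → x < y → x + k ≤ y
  ≋-gap {x} {y} (cong-by i j eq) x<y with suc j ≤? i
  ... | yes j<i = +-cancelʳ-≤ (j * k) _ _ (begin
    x + k + j * k   ≡⟨ +-assoc x k (j * k) ⟩
    x + suc j * k   ≤⟨ +-monoʳ-≤ x (*-monoˡ-≤ k j<i) ⟩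
    x + i * k       ≡⟨ eq ⟩
    y + j * k       ∎)
    where open ≤-Reasoning
  ... | no j≮i = contradiction eq (<⇒≢ (+-mono-<-≤ x<y (*-monoˡ-≤ k (≤-pred (≰⇒> j≮i)))))

  _≋?_ : ∀ x y → Dec (x ≋ y)
  x ≋? y = map′ to from (x % k ≟ y % k)
    where
    to : x % k ≡ y % k → x ≋ y
    to eq = cong-by (y / k) (x / k) (begin
      x + y / k * k                        ≡⟨ cong (_+ y / k * k) (m≡m%n+[m/n]*n x k) ⟩
      x % k + x / k * k + y / k * k        ≡⟨ cong (λ r → r + x / k * k + y / k * k) eq ⟩
      y % k + x / k * k + y / k * k        ≡⟨ ring (y % k) (x / k * k) (y / k * k) ⟩
      y % k + y / k * k + x / k * k        ≡⟨ cong (_+ x / k * k) (m≡m%n+[m/n]*n y k) ⟨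
      y + x / k * k                        ∎)
      where
      open ≡-Reasoning
      ring : ∀ a b c → a + b + c ≡ a + c + b
      ring = solve-∀
    from : x ≋ y → x % k ≡ y % k
    from (cong-by i j eq) =
      trans (sym ([m+kn]%n≡m%n x i k)) (trans (cong (_% k) eq) ([m+kn]%n≡m%n y j k))

  -- s is the size of a cut, ε the number of edges inside, ρ the demanded out-degree:
  -- the edges of the cut can be split into p outgoing and q ingoing ones as demanded.
  record Good (c c′ s ε ρ : ℕ) : Set where
    constructor mkGood
    field
      p q  : ℕ
      c≤p  : c ≤ p
      c′≤q : c′ ≤ q
      size : p + q ≡ s
      res  : p + ε ≋ ρ

  record Bal (s ε ρ : ℕ) : Set where
    constructor mkBal
    field
      c    : ℕ
      size : c + c ≡ s
      res  : c + ε ≋ ρ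

  good? : ∀ c c′ s ε ρ → Dec (Good c c′ s ε ρ)
  good? c c′ s ε ρ = map′ to from
      (anyUpTo? (λ p → (c ≤? p) ×-dec (c′ ≤? s ∸ p) ×-dec ((p + ε) ≋? ρ)) (suc s))
    where
    to : ∃ (λ p → p < suc s × c ≤ p × c′ ≤ s ∸ p × p + ε ≋ ρ) → Good c c′ s ε ρ
    to (p , s≤s p≤s , c≤p , c′≤q , r) = mkGood p (s ∸ p) c≤p c′≤q (m+[n∸m]≡n p≤s) r
    from : Good c c′ s ε ρ → ∃ (λ p → p < suc s × c ≤ p × c′ ≤ s ∸ p × p + ε ≋ ρ)
    from (mkGood p q c≤p c′≤q refl r) =
      p , s≤s (m≤m+n p q) , c≤p , subst (c′ ≤_) (sym (m+n∸m≡n p q)) c′≤q , r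

  bal? : ∀ s ε ρ → Dec (Bal s ε ρ)
  bal? s ε ρ = map′ to from
      (anyUpTo? (λ c → ((c + c) ≟ s) ×-dec ((c + ε) ≋? ρ)) (suc s))
    where
    to : ∃ (λ c → c < suc s × c + c ≡ s × c + ε ≋ ρ) → Bal s ε ρ
    to (c , _ , e , r) = mkBal c e r
    from : Bal s ε ρ → ∃ (λ c → c < suc s × c + c ≡ s × c + ε ≋ ρ)
    from (mkBal c refl r) = c , s≤s (m≤m+n c c) , refl , r

  -- p becomes p + g - i and q becomes q - j.
  adjust : ∀ i j g {c c′ c₁ c₂ s s′ ε ε′ ρ ρ′} → i + c ≤ g + c₁ → j + c′ ≤ c₂ →
    s + g ≡ i + j + s′ → ρ + ε′ + g ≋ ρ′ + ε + i →
    Good c₁ c₂ s ε ρ → Good c c′ s′ ε′ ρ′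
  adjust i j g {c} {c′} {c₁} {c₂} {s} {s′} {ε} {ε′} {ρ} {ρ′} hp hq hs hρ
         (mkGood p q c≤p c′≤q sz r) =
    mkGood p₀ q₀
      (+-cancelˡ-≤ i _ _ (≤-trans hp (≤-trans (+-monoʳ-≤ g c≤p) (≤-reflexive (sym ep)))))
      (+-cancelˡ-≤ j _ _ (≤-trans hq (≤-trans c′≤q (≤-reflexive (sym eq)))))
      (+-cancelˡ-≡ (i + j) _ _ (begin
        i + j + (p₀ + q₀)      ≡⟨ ring₁ i j p₀ q₀ ⟩
        (i + p₀) + (j + q₀)    ≡⟨ cong₂ _+_ ep eq ⟩
        g + p + q              ≡⟨ ring₂ g p q ⟩
        p + q + g              ≡⟨ cong (_+ g) sz ⟩
        s + g                  ≡⟨ hs ⟩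
        i + j + s′             ∎))
      (≋-cancelʳ (ε + i) (≋-trans (≡⇒≋ (begin
        p₀ + ε′ + (ε + i)      ≡⟨ ring₃ p₀ ε ε′ i ⟩
        (i + p₀) + ε + ε′      ≡⟨ cong (λ t → t + ε + ε′) ep ⟩
        g + p + ε + ε′         ≡⟨ ring₄ g p ε ε′ ⟩
        (p + ε) + (ε′ + g)     ∎))
        (≋-trans (≋-+ r (≋-refl {ε′ + g}))
        (≋-trans (≡⇒≋ (sym (+-assoc ρ ε′ g)))
        (≋-trans hρ (≡⇒≋ (+-assoc ρ′ ε i)))))))
    where
    open ≡-Reasoning
    p₀ = g + p ∸ i
    q₀ = q ∸ j
    ep : i + p₀ ≡ g + p
    ep = m+[n∸m]≡n (≤-trans (m≤m+n i c) (≤-trans hp (+-monoʳ-≤ g c≤p)))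
    eq : j + q₀ ≡ q
    eq = m+[n∸m]≡n (≤-trans (m≤m+n j c′) (≤-trans hq c′≤q))
    ring₁ : ∀ i j p q → i + j + (p + q) ≡ (i + p) + (j + q)
    ring₁ = solve-∀
    ring₂ : ∀ g p q → g + p + q ≡ p + q + g
    ring₂ = solve-∀
    ring₃ : ∀ p ε ε′ i → p + ε′ + (ε + i) ≡ (i + p) + ε + ε′
    ring₃ = solve-∀
    ring₄ : ∀ g p ε ε′ → g + p + ε + ε′ ≡ (p + ε) + (ε′ + g)
    ring₄ = solve-∀

  weaken : ∀ {c c′ c₁ c₂ s ε ρ} → c ≤ c₁ → c′ ≤ c₂ → Good c₁ c₂ s ε ρ → Good c c′ s ε ρ
  weaken h h′ (mkGood p q a b e r) = mkGood p q (≤-trans h a) (≤-trans h′ b) e r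

  good-≋ : ∀ {c c′ s s′ ε ε′ ρ ρ′} → s ≡ s′ → ρ + ε′ ≋ ρ′ + ε → Good c c′ s ε ρ → Good c c′ s′ ε′ ρ′
  good-≋ {s = s} refl h =
    adjust 0 0 0 ≤-refl ≤-refl (+-identityʳ s) (≋-trans (≡⇒≋ (+-identityʳ _)) (≋-trans h (≡⇒≋ (sym (+-identityʳ _)))))

  bal-≋ : ∀ {s s′ ε ε′ ρ ρ′} → s ≡ s′ → ρ + ε′ ≋ ρ′ + ε → Bal s ε ρ → Bal s′ ε′ ρ′
  bal-≋ {ε = ε} {ε′} refl h (mkBal c sz r) = mkBal c sz (≋-cancelʳ ε
    (≋-trans (≡⇒≋ (ring c ε′ ε)) (≋-trans (≋-+ r (≋-refl {ε′})) h)))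
    where
    ring : ∀ c ε′ ε → c + ε′ + ε ≡ c + ε + ε′
    ring = solve-∀

  -- Losing one outgoing and one ingoing edge keeps p = q, so balance survives without any lower
  -- bound on the cut. This is why exempt vertices tolerate splitting off.
  bal-drop : ∀ {s s′ ε ε′ ρ ρ′} → s ≡ 2 + s′ → ρ + ε′ ≋ ρ′ + ε + 1 → Bal s ε ρ → Bal s′ ε′ ρ′
  bal-drop {ε = ε} {ε′} refl h (mkBal (suc c) sz r) =
    mkBal c (suc-injective (suc-injective (trans (sym (cong suc (+-suc c c))) sz)))
      (≋-cancelʳ (ε + 1) (≋-trans (≡⇒≋ (ring c ε′ ε)) (≋-trans (≋-+ r (≋-refl {ε′}))
        (≋-trans h (≡⇒≋ (+-assoc _ ε 1))))))
    where
    ring : ∀ c ε′ ε → c + ε′ + (ε + 1) ≡ suc c + ε + ε′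
    ring = solve-∀

  -- Turning k outgoing edges into ingoing ones does not change the residue of p.
  rotateʳ : ∀ {c c′ c₁ c₂ s ε ρ} → k + c ≤ c₁ → c′ ≤ c₂ + k → Good c₁ c₂ s ε ρ → Good c c′ s ε ρ
  rotateʳ {c} {c′} {ε = ε} h h′ (mkGood p q a b sz r) = mkGood (p ∸ k) (q + k)
    (+-cancelˡ-≤ k _ _ (≤-trans h (≤-trans a (≤-reflexive (sym e)))))
    (≤-trans h′ (+-monoˡ-≤ k b))
    (trans (ring (p ∸ k) q k) (trans (cong (_+ q) e) sz))
    (≋-trans (≋-sym (≋-drop 1)) (≋-trans (≡⇒≋ (trans (ring₂ (p ∸ k) ε k) (cong (_+ ε) e))) r))
    where
    e : k + (p ∸ k) ≡ p
    e = m+[n∸m]≡n (≤-trans (m≤m+n k c) (≤-trans h a))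
    ring : ∀ x q k → x + (q + k) ≡ k + x + q
    ring = solve-∀
    ring₂ : ∀ x ε k → x + ε + 1 * k ≡ k + x + ε
    ring₂ = solve-∀

  rotateˡ : ∀ {c c′ c₁ c₂ s ε ρ} → c ≤ c₁ + k → k + c′ ≤ c₂ → Good c₁ c₂ s ε ρ → Good c c′ s ε ρ
  rotateˡ {c} {c′} {ε = ε} h h′ (mkGood p q a b sz r) = mkGood (p + k) (q ∸ k)
    (≤-trans h (+-monoˡ-≤ k a))
    (+-cancelˡ-≤ k _ _ (≤-trans h′ (≤-trans b (≤-reflexive (sym e)))))
    (trans (+-assoc p k (q ∸ k)) (trans (cong (p +_) e) sz))
    (≋-trans (≡⇒≋ (ring p ε k)) (≋-trans (≋-drop 1) r))
    where
    e : k + (q ∸ k) ≡ q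
    e = m+[n∸m]≡n (≤-trans (m≤m+n k c′) (≤-trans h′ b))
    ring : ∀ p ε k → p + k + ε ≡ p + ε + 1 * k
    ring = solve-∀

-- Sums over lists, and edge lists

χ : Bool → ℕ
χ b = if b then 1 else 0

tot : {A : Set} → (A → ℕ) → List A → ℕ
tot f []       = 0
tot f (x ∷ xs) = f x + tot f xs

interchange : ∀ a b c d → (a + b) + (c + d) ≡ (a + c) + (b + d)
interchange = solve-∀

x+y+z≡y+x+z : ∀ x y z → x + (y + z) ≡ y + (x + z)
x+y+z≡y+x+z = solve-∀

module _ {A : Set} where

  tot-cong : {f g : A → ℕ} → (∀ x → f x ≡ g x) → ∀ L → tot f L ≡ tot g L
  tot-cong h []      = refl
  tot-cong h (x ∷ L) = cong₂ _+_ (h x) (tot-cong h L)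

  tot-cong-All : {P : A → Set} {f g : A → ℕ} → (∀ x → P x → f x ≡ g x) →
    ∀ {L} → All P L → tot f L ≡ tot g L
  tot-cong-All h []       = refl
  tot-cong-All h (p ∷ ps) = cong₂ _+_ (h _ p) (tot-cong-All h ps)

  tot-mono : {f g : A → ℕ} → (∀ x → f x ≤ g x) → ∀ L → tot f L ≤ tot g L
  tot-mono h []      = z≤n
  tot-mono h (x ∷ L) = +-mono-≤ (h x) (tot-mono h L)

  tot-+ : (f g : A → ℕ) → ∀ L → tot (λ x → f x + g x) L ≡ tot f L + tot g L
  tot-+ f g []      = refl
  tot-+ f g (x ∷ L) = trans (cong (f x + g x +_) (tot-+ f g L))
    (interchange (f x) (g x) (tot f L) (tot g L))

  tot-* : (c : ℕ) (f : A → ℕ) → ∀ L → tot (λ x → c * f x) L ≡ c * tot f L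
  tot-* c f []      = sym (*-zeroʳ c)
  tot-* c f (x ∷ L) = trans (cong (c * f x +_) (tot-* c f L)) (sym (*-distribˡ-+ c (f x) (tot f L)))

  tot-0 : ∀ L → tot {A} (λ _ → 0) L ≡ 0
  tot-0 []      = refl
  tot-0 (x ∷ L) = tot-0 L

  tot-++ : (f : A → ℕ) → ∀ L M → tot f (L ++ M) ≡ tot f L + tot f M
  tot-++ f []      M = refl
  tot-++ f (x ∷ L) M = trans (cong (f x +_) (tot-++ f L M)) (sym (+-assoc (f x) _ _))

  tot-map : {B : Set} (f : B → ℕ) (h : A → B) → ∀ L → tot f (map h L) ≡ tot (f ∘ h) L
  tot-map f h []      = refl
  tot-map f h (x ∷ L) = cong (f (h x) +_) (tot-map f h L)

  tot-filter : (f : A → ℕ) (P : A → Bool) → ∀ L →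
    tot f (filterᵇ P L) ≡ tot (λ x → if P x then f x else 0) L
  tot-filter f P []      = refl
  tot-filter f P (x ∷ L) with P x
  ... | true  = cong (f x +_) (tot-filter f P L)
  ... | false = tot-filter f P L

  tot-replicate : (f : A → ℕ) → ∀ m x → tot f (replicate m x) ≡ m * f x
  tot-replicate f zero    x = refl
  tot-replicate f (suc m) x = cong (f x +_) (tot-replicate f m x)

  tot-const : ∀ L → tot {A} (λ _ → 1) L ≡ length L
  tot-const []      = refl
  tot-const (x ∷ L) = cong suc (tot-const L)

-- Demands are multisets, from which nothing can be subtracted. As K ≡ -1 modulo k, adding K copies
-- takes the place of subtracting one.
mul : {A : Set} → ℕ → List A → List A
mul m = concatMap (replicate m)

tot-mul : {A : Set} (f : A → ℕ) → ∀ m L → tot f (mul m L) ≡ m * tot f L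
tot-mul f m []      = sym (*-zeroʳ m)
tot-mul f m (x ∷ L) = trans (tot-++ f (replicate m x) (mul m L))
  (trans (cong₂ _+_ (tot-replicate f m x) (tot-mul f m L)) (sym (*-distribˡ-+ m (f x) (tot f L))))

module Edges (V : Set) where

  Edge : Set
  Edge = V × V

  VSet : Set
  VSet = V → Bool

  full : VSet
  full _ = true

  wt : List V → VSet → ℕ
  wt L C = tot (χ ∘ C) L

  cutF insF outF : VSet → Edge → ℕ
  cutF C (u , v) = χ (C u xor C v)
  insF C (u , v) = χ (C u ∧ C v)
  outF C (u , v) = χ (C u)

  -- out and inn are meant for lists of oriented edges (tail , head).
  cut ins out inn : List Edge → VSet → ℕ
  cut E C = tot (cutF C) E
  ins E C = tot (insF C) E
  out O C = tot (outF C) O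
  inn O C = tot (λ e → χ (C (proj₂ e))) O

  -- The order of the list is kept, so that directions and colours can later be read back edge by
  -- edge.
  data Orients : List Edge → List Edge → Set where
    []   : Orients [] []
    keep : ∀ {u v E O} → Orients E O → Orients ((u , v) ∷ E) ((u , v) ∷ O)
    flip : ∀ {u v E O} → Orients E O → Orients ((u , v) ∷ E) ((v , u) ∷ O)

  infix 4 _~_
  -- Equality as multisets of unordered pairs; it lets an edge found anywhere be moved to the front.
  data _~_ : List Edge → List Edge → Set where
    ~-refl  : ∀ {E} → E ~ E
    ~-flip  : ∀ {u v E} → (u , v) ∷ E ~ (v , u) ∷ E
    ~-swap  : ∀ {e f E} → e ∷ f ∷ E ~ f ∷ e ∷ E
    ~-prep  : ∀ {e E F} → E ~ F → e ∷ E ~ e ∷ F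
    ~-trans : ∀ {E F G} → E ~ F → F ~ G → E ~ G

  Symmetric : (Edge → ℕ) → Set
  Symmetric f = ∀ u v → f (u , v) ≡ f (v , u)

  tot-~ : ∀ {f} → Symmetric f → ∀ {E F} → E ~ F → tot f E ≡ tot f F
  tot-~ s ~-refl = refl
  tot-~ {f} s (~-flip {u} {v} {E}) = cong (_+ tot f E) (s u v)
  tot-~ {f} s (~-swap {e} {g} {E}) = trans (sym (+-assoc (f e) (f g) _))
    (trans (cong (_+ tot f E) (+-comm (f e) (f g))) (+-assoc (f g) (f e) _))
  tot-~ s (~-prep p) = cong (_ +_) (tot-~ s p)
  tot-~ s (~-trans p q) = trans (tot-~ s p) (tot-~ s q)

  cutF-sym : ∀ C → Symmetric (cutF C)
  cutF-sym C u v with C u | C v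
  ... | true  | true  = refl
  ... | true  | false = refl
  ... | false | true  = refl
  ... | false | false = refl

  insF-sym : ∀ C → Symmetric (insF C)
  insF-sym C u v with C u | C v
  ... | true  | true  = refl
  ... | true  | false = refl
  ... | false | true  = refl
  ... | false | false = refl

  cut-~ : ∀ {E F} → E ~ F → ∀ C → cut E C ≡ cut F C
  cut-~ p C = tot-~ (cutF-sym C) p

  ins-~ : ∀ {E F} → E ~ F → ∀ C → ins E C ≡ ins F C
  ins-~ p C = tot-~ (insF-sym C) p

  length-~ : ∀ {E F} → E ~ F → length E ≡ length F
  length-~ {E} {F} p = trans (sym (tot-const E)) (trans (tot-~ (λ _ _ → refl) p) (tot-const F))

  module _ {P : V → Set} where

    Both : Edge → Set
    Both (u , v) = P u × P v

    All-~ : ∀ {E F} → E ~ F → All Both E → All Both F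
    All-~ ~-refl ps = ps
    All-~ ~-flip ((p , q) ∷ ps) = (q , p) ∷ ps
    All-~ ~-swap (p ∷ q ∷ ps) = q ∷ p ∷ ps
    All-~ (~-prep r) (p ∷ ps) = p ∷ All-~ r ps
    All-~ (~-trans r s) ps = All-~ s (All-~ r ps)

  orients⇒~ : ∀ {E O} → Orients E O → E ~ O
  orients⇒~ []       = ~-refl
  orients⇒~ (keep o) = ~-prep (orients⇒~ o)
  orients⇒~ (flip o) = ~-trans ~-flip (~-prep (orients⇒~ o))

  orients-refl : ∀ E → Orients E E
  orients-refl []      = []
  orients-refl (e ∷ E) = keep (orients-refl E)

  -- `O′` is a rearrangement of `O`. Equality of all sums expresses this, and nothing finer is ever
  -- asked of an orientation.
  orients-~ : ∀ {E F} → E ~ F → ∀ {O} → Orients F O →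
    ∃ λ O′ → Orients E O′ × (∀ f → tot f O′ ≡ tot f O)
  orients-~ ~-refl o = _ , o , λ f → refl
  orients-~ ~-flip (keep o) = _ , flip o , λ f → refl
  orients-~ ~-flip (flip o) = _ , keep o , λ f → refl
  orients-~ ~-swap (keep (keep o)) = _ , keep (keep o) , λ f → x+y+z≡y+x+z (f _) (f _) _
  orients-~ ~-swap (keep (flip o)) = _ , flip (keep o) , λ f → x+y+z≡y+x+z (f _) (f _) _
  orients-~ ~-swap (flip (keep o)) = _ , keep (flip o) , λ f → x+y+z≡y+x+z (f _) (f _) _
  orients-~ ~-swap (flip (flip o)) = _ , flip (flip o) , λ f → x+y+z≡y+x+z (f _) (f _) _
  orients-~ (~-prep p) (keep o) with orients-~ p o
  ... | O′ , o′ , h = _ , keep o′ , λ f → cong (f _ +_) (h f)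
  orients-~ (~-prep p) (flip o) with orients-~ p o
  ... | O′ , o′ , h = _ , flip o′ , λ f → cong (f _ +_) (h f)
  orients-~ (~-trans p q) o with orients-~ q o
  ... | O₁ , o₁ , h₁ with orients-~ p o₁
  ... | O₂ , o₂ , h₂ = O₂ , o₂ , λ f → trans (h₂ f) (h₁ f)

  -- Both sides count the edge ends in C.
  out+inn : ∀ {E O} → Orients E O → ∀ C → out O C + inn O C ≡ cut E C + (ins E C + ins E C)
  out+inn {E} {O} o C = begin
    out O C + inn O C
      ≡⟨ tot-+ (outF C) _ O ⟨
    tot (λ e → outF C e + χ (C (proj₂ e))) O
      ≡⟨ tot-cong (λ (u , v) → pt (C u) (C v)) O ⟩
    tot (λ e → cutF C e + (insF C e + insF C e)) O
      ≡⟨ tot-+ (cutF C) _ O ⟩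
    cut O C + tot (λ e → insF C e + insF C e) O
      ≡⟨ cong (cut O C +_) (tot-+ (insF C) _ O) ⟩
    cut O C + (ins O C + ins O C)
      ≡⟨ cong₂ (λ a b → a + (b + b)) (cut-~ (orients⇒~ o) C) (ins-~ (orients⇒~ o) C) ⟨
    cut E C + (ins E C + ins E C) ∎
    where
    open ≡-Reasoning
    pt : ∀ x y → χ x + χ y ≡ χ (x xor y) + (χ (x ∧ y) + χ (x ∧ y))
    pt true  true  = refl
    pt true  false = refl
    pt false true  = refl
    pt false false = refl

  ins≤out : ∀ {E O} → Orients E O → ∀ C → ins E C ≤ out O C
  ins≤out {E} {O} o C = ≤-trans (≤-reflexive (ins-~ (orients⇒~ o) C))
    (tot-mono (λ (u , v) → pt (C u) (C v)) O)
    where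
    pt : ∀ x y → χ (x ∧ y) ≤ χ x
    pt true  true  = s≤s z≤n
    pt true  false = z≤n
    pt false y     = z≤n

  out≤cut+ins : ∀ {E O} → Orients E O → ∀ C → out O C ≤ cut E C + ins E C
  out≤cut+ins {E} {O} o C = ≤-trans (tot-mono (λ (u , v) → pt (C u) (C v)) O)
    (≤-reflexive (trans (tot-+ (cutF C) (insF C) O)
      (sym (cong₂ _+_ (cut-~ (orients⇒~ o) C) (ins-~ (orients⇒~ o) C)))))
    where
    pt : ∀ x y → χ x ≤ χ (x xor y) + χ (x ∧ y)
    pt true  true  = s≤s z≤n
    pt true  false = s≤s z≤n
    pt false y     = z≤n

  isolated⇒out≡ins : ∀ {E O} → Orients E O → ∀ C → cut E C ≡ 0 → out O C ≡ ins E C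
  isolated⇒out≡ins {E} o C h = ≤-antisym
    (≤-trans (out≤cut+ins o C) (≤-reflexive (cong (_+ ins E C) h))) (ins≤out o C)

  crossing : ∀ E C → cut E C ≢ 0 →
    ∃ λ x → ∃ λ y → ∃ λ E₀ → C x ≡ true × C y ≡ false × E ~ (x , y) ∷ E₀
  crossing [] C h = contradiction refl h
  crossing ((u , v) ∷ E) C h with C u in p | C v in q
  ... | true  | false = u , v , E , p , q , ~-refl
  ... | false | true  = v , u , E , q , p , ~-flip
  ... | true  | true  with crossing E C h
  ...   | x , y , E₀ , a , b , r = x , y , (u , v) ∷ E₀ , a , b , ~-trans (~-prep r) ~-swap
  crossing ((u , v) ∷ E) C h | false | false with crossing E C h
  ...   | x , y , E₀ , a , b , r = x , y , (u , v) ∷ E₀ , a , b , ~-trans (~-prep r) ~-swap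

  pick : ∀ L C → wt L C ≢ 0 → ∃ λ x → ∃ λ L₀ → C x ≡ true ×
    (∀ D → wt L D ≡ χ (D x) + wt L₀ D) × (∀ {P : V → Set} → All P L → P x × All P L₀)
  pick [] C h = contradiction refl h
  pick (v ∷ L) C h with C v in p
  ... | true  = v , L , p , (λ D → refl) , λ { (a ∷ as) → a , as }
  ... | false with pick L C h
  ...   | x , L₀ , q , e , s = x , v ∷ L₀ , q ,
            (λ D → trans (cong (χ (D v) +_) (e D)) (x+y+z≡y+x+z (χ (D v)) (χ (D x)) _)) ,
            λ { (a ∷ as) → proj₁ (s as) , a ∷ proj₂ (s as) }

  module _ (φ : V → V) where

    mapE : List Edge → List Edge
    mapE = map (λ (u , v) → φ u , φ v)

    orients-mapE : ∀ E {O} → Orients (mapE E) O → ∃ λ O′ → Orients E O′ × (∀ C → out O C ≡ out O′ (C ∘ φ))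
    orients-mapE [] [] = [] , [] , λ C → refl
    orients-mapE (e ∷ E) (keep o) with orients-mapE E o
    ... | O′ , o′ , h = _ , keep o′ , λ C → cong (χ (C (φ (proj₁ e))) +_) (h C)
    orients-mapE (e ∷ E) (flip o) with orients-mapE E o
    ... | O′ , o′ , h = _ , flip o′ , λ C → cong (χ (C (φ (proj₂ e))) +_) (h C)

    cut-mapE : ∀ E C → cut (mapE E) C ≡ cut E (C ∘ φ)
    cut-mapE E C = tot-map (cutF C) _ E

    ins-mapE : ∀ E C → ins (mapE E) C ≡ ins E (C ∘ φ)
    ins-mapE E C = tot-map (insF C) _ E

    wt-map : ∀ L C → wt (map φ L) C ≡ wt L (C ∘ φ)
    wt-map L C = tot-map (χ ∘ C) φ L

  ~-sym : ∀ {E F} → E ~ F → F ~ E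
  ~-sym ~-refl        = ~-refl
  ~-sym ~-flip        = ~-flip
  ~-sym ~-swap        = ~-swap
  ~-sym (~-prep p)    = ~-prep (~-sym p)
  ~-sym (~-trans p q) = ~-trans (~-sym q) (~-sym p)

  ~-shift : ∀ L {e F} → e ∷ L ++ F ~ L ++ e ∷ F
  ~-shift []      = ~-refl
  ~-shift (f ∷ L) = ~-trans ~-swap (~-prep (~-shift L))

  orients-++ : ∀ {E F O Q} → Orients E O → Orients F Q → Orients (E ++ F) (O ++ Q)
  orients-++ [] q       = q
  orients-++ (keep o) q = keep (orients-++ o q)
  orients-++ (flip o) q = flip (orients-++ o q)

  orients-split : ∀ E {F O} → Orients (E ++ F) O →
    ∃ λ O₁ → ∃ λ O₂ → Orients E O₁ × Orients F O₂ × (∀ C → out O C ≡ out O₁ C + out O₂ C)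
  orients-split []      o = [] , _ , [] , o , λ C → refl
  orients-split (e ∷ E) (keep o) with orients-split E o
  ... | O₁ , O₂ , o₁ , o₂ , h = _ , O₂ , keep o₁ , o₂ ,
          λ C → trans (cong (χ (C (proj₁ e)) +_) (h C)) (sym (+-assoc (χ (C (proj₁ e))) _ _))
  orients-split (e ∷ E) (flip o) with orients-split E o
  ... | O₁ , O₂ , o₁ , o₂ , h = _ , O₂ , flip o₁ , o₂ ,
          λ C → trans (cong (χ (C (proj₂ e)) +_) (h C)) (sym (+-assoc (χ (C (proj₂ e))) _ _))

  orients-parallel : ∀ c {u v} → ∃ λ O → Orients (replicate (c + c) (u , v)) O ×
    (∀ C → out O C ≡ c * χ (C u) + c * χ (C v))
  orients-parallel zero = [] , [] , λ C → refl
  orients-parallel (suc c) {u} {v} rewrite +-suc c c with orients-parallel c {u} {v}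
  ... | O , o , h = _ , keep (flip o) , λ C → trans (cong (λ x → χ (C u) + (χ (C v) + x)) (h C))
          (ring (χ (C u)) (χ (C v)) (c * χ (C u)) (c * χ (C v)))
    where
    ring : ∀ x y z w → x + (y + (z + w)) ≡ x + z + (y + w)
    ring = solve-∀

-- Orientations with nearly equal in- and out-degrees

module Even (V : Set) (_≟V_ : DecidableEquality V) where

  open Edges V

  at : V → VSet
  at v u = ⌊ u ≟V v ⌋

  at-refl : ∀ v → at v v ≡ true
  at-refl v with v ≟V v
  ... | yes _ = refl
  ... | no h  = contradiction refl h

  at-≢ : ∀ {u v} → u ≢ v → at v u ≡ false
  at-≢ {u} {v} h with u ≟V v
  ... | yes p = contradiction p h
  ... | no _  = refl

  Even : List Edge → V → Set
  Even O v = out O (at v) ≤ 1 + inn O (at v) × inn O (at v) ≤ 1 + out O (at v)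

  EvenOrientation : List Edge → Set
  EvenOrientation E = ∃ λ O → Orients E O × (∀ v → Even O v)

  transport-even : ∀ {E F} → E ~ F → EvenOrientation F → EvenOrientation E
  transport-even p (O , o , h) with orients-~ p o
  ... | O′ , o′ , e = O′ , o′ , λ v →
    subst₂ (λ a b → a ≤ 1 + b × b ≤ 1 + a) (sym (e (outF (at v)))) (sym (e (λ f → χ (at v (proj₂ f))))) (h v)

  incident : ∀ z E → (∃ λ u → ∃ λ E₀ → E ~ (z , u) ∷ E₀) ⊎ (out E (at z) + inn E (at z) ≡ 0)
  incident z [] = inj₂ refl
  incident z ((x , y) ∷ E) with x ≟V z | y ≟V z
  ... | yes refl | _        = inj₁ (y , E , ~-refl)
  ... | no _     | yes refl = inj₁ (x , E , ~-flip)
  ... | no _     | no _     with incident z E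
  ...   | inj₁ (u , E₀ , p) = inj₁ (u , (x , y) ∷ E₀ , ~-trans (~-prep p) ~-swap)
  ...   | inj₂ h            = inj₂ h

  -- The directed edge between u and v becomes a path through x, which enters and leaves x once and
  -- so keeps every difference of out- and in-degree.
  unsplit : ∀ x u v {E} → EvenOrientation ((u , v) ∷ E) → EvenOrientation ((x , u) ∷ (x , v) ∷ E)
  unsplit x u v (_ , keep {O = O} o , h) = _ , flip (keep o) , λ z → shift (χ (at z u)) (χ (at z x)) (χ (at z v)) (out O (at z)) (inn O (at z)) (h z)
    where
    shift : ∀ a c b o i → a + o ≤ 1 + (b + i) × b + i ≤ 1 + (a + o) →
      a + (c + o) ≤ 1 + (c + (b + i)) × c + (b + i) ≤ 1 + (a + (c + o))
    shift a c b o i (p , q) rewrite x+y+z≡y+x+z a c o | sym (+-suc c (b + i)) | sym (+-suc c (a + o)) =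
      +-monoʳ-≤ c p , +-monoʳ-≤ c q
  unsplit x u v (_ , flip {O = O} o , h) = _ , keep (flip o) , λ z → shift (χ (at z v)) (χ (at z x)) (χ (at z u)) (out O (at z)) (inn O (at z)) (h z)
    where
    shift : ∀ a c b o i → a + o ≤ 1 + (b + i) × b + i ≤ 1 + (a + o) →
      c + (a + o) ≤ 1 + (b + (c + i)) × b + (c + i) ≤ 1 + (c + (a + o))
    shift a c b o i (p , q) rewrite x+y+z≡y+x+z b c i | sym (+-suc c (b + i)) | sym (+-suc c (a + o)) =
      +-monoʳ-≤ c p , +-monoʳ-≤ c q

  -- Split off pairs of edges at a vertex until all degrees are at most 1.
  even-orientation : ∀ E → EvenOrientation E
  even-orientation E = go E (<-wellFounded (length E))
    where
    go : ∀ E → Acc _<_ (length E) → EvenOrientation E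
    go [] _ = [] , [] , λ v → z≤n , z≤n
    go ((x , y) ∷ E) (acc rec) with incident x E | incident y E
    ... | inj₁ (u , E₀ , p) | _ = transport-even (~-prep p) (unsplit x y u
            (go ((y , u) ∷ E₀) (rec (≤-reflexive (cong suc (sym (length-~ p)))))))
    ... | inj₂ _ | inj₁ (u , E₀ , p) = transport-even (~-trans ~-flip (~-prep p)) (unsplit y x u
            (go ((x , u) ∷ E₀) (rec (≤-reflexive (cong suc (sym (length-~ p)))))))
    -- Neither end meets another edge, so any direction gives a difference of at most 1 there.
    ... | inj₂ isox | inj₂ isoy with go E (rec ≤-refl)
    ...   | O , o , h = _ , keep o , even
      where
      unmet : ∀ z → out E (at z) + inn E (at z) ≡ 0 → out O (at z) ≡ 0 × inn O (at z) ≡ 0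
      unmet z iso = m+n≡0⇒m≡0 _ e , m+n≡0⇒n≡0 (out O (at z)) e
        where
        e : out O (at z) + inn O (at z) ≡ 0
        e = trans (out+inn o (at z)) (trans (sym (out+inn (orients-refl E) (at z))) iso)
      small : ∀ a b {o i} → o ≡ 0 × i ≡ 0 → χ a + o ≤ 1 + (χ b + i) × χ b + i ≤ 1 + (χ a + o)
      small true  true  (refl , refl) = s≤s z≤n , s≤s z≤n
      small true  false (refl , refl) = s≤s z≤n , z≤n
      small false true  (refl , refl) = z≤n , s≤s z≤n
      small false false (refl , refl) = z≤n , z≤n
      even : ∀ v → Even ((x , y) ∷ O) v
      even v with x ≟V v | y ≟V v
      ... | yes refl | r        = small true ⌊ r ⌋ (unmet x isox)
      ... | no _     | yes refl = small false true (unmet y isoy)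
      ... | no _     | no _     = h v

-- Graphs with a root, and gluing of orientations

module Nets (K n : ℕ) where

  open Mod K public
  open Edges (Fin n) public

  V : Set
  V = Fin n

  open Even V _≟F_ public using (even-orientation) renaming (at to is; at-refl to is-refl; at-≢ to ≢⇒¬is)

  is⇒≡ : ∀ {u v} → is v u ≡ true → u ≡ v
  is⇒≡ {u} {v} h with u ≟F v
  ... | yes p = p

  -- `U` holds the vertices other than the root and `W` marks the exempt ones. `a` and `b` list,
  -- with multiplicity, the ends of the root edges entering and leaving these vertices; `R` lists
  -- the out-degrees demanded in `E` modulo k.
  record Net : Set where
    constructor mkNet
    field
      U W   : VSet
      E     : List Edge
      a b R : List V

    -- `R` speaks of `E` only, whereas p counts all edges leaving C; hence the root edges in `b` are
    -- added to the demand.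
    size dem : VSet → ℕ
    size C = cut E C + (wt a C + wt b C)
    dem C  = wt R C + wt b C

    GoodAt : ℕ → ℕ → VSet → Set
    GoodAt c c′ C = Good c c′ (size C) (ins E C) (dem C)

    BalAt : VSet → Set
    BalAt C = Bal (size C) (ins E C) (dem C)

    Hits Misses Multi : VSet → Set
    Hits C   = ∃ λ t → U t ≡ true × W t ≡ false × C t ≡ true
    Misses C = ∃ λ y → U y ≡ true × C y ≡ false
    Multi C  = ∃ λ x → ∃ λ y → x ≢ y × (U x ≡ true × C x ≡ true) × (U y ≡ true × C y ≡ true)

  -- The root degrees that can arise when the root is the outside of a set without p, q ≥ k: both
  -- below 2k and one of them below k.
  Region : ℕ → ℕ → Set
  Region a b = a ≤ K + k × b ≤ K + k × (a ≤ K ⊎ b ≤ K)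

  -- `total` is forced, as out-degrees sum to the number of edges. `term` provides a vertex with
  -- which an exempt one can be merged.
  record Valid (N : Net) : Set where
    constructor mkValid
    open Net N
    field
      supE  : All (Both {λ v → U v ≡ true}) E
      supa  : All (λ v → U v ≡ true) a
      supb  : All (λ v → U v ≡ true) b
      supR  : All (λ v → U v ≡ true) R
      total : wt R full ≋ ins E full
      root  : Region (wt a full) (wt b full)
      sets  : ∀ C → Hits C → Misses C → GoodAt K K C
      bals  : ∀ w → U w ≡ true → W w ≡ true → BalAt (is w)
      term  : ∃ λ t → U t ≡ true × W t ≡ false

  Sol : List Edge → List V → Set
  Sol E R = ∃ λ O → Orients E O × (∀ v → out O (is v) ≋ wt R (is v))

  wt-cong : ∀ L {C D} → C ≗ D → wt L C ≡ wt L D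
  wt-cong L h = tot-cong (λ v → cong χ (h v)) L

  cut-cong : ∀ E {C D} → C ≗ D → cut E C ≡ cut E D
  cut-cong E h = tot-cong (λ (u , v) → cong₂ (λ x y → χ (x xor y)) (h u) (h v)) E

  ins-cong : ∀ E {C D} → C ≗ D → ins E C ≡ ins E D
  ins-cong E h = tot-cong (λ (u , v) → cong₂ (λ x y → χ (x ∧ y)) (h u) (h v)) E

  out-cong : ∀ O {C D} → C ≗ D → out O C ≡ out O D
  out-cong O h = tot-cong (λ (u , v) → cong χ (h u)) O

  transport : (P : ℕ → ℕ → ℕ → Set) → ∀ {s s′ ε ε′ ρ ρ′} → s ≡ s′ → ε ≡ ε′ → ρ ≡ ρ′ → P s ε ρ → P s′ ε′ ρ′
  transport P refl refl refl p = p

  -- Contraction keeps the type of vertices and the number of edges: those inside B become loops at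
  -- β, and `ins` still counts them.
  collapse : VSet → V → V → V
  collapse B β v = if B v then β else v

  module _ (B : VSet) where

    collapse-fibre : ∀ β → B β ≡ true → is β ∘ collapse B β ≗ B
    collapse-fibre β Bβ v with B v in p
    ... | true  = is-refl β
    ... | false = ≢⇒¬is λ { refl → true≢false Bβ p }

    collapse-other : ∀ β → B β ≡ true → ∀ v → B v ≡ false → is v ∘ collapse B β ≗ is v
    collapse-other β Bβ v p u with B u in q
    ... | false = refl
    ... | true  = trans (≢⇒¬is λ { refl → true≢false Bβ p }) (sym (≢⇒¬is λ { refl → true≢false q p }))

    inside : List Edge → List Edge
    inside = filterᵇ (λ (u , v) → B u ∧ B v)

    outs inns : List Edge → List V
    outs O = map proj₁ (filterᵇ (λ (s , t) → B s ∧ not (B t)) O)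
    inns O = map proj₂ (filterᵇ (λ (s , t) → not (B s) ∧ B t) O)

    restF : VSet → Edge → ℕ
    restF C (s , t) = χ (not (B s ∧ B t) ∧ C s)

    meet : VSet → VSet
    meet C v = C v ∧ B v

    -- The loops at the contracted vertex come with arbitrary directions; `O′` overwrites them, and
    -- `restF` collects the tails of all other edges.
    replaceInside : ∀ E {O O′} → Orients E O → Orients (inside E) O′ →
      ∃ λ O″ → Orients E O″ × (∀ C → out O″ C ≡ out O′ C + tot (restF C) O)
    replaceInside [] [] [] = [] , [] , λ C → refl
    replaceInside ((u , v) ∷ E) (keep o) o′ with B u ∧ B v
    replaceInside ((u , v) ∷ E) (keep o) (keep o′) | true with replaceInside E o o′
    ... | O″ , o″ , h = _ , keep o″ , λ C → trans (cong (χ (C u) +_) (h C)) (sym (+-assoc (χ (C u)) _ _))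
    replaceInside ((u , v) ∷ E) (keep o) (flip o′) | true with replaceInside E o o′
    ... | O″ , o″ , h = _ , flip o″ , λ C → trans (cong (χ (C v) +_) (h C)) (sym (+-assoc (χ (C v)) _ _))
    replaceInside ((u , v) ∷ E) {_ ∷ O} {O′} (keep o) o′ | false with replaceInside E o o′
    ... | O″ , o″ , h = _ , keep o″ , λ C → trans (cong (χ (C u) +_) (h C)) (x+y+z≡y+x+z (χ (C u)) (out O′ C) (tot (restF C) O))
    replaceInside ((u , v) ∷ E) (flip o) o′ rewrite ∧-comm (B v) (B u) with B u ∧ B v
    replaceInside ((u , v) ∷ E) (flip o) (keep o′) | true with replaceInside E o o′
    ... | O″ , o″ , h = _ , keep o″ , λ C → trans (cong (χ (C u) +_) (h C)) (sym (+-assoc (χ (C u)) _ _))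
    replaceInside ((u , v) ∷ E) (flip o) (flip o′) | true with replaceInside E o o′
    ... | O″ , o″ , h = _ , flip o″ , λ C → trans (cong (χ (C v) +_) (h C)) (sym (+-assoc (χ (C v)) _ _))
    replaceInside ((u , v) ∷ E) {_ ∷ O} {O′} (flip o) o′ | false with replaceInside E o o′
    ... | O″ , o″ , h = _ , flip o″ , λ C → trans (cong (χ (C v) +_) (h C)) (x+y+z≡y+x+z (χ (C v)) (out O′ C) (tot (restF C) O))

    wt-filter : ∀ L C → wt (filterᵇ B L) C ≡ wt L (meet C)
    wt-filter L C = trans (tot-filter (χ ∘ C) B L) (tot-cong (λ v → pt (B v) (C v)) L)
      where
      pt : ∀ x y → (if x then χ y else 0) ≡ χ (y ∧ x)
      pt true  true  = refl
      pt true  false = refl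
      pt false true  = refl
      pt false false = refl

    wt-outs : ∀ O C → wt (outs O) C ≡ tot (λ (s , t) → if B s ∧ not (B t) then χ (C s) else 0) O
    wt-outs O C = trans (tot-map (χ ∘ C) proj₁ (filterᵇ (λ (s , t) → B s ∧ not (B t)) O))
      (tot-filter (outF C) (λ (s , t) → B s ∧ not (B t)) O)

    wt-inns : ∀ O C → wt (inns O) C ≡ tot (λ (s , t) → if not (B s) ∧ B t then χ (C t) else 0) O
    wt-inns O C = trans (tot-map (χ ∘ C) proj₂ (filterᵇ (λ (s , t) → not (B s) ∧ B t) O))
      (tot-filter (λ e → χ (C (proj₂ e))) (λ (s , t) → not (B s) ∧ B t) O)

    ins-inside : ∀ E C → ins (inside E) C ≡ ins E (meet C)
    ins-inside E C = trans (tot-filter (insF C) _ E)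
      (tot-cong (λ (u , v) → pt (B u) (B v) (C u) (C v)) E)
      where
      pt : ∀ x y z w → (if x ∧ y then χ (z ∧ w) else 0) ≡ χ ((z ∧ x) ∧ (w ∧ y))
      pt true  true  true  true  = refl
      pt true  true  true  false = refl
      pt true  true  false w     = refl
      pt true  false true  true  = refl
      pt true  false true  false = refl
      pt true  false false w     = refl
      pt false y     true  w     = refl
      pt false y     false w     = refl

    cut-inside : ∀ {E O} → Orients E O → ∀ C →
      cut (inside E) C + (wt (inns O) C + wt (outs O) C) ≡ cut E (meet C)
    cut-inside {E} {O} o C = begin
      cut (inside E) C + (wt (inns O) C + wt (outs O) C)
        ≡⟨ cong₂ _+_ (trans (tot-filter (cutF C) _ E) (tot-~ (λ u v → symm (B u) (B v) (C u) (C v)) (orients⇒~ o)))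
                     (cong₂ _+_ (wt-inns O C) (wt-outs O C)) ⟩
      tot f O + (tot g O + tot h O)
        ≡⟨ cong (tot f O +_) (tot-+ g h O) ⟨
      tot f O + tot (λ e → g e + h e) O
        ≡⟨ tot-+ f (λ e → g e + h e) O ⟨
      tot (λ e → f e + (g e + h e)) O
        ≡⟨ tot-cong (λ (s , t) → pt (B s) (B t) (C s) (C t)) O ⟩
      cut O (meet C)
        ≡⟨ cut-~ (orients⇒~ o) (meet C) ⟨
      cut E (meet C) ∎
      where
      open ≡-Reasoning
      f g h : Edge → ℕ
      f (s , t) = if B s ∧ B t then χ (C s xor C t) else 0
      g (s , t) = if not (B s) ∧ B t then χ (C t) else 0
      h (s , t) = if B s ∧ not (B t) then χ (C s) else 0
      symm : ∀ x y z w → (if x ∧ y then χ (z xor w) else 0) ≡ (if y ∧ x then χ (w xor z) else 0)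
      symm true  true  true  true  = refl
      symm true  true  true  false = refl
      symm true  true  false true  = refl
      symm true  true  false false = refl
      symm true  false z     w     = refl
      symm false true  z     w     = refl
      symm false false z     w     = refl
      pt : ∀ x y z w → (if x ∧ y then χ (z xor w) else 0) +
        ((if not x ∧ y then χ w else 0) + (if x ∧ not y then χ z else 0)) ≡ χ ((z ∧ x) xor (w ∧ y))
      pt true  true  true  true  = refl
      pt true  true  true  false = refl
      pt true  true  false true  = refl
      pt true  true  false false = refl
      pt true  false true  true  = refl
      pt true  false true  false = refl
      pt true  false false true  = refl
      pt true  false false false = refl
      pt false true  true  true  = refl
      pt false true  true  false = refl
      pt false true  false true  = refl
      pt false true  false false = refl
      pt false false true  true  = refl
      pt false false true  false = refl
      pt false false false true  = refl
      pt false false false false = refl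

    out-split : ∀ {E O} → Orients E O → wt (outs O) full + ins E B ≡ out O B
    out-split {E} {O} o = begin
      wt (outs O) full + ins E B
        ≡⟨ cong₂ _+_ (wt-outs O full) (ins-~ (orients⇒~ o) B) ⟩
      tot f O + ins O B
        ≡⟨ tot-+ f (insF B) O ⟨
      tot (λ e → f e + insF B e) O
        ≡⟨ tot-cong (λ (s , t) → pt (B s) (B t)) O ⟩
      out O B ∎
      where
      open ≡-Reasoning
      f : Edge → ℕ
      f (s , t) = if B s ∧ not (B t) then 1 else 0
      pt : ∀ x y → (if x ∧ not y then 1 else 0) + χ (x ∧ y) ≡ χ x
      pt true  true  = refl
      pt true  false = refl
      pt false y     = refl

    -- The edges of `O` that leave B already serve part of the demand. K copies of their tails
    -- subtract it modulo k.
    residual : List Edge → List V → List V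
    residual O R = filterᵇ B R ++ mul K (outs O)

    wt-residual : ∀ O R C → wt (residual O R) C + wt (outs O) C ≋ wt R (meet C)
    wt-residual O R C = ≋-trans (≡⇒≋ (begin
      wt (residual O R) C + wt (outs O) C
        ≡⟨ cong (_+ wt (outs O) C) (tot-++ (χ ∘ C) (filterᵇ B R) (mul K (outs O))) ⟩
      wt (filterᵇ B R) C + wt (mul K (outs O)) C + wt (outs O) C
        ≡⟨ cong₂ (λ x y → x + y + wt (outs O) C) (wt-filter R C) (tot-mul (χ ∘ C) K (outs O)) ⟩
      wt R (meet C) + K * wt (outs O) C + wt (outs O) C
        ≡⟨ ring (wt R (meet C)) K (wt (outs O) C) ⟩
      wt R (meet C) + wt (outs O) C * k ∎)) (≋-drop (wt (outs O) C))
      where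
      open ≡-Reasoning
      ring : ∀ r K x → r + K * x + x ≡ r + x * suc K
      ring = solve-∀

    -- An orientation of the contraction of B, followed by one inside B that takes the orientation
    -- of the edges leaving B into account.
    glue : ∀ {E R} β → B β ≡ true →
      Sol (mapE (collapse B β) E) (map (collapse B β) R) →
      (∀ O → Orients E O → out O B ≋ wt R B → Sol (inside E) (residual O R)) → Sol E R
    glue {E} {R} β Bβ (O₀ , o₀ , h₀) inner with orients-mapE (collapse B β) E o₀
    ... | O , o , e = solve (inner O o hB)
      where
      φ = collapse B β
      h : ∀ v → out O (is v ∘ φ) ≋ wt R (is v ∘ φ)
      h v = ≋-trans (≡⇒≋ (sym (e (is v)))) (≋-trans (h₀ v) (≡⇒≋ (wt-map φ R (is v))))
      hB : out O B ≋ wt R B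
      hB = ≋-trans (≡⇒≋ (sym (out-cong O (collapse-fibre β Bβ)))) (≋-trans (h β) (≡⇒≋ (wt-cong R (collapse-fibre β Bβ))))
      solve : Sol (inside E) (residual O R) → Sol E R
      solve (O′ , o′ , h′) with replaceInside E o o′
      ... | O″ , o″ , e″ = O″ , o″ , final
        where
        final : ∀ v → out O″ (is v) ≋ wt R (is v)
        final v with B v in p
        ... | false = ≋-trans (≡⇒≋ (trans (e″ (is v)) (cong₂ _+_ zero′ rest≡out)))
                        (≋-trans (≡⇒≋ (sym (out-cong O (collapse-other β Bβ v p))))
                        (≋-trans (h v) (≡⇒≋ (wt-cong R (collapse-other β Bβ v p)))))
          where
          meet≗ : meet (is v) ≗ λ _ → false
          meet≗ u with B u in q
          ... | true  = trans (∧-identityʳ _) (≢⇒¬is λ { refl → true≢false q p })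
          ... | false with is v u
          ...   | true  = refl
          ...   | false = refl
          zero′ : out O′ (is v) ≡ 0
          zero′ = n≤0⇒n≡0 (≤-trans (out≤cut+ins o′ (is v)) (≤-trans
            (+-monoˡ-≤ _ (≤-trans (m≤m+n _ _) (≤-reflexive (cut-inside o (is v)))))
            (≤-reflexive (cong₂ _+_ (trans (cut-cong E meet≗) (tot-0 E))
              (trans (ins-inside E (is v)) (trans (ins-cong E meet≗) (tot-0 E)))))))
          rest≡out : tot (restF (is v)) O ≡ out O (is v)
          rest≡out = tot-cong (λ (s , t) → pt s t) O
            where
            pt : ∀ s t → restF (is v) (s , t) ≡ χ (is v s)
            pt s t with s ≟F v
            ... | yes refl rewrite p = refl
            ... | no _ with B s ∧ B t
            ...   | true  = refl
            ...   | false = refl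
        ... | true = ≋-trans (≡⇒≋ (trans (e″ (is v)) (cong (out O′ (is v) +_) rest≡outs)))
                       (≋-trans (≋-+ (h′ v) ≋-refl)
                       (≋-trans (wt-residual O R (is v)) (≡⇒≋ (wt-cong R meet≗))))
          where
          meet≗ : meet (is v) ≗ is v
          meet≗ u with u ≟F v
          ... | yes refl = p
          ... | no _     = refl
          rest≡outs : tot (restF (is v)) O ≡ wt (outs O) (is v)
          rest≡outs = trans (tot-cong (λ (s , t) → pt s t) O) (sym (wt-outs O (is v)))
            where
            pt : ∀ s t → restF (is v) (s , t) ≡ (if B s ∧ not (B t) then χ (is v s) else 0)
            pt s t with s ≟F v
            ... | yes refl rewrite p with B t
            ...   | true  = refl
            ...   | false = refl
            pt s t | no _ with B s | B t
            ...   | true  | true  = refl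
            ...   | true  | false = refl
            ...   | false | true  = refl
            ...   | false | false = refl

-- Contraction

all-mul : {A : Set} {P : A → Set} → ∀ m {L} → All P L → All P (mul m L)
all-mul m []       = []
all-mul m (p ∷ ps) = All.++⁺ (All.replicate⁺ m p) (all-mul m ps)

module Surgery (K n : ℕ) where

  open Nets K n public

  On : VSet → V → Set
  On U v = U v ≡ true

  module _ {U : VSet} (B : VSet) where

    all-filter : ∀ {L} → All (On U) L → All (On (meet B U)) (filterᵇ B L)
    all-filter [] = []
    all-filter {x ∷ L} (p ∷ ps) with B x in q
    ... | true  = ∧-intro p q ∷ all-filter ps
    ... | false = all-filter ps

    all-inside : ∀ {E} → All (Both {On U}) E → All (Both {On (meet B U)}) (inside B E)
    all-inside [] = []
    all-inside {(u , v) ∷ E} ((p , q) ∷ ps) with B u in r | B v in s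
    ... | true  | true  = (∧-intro p r , ∧-intro q s) ∷ all-inside ps
    ... | true  | false = all-inside ps
    ... | false | _     = all-inside ps

    all-outs : ∀ {O} → All (Both {On U}) O → All (On (meet B U)) (outs B O)
    all-outs [] = []
    all-outs {(u , v) ∷ E} ((p , q) ∷ ps) with B u in r | B v in s
    ... | true  | true  = all-outs ps
    ... | true  | false = ∧-intro p r ∷ all-outs ps
    ... | false | _     = all-outs ps

    all-inns : ∀ {O} → All (Both {On U}) O → All (On (meet B U)) (inns B O)
    all-inns [] = []
    all-inns {(u , v) ∷ E} ((p , q) ∷ ps) with B u in r | B v in s
    ... | true  | _     = all-inns ps
    ... | false | true  = ∧-intro q s ∷ all-inns ps
    ... | false | false = all-inns ps

  module _ (N : Net) where
    open Net N

    size-cong : ∀ {C D} → C ≗ D → size C ≡ size D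
    size-cong h = cong₂ _+_ (cut-cong E h) (cong₂ _+_ (wt-cong a h) (wt-cong b h))

    dem-cong : ∀ {C D} → C ≗ D → dem C ≡ dem D
    dem-cong h = cong₂ _+_ (wt-cong R h) (wt-cong b h)

    good-cong : ∀ {c c′ C D} → C ≗ D → GoodAt c c′ C → GoodAt c c′ D
    good-cong {c} {c′} h = transport (Good c c′) (size-cong h) (ins-cong E h) (dem-cong h)

    bal-cong : ∀ {C D} → C ≗ D → BalAt C → BalAt D
    bal-cong h = transport Bal (size-cong h) (ins-cong E h) (dem-cong h)

    -- The edges at the boundary of B, directed by `O`, turn into root edges, so cuts inside B keep
    -- their sizes and, modulo k, their demands.
    innerNet : VSet → List Edge → Net
    innerNet B O = mkNet (meet B U) W (inside B E)
      (filterᵇ B a ++ inns B O) (filterᵇ B b ++ outs B O) (residual B O R)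

    module _ (B : VSet) {O} (o : Orients E O) where

      private
        module I = Net (innerNet B O)

      size-inner : ∀ C → I.size C ≡ size (meet B C)
      size-inner C = begin
        cut (inside B E) C + (wt (filterᵇ B a ++ inns B O) C + wt (filterᵇ B b ++ outs B O) C)
          ≡⟨ cong (cut (inside B E) C +_) (cong₂ _+_
               (trans (tot-++ (χ ∘ C) (filterᵇ B a) _) (cong (_+ wt (inns B O) C) (wt-filter B a C)))
               (trans (tot-++ (χ ∘ C) (filterᵇ B b) _) (cong (_+ wt (outs B O) C) (wt-filter B b C)))) ⟩
        cut (inside B E) C + ((wt a (meet B C) + wt (inns B O) C) + (wt b (meet B C) + wt (outs B O) C))
          ≡⟨ ring (cut (inside B E) C) (wt a (meet B C)) (wt (inns B O) C) (wt b (meet B C)) (wt (outs B O) C) ⟩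
        (cut (inside B E) C + (wt (inns B O) C + wt (outs B O) C)) + (wt a (meet B C) + wt b (meet B C))
          ≡⟨ cong (_+ (wt a (meet B C) + wt b (meet B C))) (cut-inside B o C) ⟩
        size (meet B C) ∎
        where
        open ≡-Reasoning
        ring : ∀ c x i y j → c + ((x + i) + (y + j)) ≡ (c + (i + j)) + (x + y)
        ring = solve-∀

      dem-inner : ∀ C → I.dem C ≋ dem (meet B C)
      dem-inner C = ≋-trans (≡⇒≋ (begin
        wt (residual B O R) C + wt (filterᵇ B b ++ outs B O) C
          ≡⟨ cong (wt (residual B O R) C +_) (trans (tot-++ (χ ∘ C) (filterᵇ B b) _)
               (cong (_+ wt (outs B O) C) (wt-filter B b C))) ⟩
        wt (residual B O R) C + (wt b (meet B C) + wt (outs B O) C)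
          ≡⟨ ring (wt (residual B O R) C) (wt b (meet B C)) (wt (outs B O) C) ⟩
        wt (residual B O R) C + wt (outs B O) C + wt b (meet B C) ∎))
        (≋-+ (wt-residual B O R C) ≋-refl)
        where
        open ≡-Reasoning
        ring : ∀ r y j → r + (y + j) ≡ r + j + y
        ring = solve-∀

      dem-ins-inner : ∀ C → dem (meet B C) + ins (inside B E) C ≋ I.dem C + ins E (meet B C)
      dem-ins-inner C = ≋-+ (≋-sym (dem-inner C)) (≡⇒≋ (ins-inside B E C))

      good-inner : ∀ {c c′} C → GoodAt c c′ (meet B C) → I.GoodAt c c′ C
      good-inner C = good-≋ (sym (size-inner C)) (dem-ins-inner C)

      bal-inner : ∀ C → BalAt (meet B C) → I.BalAt C
      bal-inner C = bal-≋ (sym (size-inner C)) (dem-ins-inner C)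

      -- The new root degrees p and q split the cut around B with the demanded residue. They cannot
      -- both be at least k, and neither can reach 2k, since k edges could then be moved to the
      -- other direction.
      root-inner : out O B ≋ wt R B → ¬ GoodAt k k B → Region (wt I.a full) (wt I.b full)
      root-inner h bad = a≤ , b≤ , one-small
        where
        open ≡-Reasoning
        p = wt I.b full
        q = wt I.a full
        full-cut : cut (inside B E) full ≡ 0
        full-cut = tot-0 (inside B E)
        sz : p + q ≡ size B
        sz = begin
          p + q                       ≡⟨ +-comm p q ⟩
          0 + (q + p)                 ≡⟨ cong (_+ (q + p)) full-cut ⟨
          I.size full                 ≡⟨ size-inner full ⟩
          size B                      ∎
        rs : p + ins E B ≋ dem B
        rs = ≋-trans (≡⇒≋ (begin
          p + ins E B
            ≡⟨ cong (_+ ins E B) (trans (tot-++ (χ ∘ full) (filterᵇ B b) _)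
                 (cong (_+ wt (outs B O) full) (wt-filter B b full))) ⟩
          wt b B + wt (outs B O) full + ins E B
            ≡⟨ +-assoc (wt b B) _ _ ⟩
          wt b B + (wt (outs B O) full + ins E B)
            ≡⟨ cong (wt b B +_) (out-split B o) ⟩
          wt b B + out O B
            ≡⟨ +-comm (wt b B) (out O B) ⟩
          out O B + wt b B ∎)) (≋-+ h ≋-refl)
        one-small : q ≤ K ⊎ p ≤ K
        one-small with q ≤? K | p ≤? K
        ... | yes x | _     = inj₁ x
        ... | no _  | yes y = inj₂ y
        ... | no x  | no y  = contradiction (mkGood p q (≰⇒> y) (≰⇒> x) sz rs) bad
        b≤ : p ≤ K + k
        b≤ with p ≤? K + k
        ... | yes x = x
        ... | no x  = contradiction (rotateʳ (≰⇒> x) (m≤n+m k q) (mkGood p q ≤-refl ≤-refl sz rs)) bad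
        a≤ : q ≤ K + k
        a≤ with q ≤? K + k
        ... | yes x = x
        ... | no x  = contradiction (rotateˡ (m≤n+m k p) (≰⇒> x) (mkGood p q ≤-refl ≤-refl sz rs)) bad

      -- The cut condition inside B stays a hypothesis because it has two sources: it is inherited
      -- if there is already a root, and otherwise it follows from the minimality of B.
      valid-inner :
        All (Both {On U}) E → All (On U) a → All (On U) b → All (On U) R →
        out O B ≋ wt R B → ¬ GoodAt k k B →
        (∀ C → Hits (meet B C) → (∃ λ y → U y ≡ true × B y ≡ true × C y ≡ false) → GoodAt K K (meet B C)) →
        (∀ w → U w ≡ true → W w ≡ true → BalAt (is w)) → Hits B → Valid (innerNet B O)
      valid-inner supE supa supb supR h bad good bal (t , Ut , Wt , Bt) = mkValid
        (all-inside B supE)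
        (All.++⁺ (all-filter B supa) (all-inns B (All-~ (orients⇒~ o) supE)))
        (All.++⁺ (all-filter B supb) (all-outs B (All-~ (orients⇒~ o) supE)))
        (All.++⁺ (all-filter B supR) (all-mul K (all-outs B (All-~ (orients⇒~ o) supE))))
        (≋-cancelʳ (wt (outs B O) full) (≋-trans (wt-residual B O R full)
          (≋-trans (≋-sym h) (≡⇒≋ (trans (sym (out-split B o)) (trans (+-comm _ (ins E B))
            (cong (_+ wt (outs B O) full) (sym (ins-inside B E full)))))))))
        (root-inner h bad)
        (λ { C (u , Uu , Wu , Cu) (y , Uy , Cy) → good-inner C (good C
               (u , proj₁ (∧-true Uu) , Wu , ∧-intro Cu (proj₂ (∧-true Uu)))
               (y , proj₁ (∧-true Uy) , proj₂ (∧-true Uy) , Cy)) })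
        (λ w Uw Ww → bal-inner (is w) (bal-cong (λ u → sym (meet-is w (proj₂ (∧-true Uw)) u))
               (bal w (proj₁ (∧-true Uw)) Ww)))
        (t , ∧-intro Ut Bt , Wt)
        where
        meet-is : ∀ w → B w ≡ true → ∀ u → is w u ∧ B u ≡ is w u
        meet-is w Bw u with u ≟F w
        ... | yes refl = Bw
        ... | no _     = refl

    outerNet : VSet → V → Net
    outerNet B β = mkNet (λ v → U v ∧ (not (B v) ∨ is β v)) (λ v → W v ∧ not (B v))
      (mapE φ E) (map φ a) (map φ b) (map φ R)
      where φ = collapse B β

    module _ (B : VSet) (β : V) (Uβ : U β ≡ true) (Bβ : B β ≡ true) where

      private
        module O = Net (outerNet B β)
        φ = collapse B β

      outer⊆ : ∀ v → O.U v ≡ true → U v ≡ true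
      outer⊆ v h = proj₁ (∧-true h)

      φ-fix : ∀ v → O.U v ≡ true → φ v ≡ v
      φ-fix v h with B v | is v β | proj₂ (∧-true {U v} h)
      ... | false | _ | _  = refl
      ... | true  | _ | h′ = sym (is⇒≡ h′)

      φ-on : ∀ v → U v ≡ true → O.U (φ v) ≡ true
      φ-on v h with B v in p
      ... | true  = ∧-intro Uβ (trans (cong (not (B β) ∨_) (is-refl β)) (∨-zeroʳ (not (B β))))
      ... | false rewrite p = ∧-intro h refl

      size-outer : ∀ C → O.size C ≡ size (C ∘ φ)
      size-outer C = cong₂ _+_ (cut-mapE φ E C) (cong₂ _+_ (wt-map φ a C) (wt-map φ b C))

      dem-outer : ∀ C → O.dem C ≡ dem (C ∘ φ)
      dem-outer C = cong₂ _+_ (wt-map φ R C) (wt-map φ b C)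

      good-outer : ∀ {c c′} C → GoodAt c c′ (C ∘ φ) → O.GoodAt c c′ C
      good-outer {c} {c′} C = transport (Good c c′) (sym (size-outer C)) (sym (ins-mapE φ E C)) (sym (dem-outer C))

      bal-outer : ∀ C → BalAt (C ∘ φ) → O.BalAt C
      bal-outer C = transport Bal (sym (size-outer C)) (sym (ins-mapE φ E C)) (sym (dem-outer C))

      all-map : ∀ {L} → All (On U) L → All (On O.U) (map φ L)
      all-map []       = []
      all-map (p ∷ ps) = φ-on _ p ∷ all-map ps

      all-mapE : ∀ {L} → All (Both {On U}) L → All (Both {On O.U}) (mapE φ L)
      all-mapE []             = []
      all-mapE ((p , q) ∷ ps) = (φ-on _ p , φ-on _ q) ∷ all-mapE ps

      -- A set containing β pulls back to one that contains B, and `Hits B` makes this one subject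
      -- to the cut condition. So β can count as not exempt, even if it was exempt before.
      valid-outer : Valid N → Hits B → Valid (outerNet B β)
      valid-outer valid (t₀ , Ut₀ , Wt₀ , Bt₀) = mkValid
        (all-mapE supE) (all-map supa) (all-map supb) (all-map supR)
        (subst₂ _≋_ (sym (wt-map φ R full)) (sym (ins-mapE φ E full)) total)
        (subst₂ Region (sym (wt-map φ a full)) (sym (wt-map φ b full)) root)
        (λ { C (t , Ut , Wt , Ct) (y , Uy , Cy) → good-outer C (sets (C ∘ φ)
               (hit C t Ut Wt Ct) (y , outer⊆ y Uy , trans (cong C (φ-fix y Uy)) Cy)) })
        (λ w Uw Ww → bal-outer (is w) (bal-cong (λ u → sym (collapse-other B β Bβ w (not-true (proj₂ (∧-true Ww))) u))
               (bals w (outer⊆ w Uw) (proj₁ (∧-true Ww)))))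
        (β , trans (sym (cong O.U (φβ))) (φ-on β Uβ) , trans (cong (λ x → W β ∧ not x) Bβ) (∧-zeroʳ (W β)))
        where
        open Valid valid
        not-true : ∀ {x} → not x ≡ true → x ≡ false
        not-true {false} _ = refl
        φβ : φ β ≡ β
        φβ rewrite Bβ = refl
        hit : ∀ C t → O.U t ≡ true → O.W t ≡ false → C t ≡ true → Hits (C ∘ φ)
        hit C t Ut Wt Ct with B t in p | φ-fix t Ut
        ... | true  | refl = t₀ , Ut₀ , Wt₀ , trans (cong C (collapse-B t₀ Bt₀)) Ct
          where
          collapse-B : ∀ v → B v ≡ true → φ v ≡ β
          collapse-B v h rewrite h = refl
        ... | false | _ = t , outer⊆ t Ut , trans (sym (∧-identityʳ (W t))) Wt , trans (cong C (φ-fix t Ut)) Ct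

    -- If no edge crosses C, the demands inside and outside C are met by root edges only,
    -- which is too much for the root.
    must-cross : ∀ {c₁ c₁′ c₂ c₂′} → wt R full ≋ ins E full → Region (wt a full) (wt b full) →
      ∀ C → k ≤ c₁ + c₂ → k ≤ c₁′ + c₂′ →
      GoodAt c₁ c₁′ C → GoodAt c₂ c₂′ (not ∘ C) → cut E C ≢ 0
    must-cross total (a≤ , b≤ , small) C h h′ (mkGood p q p≥ q≥ sz rs) (mkGood p′ q′ p′≥ q′≥ sz′ rs′) d≡0 =
      absurd small
      where
      open ≡-Reasoning
      X = p + p′
      Y = q + q′
      kX : k ≤ X
      kX = ≤-trans h (+-mono-≤ p≥ p′≥)
      kY : k ≤ Y
      kY = ≤-trans h′ (+-mono-≤ q≥ q′≥)
      comp : ∀ L → wt L C + wt L (not ∘ C) ≡ wt L full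
      comp L = trans (sym (tot-+ (χ ∘ C) (χ ∘ not ∘ C) L)) (tot-cong (λ v → pt (C v)) L)
        where
        pt : ∀ x → χ x + χ (not x) ≡ 1
        pt true  = refl
        pt false = refl
      cut-comp : cut E (not ∘ C) ≡ 0
      cut-comp = trans (tot-cong (λ (u , v) → pt (C u) (C v)) E) d≡0
        where
        pt : ∀ x y → χ (not x xor not y) ≡ χ (x xor y)
        pt true  true  = refl
        pt true  false = refl
        pt false true  = refl
        pt false false = refl
      ins-comp : ins E C + ins E (not ∘ C) ≡ ins E full
      ins-comp = begin
        ins E C + ins E (not ∘ C)
          ≡⟨ cong (_+ (ins E C + ins E (not ∘ C))) d≡0 ⟨
        cut E C + (ins E C + ins E (not ∘ C))
          ≡⟨ cong (cut E C +_) (tot-+ (insF C) (insF (not ∘ C)) E) ⟨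
        cut E C + tot (λ e → insF C e + insF (not ∘ C) e) E
          ≡⟨ tot-+ (cutF C) (λ e → insF C e + insF (not ∘ C) e) E ⟨
        tot (λ e → cutF C e + (insF C e + insF (not ∘ C) e)) E
          ≡⟨ tot-cong (λ (u , v) → pt (C u) (C v)) E ⟩
        ins E full ∎
        where
        pt : ∀ x y → χ (x xor y) + (χ (x ∧ y) + χ (not x ∧ not y)) ≡ 1
        pt true  true  = refl
        pt true  false = refl
        pt false true  = refl
        pt false false = refl
      XY : X + Y ≡ wt a full + wt b full
      XY = begin
        (p + p′) + (q + q′)   ≡⟨ interchange p p′ q q′ ⟩
        (p + q) + (p′ + q′)   ≡⟨ cong₂ _+_ sz sz′ ⟩
        (cut E C + (wt a C + wt b C)) + (cut E (not ∘ C) + (wt a (not ∘ C) + wt b (not ∘ C)))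
                              ≡⟨ cong₂ (λ x y → (x + (wt a C + wt b C)) + (y + (wt a (not ∘ C) + wt b (not ∘ C)))) d≡0 cut-comp ⟩
        (wt a C + wt b C) + (wt a (not ∘ C) + wt b (not ∘ C))
                              ≡⟨ interchange (wt a C) (wt b C) _ _ ⟩
        (wt a C + wt a (not ∘ C)) + (wt b C + wt b (not ∘ C))
                              ≡⟨ cong₂ _+_ (comp a) (comp b) ⟩
        wt a full + wt b full ∎
      -- By `total` the demands of both sides add up to the number of root edges in `b`.
      X≋b : X ≋ wt b full
      X≋b = ≋-cancelʳ (ins E full) (≋-trans (≡⇒≋ (begin
        p + p′ + ins E full                       ≡⟨ cong (p + p′ +_) ins-comp ⟨
        p + p′ + (ins E C + ins E (not ∘ C))      ≡⟨ interchange p p′ _ _ ⟩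
        (p + ins E C) + (p′ + ins E (not ∘ C))    ∎))
        (≋-trans (≋-+ rs rs′) (≋-trans (≡⇒≋ (begin
        (wt R C + wt b C) + (wt R (not ∘ C) + wt b (not ∘ C))  ≡⟨ interchange (wt R C) _ _ _ ⟩
        (wt R C + wt R (not ∘ C)) + (wt b C + wt b (not ∘ C))  ≡⟨ cong₂ _+_ (comp R) (comp b) ⟩
        wt R full + wt b full                                  ≡⟨ +-comm (wt R full) (wt b full) ⟩
        wt b full + wt R full                                  ∎))
        (≋-+ ≋-refl total))))
      module ≤R = ≤-Reasoning
      absurd : wt a full ≤ K ⊎ wt b full ≤ K → _
      -- From b < k ≤ X and X ≡ b follows X ≥ b + k; with Y ≥ k the sum is at least b + 2k, but a is
      -- at most 2k - 1.
      absurd (inj₂ b≤K) = <-irrefl refl (≤R.begin-strict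
        wt a full + wt b full       ≤R.≤⟨ +-monoˡ-≤ (wt b full) a≤ ⟩
        K + k + wt b full           ≤R.≡⟨ ring K k (wt b full) ⟩
        wt b full + k + K           ≤R.<⟨ +-mono-≤-< (≋-gap (≋-sym X≋b) (≤-trans (s≤s b≤K) kX)) kY ⟩
        X + Y                       ≤R.≡⟨ XY ⟩
        wt a full + wt b full       ≤R.∎)
        where
        ring : ∀ x y z → x + y + z ≡ z + y + x
        ring = solve-∀
      -- Now Y > a forces X < b, so X ≤ b - k ≤ k - 1, against X ≥ k.
      absurd (inj₁ a≤K) = <-irrefl refl (≤R.begin-strict
        k + K                       ≤R.<⟨ +-mono-≤-< kX ≤-refl ⟩
        X + k                       ≤R.≤⟨ ≋-gap X≋b X<b ⟩
        wt b full                   ≤R.≤⟨ b≤ ⟩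
        K + k                       ≤R.≡⟨ +-comm K k ⟩
        k + K                       ≤R.∎)
        where
        X<b : X < wt b full
        X<b = +-cancelʳ-< (wt a full) _ _ (≤R.begin-strict
          X + wt a full             ≤R.<⟨ +-monoʳ-< X (≤-trans (s≤s a≤K) kY) ⟩
          X + Y                     ≤R.≡⟨ XY ⟩
          wt a full + wt b full     ≤R.≡⟨ +-comm (wt a full) _ ⟩
          wt b full + wt a full     ≤R.∎)

-- Splitting off edges

count-mono : ∀ {m} {f g : Fin m → Bool} → (∀ x → f x ≡ true → g x ≡ true) → count f ≤ count g
count-mono {zero}  h = z≤n
count-mono {suc m} {f} {g} h with f Fin.zero in p
... | false = ≤-trans (count-mono (λ x → h (Fin.suc x))) (m≤n+m _ (χ (g Fin.zero)))
... | true rewrite h Fin.zero p = s≤s (count-mono (λ x → h (Fin.suc x)))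

count-mono-< : ∀ {m} {f g : Fin m → Bool} → (∀ x → f x ≡ true → g x ≡ true) →
  ∀ y → g y ≡ true → f y ≡ false → count f < count g
count-mono-< h Fin.zero p q rewrite p | q = s≤s (count-mono (λ x → h (Fin.suc x)))
count-mono-< {f = f} {g} h (Fin.suc y) p q with f Fin.zero in r
... | false = ≤-trans (count-mono-< (λ x → h (Fin.suc x)) y p q) (m≤n+m _ (χ (g Fin.zero)))
... | true rewrite h Fin.zero r = s≤s (count-mono-< (λ x → h (Fin.suc x)) y p q)

module Reduce (K n : ℕ) where

  open Surgery K n public

  -- Root edges count last: they may be added when another edge is deleted.
  data _≺_ (M N : Net) : Set where
    fewer-vertices : count (Net.U M) < count (Net.U N) → M ≺ N
    fewer-edges    : count (Net.U M) ≡ count (Net.U N) → length (Net.E M) < length (Net.E N) → M ≺ N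
    fewer-root     : count (Net.U M) ≡ count (Net.U N) → length (Net.E M) ≡ length (Net.E N) →
      wt (Net.a M) full + wt (Net.b M) full < wt (Net.a N) full + wt (Net.b N) full → M ≺ N

  Below : Net → Set
  Below N = ∀ M → M ≺ N → Valid M → Sol (Net.E M) (Net.R M)

  Slack : Net → Set
  Slack N = ∀ C → Net.Hits N C → Net.Misses N C → Net.Multi N C → Net.GoodAt N k k C

  sol-~ : ∀ {E F R} → E ~ F → Sol F R → Sol E R
  sol-~ p (O , o , h) with orients-~ p o
  ... | O′ , o′ , e = O′ , o′ , λ v → ≋-trans (≡⇒≋ (e (outF (is v)))) (h v)

  -- Lowers the demand at w by one, as K ≡ -1.
  demand-at : V → List V → List V
  demand-at w R = replicate K w ++ R

  wt-demand-at : ∀ w R C → wt (demand-at w R) C ≡ (if C w then K else 0) + wt R C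
  wt-demand-at w R C = trans (tot-++ (χ ∘ C) (replicate K w) R)
    (cong (_+ wt R C) (trans (tot-replicate (χ ∘ C) K w) (pt (C w))))
    where
    pt : ∀ x → K * χ x ≡ (if x then K else 0)
    pt true  = *-identityʳ K
    pt false = *-zeroʳ K

  -- The edge leaving w that is put back makes up for the K ≡ -1 in the demand.
  k-out : ∀ w R v → ∀ {o} → o ≋ wt (demand-at w R) (is v) → χ (is v w) + o ≋ wt R (is v)
  k-out w R v {o} h = ≋-trans (≋-+ (≋-refl {χ (is v w)}) (≋-trans h (≡⇒≋ (wt-demand-at w R (is v))))) (pt (is v w))
    where
    ring : ∀ K r → 1 + (K + r) ≡ r + 1 * suc K
    ring = solve-∀
    pt : ∀ x → χ x + ((if x then K else 0) + wt R (is v)) ≋ wt R (is v)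
    pt true  = ≋-trans (≡⇒≋ (ring K (wt R (is v)))) (≋-drop 1)
    pt false = ≋-refl

  module _ (N : Net) where
    open Net N

    -- The demand in the reversed graph is the degree minus R, and K ≡ -1.
    flipNet : Net
    flipNet = mkNet U W E b a ((map proj₁ E ++ map proj₂ E) ++ mul K R)

    private
      module F = Net flipNet

    wt-flip : ∀ C → wt F.R C ≡ (cut E C + (ins E C + ins E C)) + K * wt R C
    wt-flip C = trans (tot-++ (χ ∘ C) (map proj₁ E ++ map proj₂ E) (mul K R)) (cong₂ _+_
      (trans (tot-++ (χ ∘ C) (map proj₁ E) (map proj₂ E))
        (trans (cong₂ _+_ (tot-map (χ ∘ C) proj₁ E) (tot-map (χ ∘ C) proj₂ E)) (out+inn (orients-refl E) C)))
      (tot-mul (χ ∘ C) K R))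

    size-flip : ∀ C → F.size C ≡ size C
    size-flip C = cong (cut E C +_) (+-comm (wt b C) (wt a C))

    -- Modulo k, the demands of C in both directions add up to the number of edge ends in C, root
    -- edges included, and so do p and q with the inner edges counted twice. Hence either congruence
    -- yields the other.
    res-flip : ∀ C p q → p + q ≡ size C → p + ins E C ≋ dem C → q + ins E C ≋ F.dem C
    res-flip C p q sz r = ≋-cancelʳ (p + ins E C) (≋-trans (≡⇒≋ (begin
      q + ε + (p + ε)                          ≡⟨ ring₁ p q ε ⟩
      p + q + (ε + ε)                          ≡⟨ cong (_+ (ε + ε)) sz ⟩
      cut E C + (wt a C + wt b C) + (ε + ε)    ≡⟨ ring₂ (cut E C) (wt a C) (wt b C) ε ⟩
      cut E C + (ε + ε) + wt a C + wt b C      ∎))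
      (≋-trans (≋-sym (≋-drop (wt R C))) (≋-trans (≡⇒≋ (trans
        (ring₃ (cut E C + (ε + ε)) (wt a C) (wt b C) (wt R C) K)
        (cong (λ x → x + wt a C + dem C) (sym (wt-flip C)))))
      (≋-+ (≋-refl {F.dem C}) (≋-sym r)))))
      where
      open ≡-Reasoning
      ε = ins E C
      ring₁ : ∀ p q ε → q + ε + (p + ε) ≡ p + q + (ε + ε)
      ring₁ = solve-∀
      ring₂ : ∀ d a b ε → d + (a + b) + (ε + ε) ≡ d + (ε + ε) + a + b
      ring₂ = solve-∀
      ring₃ : ∀ d a b r K → d + a + b + r * suc K ≡ d + K * r + a + (r + b)
      ring₃ = solve-∀

    good-flip : ∀ {c c′ C} → GoodAt c c′ C → F.GoodAt c′ c C
    good-flip {C = C} (mkGood p q a b sz r) =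
      mkGood q p b a (trans (+-comm q p) (trans sz (sym (size-flip C)))) (res-flip C p q sz r)

    bal-flip : ∀ {C} → BalAt C → F.BalAt C
    bal-flip {C} (mkBal c sz r) = mkBal c (trans sz (sym (size-flip C))) (res-flip C c c sz r)

    sol-flip : Sol E F.R → Sol E R
    sol-flip (O , o , h) = map swap O , rev o , λ v → conv v
      where
      rev : ∀ {E O} → Orients E O → Orients E (map swap O)
      rev []       = []
      rev (keep o) = flip (rev o)
      rev (flip o) = keep (rev o)
      conv : ∀ v → out (map swap O) (is v) ≋ wt R (is v)
      conv v = ≋-cancelʳ (out O (is v)) (≋-trans (≡⇒≋ (begin
        out (map swap O) (is v) + out O (is v)    ≡⟨ cong (_+ out O (is v)) (tot-map (outF (is v)) swap O) ⟩
        inn O (is v) + out O (is v)               ≡⟨ +-comm (inn O (is v)) _ ⟩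
        out O (is v) + inn O (is v)               ≡⟨ out+inn o (is v) ⟩
        D                                         ∎))
        (≋-trans (≋-sym (≋-drop (wt R (is v)))) (≋-trans (≡⇒≋ (trans (ring D (wt R (is v)) K)
          (cong (wt R (is v) +_) (sym (wt-flip (is v))))))
        (≋-+ (≋-refl {wt R (is v)}) (≋-sym (h v))))))
        where
        open ≡-Reasoning
        D = cut E (is v) + (ins E (is v) + ins E (is v))
        ring : ∀ d r K → d + r * suc K ≡ r + (d + K * r)
        ring = solve-∀

    valid-flip : Valid N → Valid flipNet
    valid-flip valid = mkValid supE supb supa
      (All.++⁺ (All.++⁺ (All.map⁺ (All.map proj₁ supE)) (All.map⁺ (All.map proj₂ supE))) (all-mul K supR))
      (≋-trans (≡⇒≋ (trans (wt-flip full) (cong (λ x → x + (ins E full + ins E full) + K * wt R full) (tot-0 E))))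
        (≋-cancelʳ (wt R full) (≋-trans (≡⇒≋ (ring (ins E full) (wt R full) K))
          (≋-trans (≋-drop (wt R full)) (≋-+ (≋-refl {ins E full}) (≋-sym total))))))
      (let (a≤ , b≤ , s) = root in b≤ , a≤ , Data.Sum.swap s)
      (λ C h m → good-flip (sets C h m))
      (λ w Uw Ww → bal-flip (bals w Uw Ww))
      term
      where
      open Valid valid
      ring : ∀ e r K → 0 + (e + e) + K * r + r ≡ (e + e) + r * suc K
      ring = solve-∀

    slack-flip : Slack N → Slack flipNet
    slack-flip slack C h m mm = good-flip (slack C h m mm)

    below-flip : Below N → Below flipNet
    below-flip below M (fewer-vertices x) = below M (fewer-vertices x)
    below-flip below M (fewer-edges e x)  = below M (fewer-edges e x)
    below-flip below M (fewer-root e f x) =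
      below M (fewer-root e f (subst (wt (Net.a M) full + wt (Net.b M) full <_) (+-comm (wt b full) (wt a full)) x))

    -- A cut is either unaffected by a reduction or loses one outgoing and one ingoing edge. The
    -- loss must be paid from slack, which sets with two vertices have.
    data Step (M : Net) (C : VSet) : Set where
      same : size C ≡ Net.size M C → dem C + ins (Net.E M) C ≋ Net.dem M C + ins E C → Step M C
      drop : size C ≡ 2 + Net.size M C → dem C + ins (Net.E M) C ≋ Net.dem M C + ins E C + 1 →
        (Hits C → Misses C → Multi C) → Step M C

    -- Holds the relevant quantities once it is decided which of the affected vertices lie in C, so
    -- that every case becomes plain arithmetic.
    record Sizes (M : Net) (C : VSet) (s s′ ε ε′ ρ ρ′ : ℕ) : Set where
      constructor sizes
      field
        size≡  : size C ≡ s
        size≡′ : Net.size M C ≡ s′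
        ins≡   : ins E C ≡ ε
        ins≡′  : ins (Net.E M) C ≡ ε′
        dem≡   : dem C ≡ ρ
        dem≡′  : Net.dem M C ≡ ρ′

    same-by : ∀ {M C s s′ ε ε′ ρ ρ′} → Sizes M C s s′ ε ε′ ρ ρ′ → s ≡ s′ → ρ + ε′ ≋ ρ′ + ε → Step M C
    same-by (sizes refl refl refl refl refl refl) = same

    drop-by : ∀ {M C s s′ ε ε′ ρ ρ′} → Sizes M C s s′ ε ε′ ρ ρ′ → s ≡ 2 + s′ → ρ + ε′ ≋ ρ′ + ε + 1 →
      (Hits C → Misses C → Multi C) → Step M C
    drop-by (sizes refl refl refl refl refl refl) = drop

    adjust-by : ∀ i j g {M C s s′ ε ε′ ρ ρ′ c₁ c₂ d d′} → Sizes M C s s′ ε ε′ ρ ρ′ →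
      i + d ≤ g + c₁ → j + d′ ≤ c₂ → s + g ≡ i + j + s′ → ρ + ε′ + g ≋ ρ′ + ε + i →
      GoodAt c₁ c₂ C → Net.GoodAt M d d′ C
    adjust-by i j g (sizes refl refl refl refl refl refl) = adjust i j g

    good-step : ∀ {M C} → Slack N → Valid N → Step M C → Hits C → Misses C → Net.GoodAt M K K C
    good-step {M} {C} slack valid (same p q) h m = good-≋ p q (Valid.sets valid C h m)
    good-step {M} {C} slack valid (drop p q f) h m = adjust 1 1 0 ≤-refl ≤-refl
      (trans (+-identityʳ _) p) (≋-trans (≡⇒≋ (+-identityʳ _)) q) (slack C h m (f h m))

    bal-step : ∀ {M C} → Step M C → BalAt C → Net.BalAt M C
    bal-step (same p q)   = bal-≋ p q
    bal-step (drop p q _) = bal-drop p q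

  module _ (N : Net) (valid : Valid N) (slack : Slack N) (below : Below N) where
    open Net N
    open Valid valid

    private
      ring-B : ∀ r b e K → r + b + e + 1 * suc K ≡ K + r + b + (1 + e) + 0 * suc K
      ring-B = solve-∀
      ring-C : ∀ r b e K → r + b + e + 1 * suc K ≡ K + r + b + e + 1 + 0 * suc K
      ring-C = solve-∀

    -- If u = v then the cut around u shrinks by 2, which only an exempt u tolerates.
    reduce-lift : ∀ w u v E₀ → U w ≡ true → W w ≡ true → u ≢ v ⊎ W u ≡ true →
      E ~ (w , u) ∷ (w , v) ∷ E₀ → Sol E R
    reduce-lift w u v E₀ Uw Ww side E~ = sol-~ {R = R} E~ (back (below M
        (fewer-edges refl (≤-reflexive (sym (length-~ E~))))
        (mkValid supM supa supb (All.++⁺ (All.replicate⁺ K Uw) supR) totalM root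
          (λ C h m → good-step N slack valid (step C) h m)
          (λ w Uw Ww → bal-step N (step (is w)) (bals w Uw Ww)) term)))
      where
      M : Net
      M = mkNet U W ((u , v) ∷ E₀) a b (demand-at w R)
      sup : All (Both {On U}) ((w , u) ∷ (w , v) ∷ E₀)
      sup = All-~ E~ supE
      supM : All (Both {On U}) ((u , v) ∷ E₀)
      supM with sup
      ... | (_ , Uu) ∷ (_ , Uv) ∷ s = (Uu , Uv) ∷ s
      Uu : U u ≡ true
      Uu with sup
      ... | (_ , Uu) ∷ (_ , Uv) ∷ s = Uu
      Uv : U v ≡ true
      Uv with sup
      ... | (_ , Uu) ∷ (_ , Uv) ∷ s = Uv
      num : ∀ C {x y z} → C w ≡ x → C u ≡ y → C v ≡ z → Sizes N M C
        (χ (x xor y) + (χ (x xor z) + cut E₀ C) + (wt a C + wt b C))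
        (χ (y xor z) + cut E₀ C + (wt a C + wt b C))
        (χ (x ∧ y) + (χ (x ∧ z) + ins E₀ C)) (χ (y ∧ z) + ins E₀ C)
        (wt R C + wt b C) ((if x then K else 0) + wt R C + wt b C)
      num C refl refl refl = sizes (cong (_+ (wt a C + wt b C)) (cut-~ E~ C)) refl (ins-~ E~ C) refl
        refl (cong (_+ wt b C) (wt-demand-at w R C))
      step : ∀ C → Step N M C
      step C with C w in Cw | C u in Cu | C v in Cv
      ... | true  | true  | true  = same-by N (num C Cw Cu Cv) refl (cong-by 1 0 (ring (wt R C) (wt b C) (ins E₀ C) K))
        where
        ring : ∀ r b e K → r + b + (1 + e) + 1 * suc K ≡ K + r + b + (1 + (1 + e)) + 0 * suc K
        ring = solve-∀
      ... | true  | true  | false = same-by N (num C Cw Cu Cv) refl (cong-by 1 0 (ring-B (wt R C) (wt b C) (ins E₀ C) K))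
      ... | true  | false | true  = same-by N (num C Cw Cu Cv) refl (cong-by 1 0 (ring-B (wt R C) (wt b C) (ins E₀ C) K))
      -- A set subject to the condition contains a vertex that is not exempt, hence a second vertex
      -- besides w.
      ... | true  | false | false = drop-by N (num C Cw Cu Cv) refl (cong-by 1 0 (ring-C (wt R C) (wt b C) (ins E₀ C) K))
              (λ { (t , Ut , Wt , Ct) _ → t , w , (λ { refl → true≢false Ww Wt }) , (Ut , Ct) , (Uw , Cw) })
      ... | false | true  | true  = drop-by N (num C Cw Cu Cv) refl (≡⇒≋ (ring (wt R C) (wt b C) (ins E₀ C))) (multi side)
        where
        ring : ∀ r b e → r + b + (1 + e) ≡ r + b + e + 1
        ring = solve-∀
        multi : u ≢ v ⊎ W u ≡ true → Hits C → Misses C → Multi C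
        multi (inj₁ u≢v) _ _ = u , v , u≢v , (Uu , Cu) , (Uv , Cv)
        multi (inj₂ Wu) (t , Ut , Wt , Ct) _ = t , u , (λ { refl → true≢false Wu Wt }) , (Ut , Ct) , (Uu , Cu)
      ... | false | true  | false = same-by N (num C Cw Cu Cv) refl ≋-refl
      ... | false | false | true  = same-by N (num C Cw Cu Cv) refl ≋-refl
      ... | false | false | false = same-by N (num C Cw Cu Cv) refl ≋-refl
      totalM : wt (demand-at w R) full ≋ 1 + ins E₀ full
      totalM = ≋-trans (≡⇒≋ (wt-demand-at w R full)) (≋-trans (≋-+ (≋-refl {K})
        (≋-trans total (≡⇒≋ (ins-~ E~ full)))) (≋-trans (≡⇒≋ (ring K (ins E₀ full))) (≋-drop 1)))
        where
        ring : ∀ K e → K + (2 + e) ≡ 1 + e + 1 * suc K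
        ring = solve-∀
      back : Sol ((u , v) ∷ E₀) (demand-at w R) → Sol ((w , u) ∷ (w , v) ∷ E₀) R
      -- Rerouted through w, the edge uv enters and leaves w once, which accounts for the demand
      -- lowered by one.
      back (_ , keep {O = O} o , h) = _ , flip (keep o) , λ x → ≋-trans
        (≡⇒≋ (x+y+z≡y+x+z (χ (is x u)) (χ (is x w)) (out O (is x)))) (k-out w R x (h x))
      back (_ , flip {O = O} o , h) = _ , keep (flip o) , λ x → k-out w R x (h x)

    -- The edge wu is oriented towards u and, together with a root edge entering w, replaced by
    -- a root edge entering u.
    reduce-root-lift : ∀ w u E₀ → U w ≡ true → W w ≡ true → wt a (is w) ≢ 0 →
      E ~ (w , u) ∷ E₀ → Sol E R
    reduce-root-lift w u E₀ Uw Ww aw E~ with pick a (is w) aw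
    ... | x , a₀ , xw , wa , supx with is⇒≡ xw
    ... | refl = sol-~ {R = R} E~ (back (below M (fewer-edges refl (≤-reflexive (sym (length-~ E~))))
        (mkValid (proj₂ supM) (proj₁ supM ∷ proj₂ (supx supa)) supb (All.++⁺ (All.replicate⁺ K Uw) supR) totalM
          (subst (λ x → Region x (wt b full)) (wa full) root)
          (λ C h m → good-step N slack valid (step C) h m)
          (λ w Uw Ww → bal-step N (step (is w)) (bals w Uw Ww)) term)))
      where
      M : Net
      M = mkNet U W E₀ (u ∷ a₀) b (demand-at w R)
      supM : U u ≡ true × All (Both {On U}) E₀
      supM with All-~ E~ supE
      ... | (_ , Uu) ∷ s = Uu , s
      num : ∀ C {x y} → C w ≡ x → C u ≡ y → Sizes N M C
        (χ (x xor y) + cut E₀ C + (χ x + wt a₀ C + wt b C)) (cut E₀ C + (χ y + wt a₀ C + wt b C))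
        (χ (x ∧ y) + ins E₀ C) (ins E₀ C)
        (wt R C + wt b C) ((if x then K else 0) + wt R C + wt b C)
      num C refl refl = sizes (cong₂ (λ x y → x + (y + wt b C)) (cut-~ E~ C) (wa C)) refl (ins-~ E~ C) refl
        refl (cong (_+ wt b C) (wt-demand-at w R C))
      step : ∀ C → Step N M C
      step C with C w in Cw | C u in Cu
      ... | true  | true  = same-by N (num C Cw Cu) refl (cong-by 1 0 (ring-B (wt R C) (wt b C) (ins E₀ C) K))
      -- C loses the outgoing edge wu together with the root edge that entered w.
      ... | true  | false = drop-by N (num C Cw Cu) (ring (cut E₀ C) (wt a₀ C) (wt b C)) (cong-by 1 0 (ring-C (wt R C) (wt b C) (ins E₀ C) K))
              (λ { (t , Ut , Wt , Ct) _ → t , w , (λ { refl → true≢false Ww Wt }) , (Ut , Ct) , (Uw , Cw) })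
        where
        ring : ∀ c a b → 1 + c + (1 + a + b) ≡ 2 + (c + (a + b))
        ring = solve-∀
      ... | false | true  = same-by N (num C Cw Cu) (ring (cut E₀ C) (wt a₀ C) (wt b C)) ≋-refl
        where
        ring : ∀ c a b → 1 + c + (a + b) ≡ c + (1 + a + b)
        ring = solve-∀
      ... | false | false = same-by N (num C Cw Cu) refl ≋-refl
      totalM : wt (demand-at w R) full ≋ ins E₀ full
      totalM = ≋-trans (≡⇒≋ (wt-demand-at w R full)) (≋-trans (≋-+ (≋-refl {K})
        (≋-trans total (≡⇒≋ (ins-~ E~ full)))) (≋-trans (≡⇒≋ (ring K (ins E₀ full))) (≋-drop 1)))
        where
        ring : ∀ K e → K + (1 + e) ≡ e + 1 * suc K
        ring = solve-∀
      back : Sol E₀ (demand-at w R) → Sol ((w , u) ∷ E₀) R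
      back (O , o , h) = _ , keep o , λ x → k-out w R x (h x)

-- Removing exempt vertices

module Eliminate (K n : ℕ) where

  open Reduce K n public

  -- In the second alternative `E₀` meets w in loops only; `m` = 0 covers a w without neighbours.
  neighbours : ∀ w t → w ≢ t → ∀ E →
    (∃ λ v → ∃ λ E₀ → v ≢ w × v ≢ t × E ~ (w , v) ∷ E₀) ⊎
    (∃ λ m → ∃ λ E₀ → E ~ replicate m (w , t) ++ E₀ × cut E₀ (is w) ≡ 0)
  neighbours w t w≢t [] = inj₂ (0 , [] , ~-refl , refl)
  neighbours w t w≢t ((x , y) ∷ E) = go (neighbours w t w≢t E)
    where
    Goal : Set
    Goal = (∃ λ v → ∃ λ E₀ → v ≢ w × v ≢ t × (x , y) ∷ E ~ (w , v) ∷ E₀) ⊎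
           (∃ λ m → ∃ λ E₀ → (x , y) ∷ E ~ replicate m (w , t) ++ E₀ × cut E₀ (is w) ≡ 0)
    cross : ∀ z → z ≢ w → (x , y) ∷ E ~ (w , z) ∷ E →
      (∃ λ m → ∃ λ E₀ → E ~ replicate m (w , t) ++ E₀ × cut E₀ (is w) ≡ 0) → Goal
    cross z z≢w p (m , E₀ , q , c) with z ≟F t
    ... | yes refl = inj₂ (suc m , E₀ , ~-trans p (~-prep q) , c)
    ... | no z≢t   = inj₁ (z , E , z≢w , z≢t , p)
    go : _ → Goal
    go (inj₁ (v , E₀ , v≢w , v≢t , p)) =
      inj₁ (v , (x , y) ∷ E₀ , v≢w , v≢t , ~-trans (~-prep p) ~-swap)
    go (inj₂ r@(m , E₀ , p , c)) with x ≟F w in ex | y ≟F w in ey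
    ... | yes refl | no y≢w   = cross y y≢w ~-refl r
    ... | no x≢w   | yes refl = cross x x≢w ~-flip r
    ... | yes refl | yes refl = inj₂ (m , (x , y) ∷ E₀ ,
            ~-trans (~-prep p) (~-shift (replicate m (w , t))) , trans (cong (_+ cut E₀ (is w)) z) c)
      where
      z : cutF (is w) (w , w) ≡ 0
      z rewrite is-refl w = refl
    ... | no x≢w   | no y≢w   = inj₂ (m , (x , y) ∷ E₀ ,
            ~-trans (~-prep p) (~-shift (replicate m (w , t))) , trans (cong (_+ cut E₀ (is w)) z) c)
      where
      z : cutF (is w) (x , y) ≡ 0
      z rewrite ≢⇒¬is x≢w | ≢⇒¬is y≢w = refl

  module _ (N : Net) (valid : Valid N) (below : Below N) where
    open Net N
    open Valid valid

    -- All edges of the exempt vertex w go to the vertex t: identify w with t, and orient half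
    -- of the edges between them in each direction.
    reduce-merge : ∀ w t m E₀ → U w ≡ true → W w ≡ true → U t ≡ true → W t ≡ false →
      wt a (is w) ≡ 0 → wt b (is w) ≡ 0 →
      E ~ replicate m (w , t) ++ E₀ → cut E₀ (is w) ≡ 0 → Sol E R
    reduce-merge w t m E₀ Uw Ww Ut Wt aw bw E~ isol =
      build (below (outerNet N B t)
        (fewer-vertices (count-mono-< (outer⊆ N B t Ut Bt) w Uw w∉))
        (valid-outer N B t Ut Bt valid (t , Ut , Wt , Bt)))
      where
      w≢t : w ≢ t
      w≢t refl = true≢false Ww Wt
      B : VSet
      B v = is w v ∨ is t v
      Bw : B w ≡ true
      Bw rewrite is-refl w = refl
      Bt : B t ≡ true
      Bt rewrite is-refl t = ∨-zeroʳ (is w t)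
      w∉ : Net.U (outerNet N B t) w ≡ false
      w∉ rewrite Bw | ≢⇒¬is w≢t with U w
      ... | true  = refl
      ... | false = refl
      φ = collapse B t
      par : List Edge
      par = replicate m (w , t)
      cut-par : ∀ C → cut par C ≡ m * χ (C w xor C t)
      cut-par C = tot-replicate (cutF C) m (w , t)
      ins-par : ∀ C → ins par C ≡ m * χ (C w ∧ C t)
      ins-par C = tot-replicate (insF C) m (w , t)
      half : Bal (size (is w)) (ins E (is w)) (dem (is w))
      half = bals w Uw Ww
      c = Bal.c half
      c+c≡m : c + c ≡ m
      c+c≡m = trans (Bal.size half) (begin
        size (is w)
          ≡⟨ cong₂ _+_ (trans (cut-~ E~ (is w)) (tot-++ (cutF (is w)) par E₀)) (cong₂ _+_ aw bw) ⟩
        cut par (is w) + cut E₀ (is w) + 0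
          ≡⟨ +-identityʳ _ ⟩
        cut par (is w) + cut E₀ (is w)
          ≡⟨ cong₂ _+_ (cut-par (is w)) isol ⟩
        m * χ (is w w xor is w t) + 0
          ≡⟨ +-identityʳ _ ⟩
        m * χ (is w w xor is w t)
          ≡⟨ cong₂ (λ x y → m * χ (x xor y)) (is-refl w) (≢⇒¬is (w≢t ∘ sym)) ⟩
        m * 1
          ≡⟨ *-identityʳ m ⟩
        m ∎)
        where open ≡-Reasoning
      ins-w : ins E (is w) ≡ ins E₀ (is w)
      ins-w = trans (ins-~ E~ (is w)) (trans (tot-++ (insF (is w)) par E₀)
        (cong (_+ ins E₀ (is w)) (trans (ins-par (is w))
        (trans (cong₂ (λ x y → m * χ (x ∧ y)) (is-refl w) (≢⇒¬is (w≢t ∘ sym))) (*-zeroʳ m)))))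
      build : Sol (mapE φ E) (map φ R) → Sol E R
      build (Q , q , h) with orients-mapE φ E q
      ... | Q₁ , q₁ , e₁ with orients-~ (~-sym E~) q₁
      ... | Q₂ , q₂ , e₂ with orients-split par q₂ | orients-parallel c {w} {t}
      ... | P , O₀ , p , o₀ , e₃ | P′ , p′ , e₄ =
        sol-~ {R = R} E~ (P′ ++ O₀ , orients-++ (subst (λ m → Orients (replicate m (w , t)) P′) c+c≡m p′) o₀ , final)
        where
        old : ∀ v → out P (is v ∘ φ) + out O₀ (is v ∘ φ) ≋ wt R (is v ∘ φ)
        old v = ≋-trans (≡⇒≋ (sym (trans (e₁ (is v)) (trans (sym (e₂ (outF (is v ∘ φ)))) (e₃ (is v ∘ φ))))))
          (≋-trans (h v) (≡⇒≋ (wt-map φ R (is v))))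
        new : ∀ C → out (P′ ++ O₀) C ≡ c * χ (C w) + c * χ (C t) + out O₀ C
        new C = trans (tot-++ (outF C) P′ O₀) (cong (_+ out O₀ C) (e₄ C))
        -- The remaining edges at w are loops, which count as inner edges of {w}; balance at w then
        -- says that c outgoing edges are right.
        out-w : c + out O₀ (is w) ≋ wt R (is w)
        out-w = ≋-trans (≡⇒≋ (cong (c +_) (trans (isolated⇒out≡ins o₀ (is w) isol) (sym ins-w))))
          (≋-trans (Bal.res half) (≡⇒≋ (trans (cong (wt R (is w) +_) bw) (+-identityʳ _))))
        -- The merged vertex has the out-degree demanded of w and t together, and w gets its part;
        -- subtraction leaves the right amount for t.
        out-t : c + out O₀ (is t) ≋ wt R (is t)
        out-t = ≋-cancelʳ (wt R (is w)) (≋-trans (≋-+ (≋-refl {c + out O₀ (is t)}) (≋-sym out-w))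
          (≋-trans (≡⇒≋ (trans (ring c (out O₀ (is t)) (out O₀ (is w))) (cong₂ _+_ c+c≡m (sym (sumB (outF (is w)) (outF (is t)) (outF B) (λ e → pt (proj₁ e)) O₀)))))
          (≋-trans (≡⇒≋ (cong (_+ out O₀ B) (sym outP)))
          (≋-trans (≡⇒≋ (sym (cong₂ _+_ (out-cong P fib) (out-cong O₀ fib))))
          (≋-trans (old t) (≡⇒≋ (trans (wt-cong R fib) (trans (sumB (χ ∘ is w) (χ ∘ is t) (χ ∘ B) pt R) (+-comm (wt R (is w)) _)))))))))
          where
          fib = collapse-fibre B t Bt
          ring : ∀ c x y → c + x + (c + y) ≡ c + c + (y + x)
          ring = solve-∀
          pt : ∀ v → χ (B v) ≡ χ (is w v) + χ (is t v)
          pt v with v ≟F w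
          ... | no _     = refl
          ... | yes refl rewrite ≢⇒¬is w≢t = refl
          sumB : ∀ {A : Set} (f g s : A → ℕ) → (∀ x → s x ≡ f x + g x) → ∀ L → tot s L ≡ tot f L + tot g L
          sumB f g s h L = trans (tot-cong h L) (tot-+ f g L)
          outP : out P B ≡ m
          outP = trans (isolated⇒out≡ins p B (trans (cut-par B)
              (trans (cong₂ (λ x y → m * χ (x xor y)) Bw Bt) (*-zeroʳ m))))
            (trans (ins-par B) (trans (cong₂ (λ x y → m * χ (x ∧ y)) Bw Bt) (*-identityʳ m)))
        final : ∀ v → out (P′ ++ O₀) (is v) ≋ wt R (is v)
        final v with v ≟F w | v ≟F t
        ... | yes refl | _ = ≋-trans (≡⇒≋ (trans (new (is w)) (cong (_+ out O₀ (is w)) (trans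
                (cong₂ (λ x y → c * χ x + c * χ y) (is-refl w) (≢⇒¬is (w≢t ∘ sym))) (ring c))))) out-w
          where
          ring : ∀ c → c * 1 + c * 0 ≡ c
          ring = solve-∀
        ... | no _ | yes refl = ≋-trans (≡⇒≋ (trans (new (is t)) (cong (_+ out O₀ (is t)) (trans
                (cong₂ (λ x y → c * χ x + c * χ y) (≢⇒¬is w≢t) (is-refl t)) (ring c))))) out-t
          where
          ring : ∀ c → c * 0 + c * 1 ≡ c
          ring = solve-∀
        ... | no v≢w | no v≢t = ≋-trans (≡⇒≋ (trans (new (is v)) (cong (_+ out O₀ (is v)) (trans
                (cong₂ (λ x y → c * χ x + c * χ y) w∌ t∌) (trans (ring c) (sym outP))))))
              (≋-trans (≡⇒≋ (sym (cong₂ _+_ (out-cong P oth) (out-cong O₀ oth))))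
              (≋-trans (old v) (≡⇒≋ (wt-cong R oth))))
          where
          ring : ∀ c → c * 0 + c * 0 ≡ 0
          ring = solve-∀
          w∌ : is v w ≡ false
          w∌ = ≢⇒¬is (v≢w ∘ sym)
          t∌ : is v t ≡ false
          t∌ = ≢⇒¬is (v≢t ∘ sym)
          Bv : B v ≡ false
          Bv rewrite ≢⇒¬is v≢w | ≢⇒¬is v≢t = refl
          oth = collapse-other B t Bt v Bv
          outP : out P (is v) ≡ 0
          outP = trans (isolated⇒out≡ins p (is v) (trans (cut-par (is v))
              (trans (cong₂ (λ x y → m * χ (x xor y)) w∌ t∌) (*-zeroʳ m))))
            (trans (ins-par (is v)) (trans (cong₂ (λ x y → m * χ (x ∧ y)) w∌ t∌) (*-zeroʳ m)))

  1≤c+c : ∀ c → c + c ≢ 0 → 1 ≤ c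
  1≤c+c zero h    = contradiction refl h
  1≤c+c (suc c) h = s≤s z≤n

  module _ (1≤K : 1 ≤ K) where

    -- A root edge at w forces p = q ≥ 1 there, and the other side has p, q ≥ K. Together this is
    -- the k that the root cannot provide.
    root-edge⇒crossed : ∀ N → Valid N → ∀ w → Net.U N w ≡ true → Net.W N w ≡ true →
      wt (Net.a N) (is w) ≢ 0 → cut (Net.E N) (is w) ≢ 0
    root-edge⇒crossed N valid w Uw Ww aw = must-cross N total root (is w) ≤k ≤k
        (mkGood (Bal.c bal) (Bal.c bal) 1≤c 1≤c (Bal.size bal) (Bal.res bal))
        (sets (not ∘ is w) (t , Ut , Wt , cong not (≢⇒¬is t≢w)) (w , Uw , cong not (is-refl w)))
      where
      open Net N
      open Valid valid
      t = proj₁ term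
      Ut = proj₁ (proj₂ term)
      Wt = proj₂ (proj₂ term)
      t≢w : t ≢ w
      t≢w e = true≢false Ww (subst (λ x → W x ≡ false) e Wt)
      bal = bals w Uw Ww
      ≤k : k ≤ 1 + K
      ≤k = ≤-refl
      1≤c : 1 ≤ Bal.c bal
      1≤c = 1≤c+c (Bal.c bal) λ e → aw (m+n≡0⇒m≡0 _ (m+n≡0⇒n≡0 (cut E (is w)) (trans (sym (Bal.size bal)) e)))

    reduce-root-edge : ∀ N → Valid N → Slack N → Below N → ∀ w → Net.U N w ≡ true → Net.W N w ≡ true →
      wt (Net.a N) (is w) ≢ 0 → Sol (Net.E N) (Net.R N)
    reduce-root-edge N valid slack below w Uw Ww aw
      with crossing (Net.E N) (is w) (root-edge⇒crossed N valid w Uw Ww aw)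
    ... | x , u , E₀ , xw , _ , E~ with is⇒≡ xw
    ... | refl = reduce-root-lift N valid slack below w u E₀ Uw Ww aw E~

    -- Two edges at w can be split off unless both lead to the same vertex that is not exempt. The
    -- only obstacle is therefore a w all of whose neighbours coincide, and then merging applies.
    eliminate : ∀ N → Valid N → Slack N → Below N → ∀ w → Net.U N w ≡ true → Net.W N w ≡ true →
      Sol (Net.E N) (Net.R N)
    eliminate N valid slack below w Uw Ww with wt (Net.a N) (is w) ≟ 0 | wt (Net.b N) (is w) ≟ 0
    ... | no aw  | _      = reduce-root-edge N valid slack below w Uw Ww aw
    ... | yes _  | no bw  = sol-flip N (reduce-root-edge (flipNet N) (valid-flip N valid)
            (slack-flip N slack) (below-flip N below) w Uw Ww bw)
    ... | yes aw | yes bw = go (neighbours w t w≢t E)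
      where
      open Net N
      open Valid valid
      t = proj₁ term
      Ut = proj₁ (proj₂ term)
      Wt = proj₂ (proj₂ term)
      w≢t : w ≢ t
      w≢t e = true≢false Ww (subst (λ x → W x ≡ false) (sym e) Wt)
      odd : ∀ c → c + c ≢ 1
      odd (suc c) e = contradiction (suc-injective e) (λ e′ → 1+n≢0 (trans (sym (+-suc c c)) e′))
      go : _ → Sol E R
      go (inj₂ (m , E₀ , E~ , isol)) = reduce-merge N valid below w t m E₀ Uw Ww Ut Wt aw bw E~ isol
      go (inj₁ (v , E₁ , v≢w , _ , E~)) with W v in Wv
      ... | false = go′ (neighbours w v (v≢w ∘ sym) E₁)
        where
        Uv : U v ≡ true
        Uv with All-~ E~ supE
        ... | (_ , h) ∷ _ = h
        go′ : _ → Sol E R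
        go′ (inj₁ (v′ , E₂ , _ , v′≢v , E₁~)) =
          reduce-lift N valid slack below w v v′ E₂ Uw Ww (inj₁ (v′≢v ∘ sym)) (~-trans E~ (~-prep E₁~))
        go′ (inj₂ (m , E₂ , E₁~ , isol)) =
          reduce-merge N valid below w v (suc m) E₂ Uw Ww Uv Wv aw bw (~-trans E~ (~-prep E₁~)) isol
      -- Without root edges the cut around w has even size, so a second edge leaves w. It may lead
      -- to v again, since v is exempt.
      ... | true with cut E₁ (is w) ≟ 0
      ...   | yes z = contradiction (trans (Bal.size (bals w Uw Ww)) (trans
                (cong₂ _+_ (cut-~ E~ (is w)) (cong₂ _+_ aw bw)) (trans (+-identityʳ _)
                (trans (cong₂ (λ x y → χ (x xor y) + cut E₁ (is w)) (is-refl w) (≢⇒¬is v≢w)) (cong suc z)))))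
                (odd (Bal.c (bals w Uw Ww)))
      ...   | no nz with crossing E₁ (is w) nz
      ...     | x , u , E₂ , xw , _ , E₁~ with is⇒≡ xw
      ...       | refl = reduce-lift N valid slack below w v u E₂ Uw Ww (inj₂ Wv) (~-trans E~ (~-prep E₁~))

-- Graphs without exempt vertices

module Settle (K n : ℕ) where

  open Eliminate K n public

  module _ (N : Net) where
    open Net N

    multi? : ∀ C → Dec (Multi C)
    multi? C = any? λ x → any? λ y → ¬? (x ≟F y) ×-dec
      ((U x ≟B true) ×-dec (C x ≟B true)) ×-dec ((U y ≟B true) ×-dec (C y ≟B true))

    singleton : ∀ C → ¬ Multi C → ∀ z → U z ≡ true → C z ≡ true → ∀ v → U v ≡ true → C v ≡ is z v
    singleton C ¬m z Uz Cz v Uv with v ≟F z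
    ... | yes refl = Cz
    ... | no v≢z with C v in Cv
    ...   | false = refl
    ...   | true  = contradiction (v , z , v≢z , (Uv , Cv) , (Uz , Cz)) ¬m

    module _ (supE : All (Both {On U}) E) (supa : All (On U) a) (supb : All (On U) b) (supR : All (On U) R)
             {C D : VSet} (h : ∀ v → U v ≡ true → C v ≡ D v) where

      wt-agree : ∀ {L} → All (On U) L → wt L C ≡ wt L D
      wt-agree = tot-cong-All (λ v Uv → cong χ (h v Uv))

      size-agree : size C ≡ size D
      size-agree = cong₂ _+_
        (tot-cong-All (λ (u , v) (Uu , Uv) → cong₂ (λ x y → χ (x xor y)) (h u Uu) (h v Uv)) supE)
        (cong₂ _+_ (wt-agree supa) (wt-agree supb))

      ins-agree : ins E C ≡ ins E D
      ins-agree = tot-cong-All (λ (u , v) (Uu , Uv) → cong₂ (λ x y → χ (x ∧ y)) (h u Uu) (h v Uv)) supE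

      good-agree : ∀ {c c′} → GoodAt c c′ C → GoodAt c c′ D
      good-agree {c} {c′} = transport (Good c c′) size-agree ins-agree (cong₂ _+_ (wt-agree supR) (wt-agree supb))

      bal-agree : BalAt C → BalAt D
      bal-agree = transport Bal size-agree ins-agree (cong₂ _+_ (wt-agree supR) (wt-agree supb))

  module _ (N : Net) (valid : Valid N) (slack : Slack N) (below : Below N)
           (noW : ∀ v → Net.U N v ≡ true → Net.W N v ≡ false) where
    open Net N
    open Valid valid

    -- C either agrees with {x} or contains another vertex, and then it has slack.
    good-around : ∀ {c c′} → c ≤ k → c′ ≤ k → ∀ x → U x ≡ true → GoodAt c c′ (is x) →
      ∀ C → C x ≡ true → Hits C → Misses C → GoodAt c c′ C
    good-around c≤ c′≤ x Ux g C Cx h m with multi? N C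
    ... | yes mm = weaken c≤ c′≤ (slack C h m mm)
    ... | no ¬m  = good-agree N supE supa supb supR
            (λ v Uv → sym (singleton N C ¬m x Ux Cx v Uv)) g

    module _ (x y : V) (E₀ : List Edge) (c : ℕ) (x≢y : x ≢ y) (E~ : E ~ (x , y) ∷ E₀) where

      private
        -- c root edges leaving y are added, and xy is oriented towards y and deleted.
        M : Net
        M = mkNet U W E₀ a (replicate c y ++ b) (demand-at x R)
        module M = Net M

        copies : ∀ C → wt (replicate c y ++ b) C ≡ (if C y then c else 0) + wt b C
        copies C = trans (tot-++ (χ ∘ C) (replicate c y) b)
          (cong (_+ wt b C) (trans (tot-replicate (χ ∘ C) c y) (pt (C y))))
          where
          pt : ∀ z → c * χ z ≡ (if z then c else 0)
          pt true  = *-identityʳ c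
          pt false = *-zeroʳ c

        num : ∀ C {z w} → C x ≡ z → C y ≡ w → Sizes N M C
          (χ (z xor w) + cut E₀ C + (wt a C + wt b C)) (cut E₀ C + (wt a C + ((if w then c else 0) + wt b C)))
          (χ (z ∧ w) + ins E₀ C) (ins E₀ C)
          (wt R C + wt b C) ((if z then K else 0) + wt R C + ((if w then c else 0) + wt b C))
        num C refl refl = sizes (cong (_+ (wt a C + wt b C)) (cut-~ E~ C))
          (cong (λ t → cut E₀ C + (wt a C + t)) (copies C)) (ins-~ E~ C) refl
          refl (cong₂ _+_ (wt-demand-at x R C) (copies C))

      entering : ∀ {c₁ c₂ d′} C → C x ≡ false → C y ≡ true → 1 + d′ ≤ c₂ →
        GoodAt c₁ c₂ C → M.GoodAt (c + c₁) d′ C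
      entering C Cx Cy h = adjust-by N 0 1 c (num C Cx Cy) ≤-refl h
        (ring₁ (cut E₀ C) (wt a C) (wt b C) c) (≡⇒≋ (ring₂ (wt R C) (wt b C) (ins E₀ C) c))
        where
        ring₁ : ∀ d a b c → 1 + d + (a + b) + c ≡ 1 + (d + (a + (c + b)))
        ring₁ = solve-∀
        ring₂ : ∀ r b e c → r + b + e + c ≡ r + (c + b) + e + 0
        ring₂ = solve-∀

      -- Sets with x but not y lose an outgoing edge, those with y but not x an ingoing one, and
      -- slack pays unless the set is a single vertex. For {y} the condition is a hypothesis, since
      -- it may depend on the added root edges.
      reduce-edge : Region (wt a full) (c + wt b full) → GoodAt k K (is x) → M.GoodAt K K (is y) → Sol E R
      reduce-edge rootM gx gy = sol-~ {R = R} E~ (back (below M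
          (fewer-edges refl (≤-reflexive (sym (length-~ E~)))) validM))
        where
        sup : All (Both {On U}) ((x , y) ∷ E₀)
        sup = All-~ E~ supE
        Ux : U x ≡ true
        Ux = proj₁ (All.head sup)
        Uy : U y ≡ true
        Uy = proj₂ (All.head sup)
        supb′ = All.++⁺ (All.replicate⁺ c Uy) supb
        supR′ = All.++⁺ (All.replicate⁺ K Ux) supR
        good : ∀ C → Hits C → Misses C → M.GoodAt K K C
        good C h m with C x in Cx | C y in Cy
        ... | true  | true  = adjust-by N 0 0 c (num C Cx Cy) (m≤n+m K c) ≤-refl
                (ring₁ (cut E₀ C) (wt a C) (wt b C) c)
                (cong-by 1 0 (ring₂ (wt R C) (wt b C) (ins E₀ C) c K)) (sets C h m)
          where
          ring₁ : ∀ d a b c → d + (a + b) + c ≡ d + (a + (c + b))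
          ring₁ = solve-∀
          ring₂ : ∀ r b e c K → r + b + e + c + 1 * suc K ≡ K + r + (c + b) + (1 + e) + 0 + 0 * suc K
          ring₂ = solve-∀
        ... | false | false = adjust-by N 0 0 0 (num C Cx Cy) ≤-refl ≤-refl
                (+-identityʳ _) ≋-refl (sets C h m)
        ... | true  | false = adjust-by N 1 0 0 (num C Cx Cy) ≤-refl ≤-refl
                (+-identityʳ _) (cong-by 1 0 (ring (wt R C) (wt b C) (ins E₀ C) K))
                (good-around ≤-refl (n≤1+n K) x Ux gx C Cx h m)
          where
          ring : ∀ r b e K → r + b + e + 0 + 1 * suc K ≡ K + r + b + e + 1 + 0 * suc K
          ring = solve-∀
        ... | false | true with multi? N C
        ...   | yes mm = weaken (≤-trans (n≤1+n K) (m≤n+m k c)) ≤-refl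
                  (entering C Cx Cy ≤-refl (slack C h m mm))
        ...   | no ¬m  = good-agree M (All.tail sup) supa supb′ supR′
                  (λ v Uv → sym (singleton N C ¬m y Uy Cy v Uv)) gy
        validM : Valid M
        validM = mkValid (All.tail sup) supa supb′ supR′
          (≋-trans (≡⇒≋ (wt-demand-at x R full)) (≋-trans (≋-+ (≋-refl {K})
            (≋-trans total (≡⇒≋ (ins-~ E~ full)))) (≋-trans (≡⇒≋ (ring K (ins E₀ full))) (≋-drop 1))))
          (subst (Region (wt a full)) (sym (copies full)) rootM)
          good (λ w Uw Ww → contradiction (noW w Uw) (true≢false Ww)) term
          where
          ring : ∀ K e → K + (1 + e) ≡ e + 1 * suc K
          ring = solve-∀
        back : Sol E₀ (demand-at x R) → Sol ((x , y) ∷ E₀) R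
        back (O , o , h) = _ , keep o , λ z → k-out x R z (h z)

    delete-edge : ∀ x y E₀ → x ≢ y → E ~ (x , y) ∷ E₀ → GoodAt k K (is x) → GoodAt K k (is y) → Sol E R
    delete-edge x y E₀ x≢y E~ gx gy = reduce-edge x y E₀ 0 x≢y E~ root gx
      (entering x y E₀ 0 x≢y E~ (is y) (≢⇒¬is x≢y) (is-refl y) ≤-refl gy)

    module _ (1≤K : 1 ≤ K) (u t : V) (u≢t : u ≢ t) (Uu : U u ≡ true) (Ut : U t ≡ true) where

      hits : ∀ {C} x → U x ≡ true → C x ≡ true → Hits C
      hits x Ux Cx = x , Ux , noW x Ux , Cx

      misses : ∀ x → Misses (is x)
      misses x with u ≟F x
      ... | yes refl = t , Ut , ≢⇒¬is (u≢t ∘ sym)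
      ... | no u≢x   = u , Uu , ≢⇒¬is u≢x

      crosses : ∀ C x y → U x ≡ true → C x ≡ true → U y ≡ true → C y ≡ false → cut E C ≢ 0
      crosses C x y Ux Cx Uy Cy = must-cross N total root C 1+K≤K+K 1+K≤K+K
        (sets C (hits x Ux Cx) (y , Uy , Cy))
        (sets (not ∘ C) (hits y Uy (cong not Cy)) (x , Ux , cong not Cx))
        where
        -- Here k ≥ 2 matters: the bounds K of two complementary sets must add up to at least k.
        1+K≤K+K : k ≤ K + K
        1+K≤K+K = +-monoˡ-≤ K 1≤K

      -- Only p = q = K leaves no edge to spare in either direction, and that would be a balanced
      -- vertex.
      out-or-in : ∀ x → U x ≡ true → ¬ BalAt (is x) → GoodAt k K (is x) ⊎ GoodAt K k (is x)
      out-or-in x Ux unbal with sets (is x) (hits x Ux (is-refl x)) (misses x)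
      ... | mkGood p q K≤p K≤q sz r with K ≟ p | K ≟ q
      ...   | no K≢p   | _        = inj₁ (mkGood p q (≤∧≢⇒< K≤p K≢p) K≤q sz r)
      ...   | yes _    | no K≢q   = inj₂ (mkGood p q K≤p (≤∧≢⇒< K≤q K≢q) sz r)
      ...   | yes refl | yes refl = contradiction (mkBal K sz r) unbal

      -- If all vertices tolerate the loss of an outgoing edge but y no ingoing one, then adding
      -- root edges leaving y until p = 2k - 1, which may be replaced by p - k and q + k, makes
      -- the deletion of an edge entering y possible.
      all-out : (∀ x → U x ≡ true → GoodAt k K (is x)) → Sol E R
      all-out outok = by-cases b refl
        where
        by-cases : ∀ L → b ≡ L → Sol E R
        -- Every set containing x can spare an outgoing edge, so root edges leaving x are removed
        -- first. With `b` empty, up to K of them can later be added within `Region`.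
        by-cases (x ∷ b₀) beq = below M (fewer-root refl refl (≤-reflexive (trans (sym (+-suc (wt a full) (wt b₀ full)))
                           (cong (λ l → wt a full + wt l full) (sym beq)))))
                         (mkValid supE supa (All.tail supb′) supR total
                           (let (a≤ , b≤ , s) = root′ in a≤ , ≤-trans (n≤1+n _) b≤ , weaken-small s)
                           good (λ w Uw Ww → contradiction (noW w Uw) (true≢false Ww)) term)
          where
          M : Net
          M = mkNet U W E a b₀ R
          supb′ : All (On U) (x ∷ b₀)
          supb′ = subst (All (On U)) beq supb
          root′ : Region (wt a full) (1 + wt b₀ full)
          root′ = subst (λ l → Region (wt a full) (wt l full)) beq root
          weaken-small : ∀ {m l} → m ≤ K ⊎ suc l ≤ K → m ≤ K ⊎ l ≤ K
          weaken-small (inj₁ p) = inj₁ p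
          weaken-small (inj₂ p) = inj₂ (≤-trans (n≤1+n _) p)
          wtb : ∀ C {z} → C x ≡ z → wt b C ≡ χ z + wt b₀ C
          wtb C refl = cong (λ l → wt l C) beq
          num : ∀ C {z} → C x ≡ z → Sizes N M C
            (cut E C + (wt a C + (χ z + wt b₀ C))) (cut E C + (wt a C + wt b₀ C)) (ins E C) (ins E C)
            (wt R C + (χ z + wt b₀ C)) (wt R C + wt b₀ C)
          num C Cx = sizes (cong (λ l → cut E C + (wt a C + l)) (wtb C Cx)) refl refl refl
            (cong (wt R C +_) (wtb C Cx)) refl
          good : ∀ C → Hits C → Misses C → Net.GoodAt M K K C
          good C h m with C x in Cx
          ... | false = adjust-by N 0 0 0 (num C Cx) ≤-refl ≤-refl (+-identityʳ _) ≋-refl (sets C h m)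
          ... | true  = adjust-by N 1 0 0 (num C Cx) ≤-refl ≤-refl
                  (ring₁ (cut E C) (wt a C) (wt b₀ C)) (≡⇒≋ (ring₂ (wt R C) (wt b₀ C) (ins E C)))
                  (good-around ≤-refl (n≤1+n K) x (All.head supb′) (outok x (All.head supb′)) C Cx h m)
            where
            ring₁ : ∀ d a b → d + (a + (1 + b)) + 0 ≡ 1 + (d + (a + b))
            ring₁ = solve-∀
            ring₂ : ∀ r b e → r + (1 + b) + e + 0 ≡ r + b + e + 1
            ring₂ = solve-∀
        by-cases [] beq with crossing E (is u) (crosses (is u) u t Uu (is-refl u) Ut (≢⇒¬is (u≢t ∘ sym)))
        ... | x , y , E₀ , xu , yu , E~ = go (good? K k (size (is y)) (ins E (is y)) (dem (is y)))
          where
          sup : All (Both {On U}) ((x , y) ∷ E₀)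
          sup = All-~ E~ supE
          Ux = proj₁ (All.head sup)
          Uy = proj₂ (All.head sup)
          x≢y : x ≢ y
          x≢y refl = true≢false xu yu
          go : Dec (GoodAt K k (is y)) → Sol E R
          go (yes iny) = delete-edge x y E₀ x≢y E~ (outok x Ux) iny
          go (no ¬iny) with outok y Uy
          -- As p ≥ k, at most K root edges are added. At y they give p = 2k - 1 and the deletion
          -- leaves q ≥ K - 1; after k edges are moved, p = K and q ≥ K.
          ... | mkGood p q k≤p K≤q sz r = reduce-edge x y E₀ c x≢y E~
                  (proj₁ root , ≤-trans c+b≤K (m≤m+n K k) , inj₂ c+b≤K) (outok x Ux)
                  (rotateʳ (≤-reflexive (trans (+-comm k K) (sym c+p))) (≤-trans (n≤1+n K) (m≤n+m k (pred K)))
                    (entering x y E₀ c x≢y E~ (is y) (≢⇒¬is x≢y) (is-refl y) 1+pred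
                      (mkGood p q ≤-refl K≤q sz r)))
            where
            -- If p ≥ 2k, moving k edges would let y tolerate the loss of an ingoing edge.
            p≤ : p ≤ K + k
            p≤ with p ≤? K + k
            ... | yes h = h
            ... | no h  = contradiction (weaken (n≤1+n K) ≤-refl
                    (rotateʳ (≰⇒> h) (m≤n+m k q) (mkGood p q ≤-refl ≤-refl sz r))) ¬iny
            c = K + k ∸ p
            c+p : c + p ≡ K + k
            c+p = m∸n+n≡m p≤
            1+pred : 1 + pred K ≤ K
            1+pred = ≤-reflexive (suc-pred K {{>-nonZero 1≤K}})
            c+b≤K : c + wt b full ≤ K
            c+b≤K = ≤-trans (≤-reflexive (trans (cong (λ l → c + wt l full) beq) (+-identityʳ c)))
              (+-cancelʳ-≤ p _ _ (≤-trans (≤-reflexive c+p) (+-monoʳ-≤ K k≤p)))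

  goodAt? : ∀ N c c′ C → Dec (Net.GoodAt N c c′ C)
  goodAt? N c c′ C = good? c c′ (Net.size N C) (ins (Net.E N) C) (Net.dem N C)

  settle : 1 ≤ K → ∀ N → Valid N → Slack N → Below N →
    (∀ v → Net.U N v ≡ true → Net.W N v ≡ false) →
    ∀ u t → u ≢ t → Net.U N u ≡ true → Net.U N t ≡ true →
    (∀ x → Net.U N x ≡ true → ¬ Net.BalAt N (is x)) → Sol (Net.E N) (Net.R N)
  settle 1≤K N valid slack below noW u t u≢t Uu Ut unbal = by-cases (any? exception₁) (any? exception₂)
    where
    open Net N
    out? : ∀ x → Dec (GoodAt k K (is x))
    out? x = goodAt? N k K (is x)
    in? : ∀ x → Dec (GoodAt K k (is x))
    in? x = goodAt? N K k (is x)
    exception₁ : ∀ x → Dec (U x ≡ true × ¬ GoodAt k K (is x))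
    exception₁ x = (U x ≟B true) ×-dec ¬? (out? x)
    exception₂ : ∀ x → Dec (U x ≡ true × ¬ GoodAt K k (is x))
    exception₂ x = (U x ≟B true) ×-dec ¬? (in? x)
    out-or-in′ : ∀ x → U x ≡ true → GoodAt k K (is x) ⊎ GoodAt K k (is x)
    out-or-in′ x Ux = out-or-in N valid slack below noW 1≤K u t u≢t Uu Ut x Ux (unbal x Ux)
    C : VSet
    C v = ⌊ out? v ⌋
    delete : ∀ x y E₀ → C x ≡ true → C y ≡ false → E ~ (x , y) ∷ E₀ →
      GoodAt k K (is y) ⊎ GoodAt K k (is y) → Sol E R
    delete x y E₀ Cx Cy E~ (inj₁ h) = contradiction h (⌊⌋⇒¬ (out? y) Cy)
    delete x y E₀ Cx Cy E~ (inj₂ h) =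
      delete-edge N valid slack below noW x y E₀ (λ { refl → true≢false Cx Cy }) E~ (⌊⌋⇒ (out? x) Cx) h
    mixed : ∀ x y → U x ≡ true → GoodAt k K (is x) → U y ≡ true → ¬ GoodAt k K (is y) → Sol E R
    mixed x₀ y₀ Ux₀ h Uy₀ ¬h =
      let (x , y , E₀ , Cx , Cy , E~) = crossing E C (crosses N valid slack below noW 1≤K u t u≢t Uu Ut C x₀ y₀
                                          Ux₀ (⌊⌋-true (out? x₀) h) Uy₀ (⌊⌋-false (out? y₀) ¬h))
      in delete x y E₀ Cx Cy E~ (out-or-in′ y (proj₂ (All.head (All-~ E~ (Valid.supE valid)))))
    by-cases : Dec (∃ λ x → U x ≡ true × ¬ GoodAt k K (is x)) →
      Dec (∃ λ x → U x ≡ true × ¬ GoodAt K k (is x)) → Sol E R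
    by-cases (no all) _ = all-out N valid slack below noW 1≤K u t u≢t Uu Ut
      (λ x Ux → decidable-stable (out? x) (λ h → all (x , Ux , h)))
    -- Reversing all edges exchanges the two kinds of tolerance.
    by-cases (yes _) (no all) = sol-flip N (all-out (flipNet N) (valid-flip N valid) (slack-flip N slack)
      (below-flip N below) noW 1≤K u t u≢t Uu Ut
      (λ x Ux → good-flip N (decidable-stable (in? x) (λ h → all (x , Ux , h)))))
    by-cases (yes (y₀ , Uy₀ , ¬out)) (yes (x₀ , Ux₀ , ¬in)) with out-or-in′ x₀ Ux₀
    ... | inj₂ h = contradiction h ¬in
    ... | inj₁ h = mixed x₀ y₀ Ux₀ h Uy₀ ¬out

-- Critical sets and the induction for graphs with a root

count-cong : ∀ {m} {f g : Fin m → Bool} → f ≗ g → count f ≡ count g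
count-cong {zero}  h = refl
count-cong {suc m} h = cong₂ _+_ (cong χ (h Fin.zero)) (count-cong (h ∘ Fin.suc))

module Solve (K n : ℕ) (1≤K : 1 ≤ K) where

  open Settle K n public

  -- Sets are enumerated as bit vectors, which represent a predicate only up to pointwise equality;
  -- `P` has to respect it.
  search : {P : VSet → Set} → (∀ C → Dec (P C)) → (∀ {C D} → C ≗ D → P C → P D) → Dec (∃ P)
  search P? resp = map′ (λ (S , p) → lookupᵛ S , p)
    (λ (C , p) → tabulateᵛ C , resp (λ v → sym (lookup∘tabulate C v)) p) (anySubset? (P? ∘ lookupᵛ))

  module _ (N : Net) where
    open Net N

    Critical : VSet → Set
    Critical C = Hits C × Misses C × Multi C × ¬ GoodAt k k C

    critical? : ∀ C → Dec (Critical C)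
    critical? C =
      any? (λ t → (U t ≟B true) ×-dec (W t ≟B false) ×-dec (C t ≟B true)) ×-dec
      any? (λ y → (U y ≟B true) ×-dec (C y ≟B false)) ×-dec
      multi? N C ×-dec ¬? (goodAt? N k k C)

    critical-cong : ∀ {C D} → C ≗ D → Critical C → Critical D
    critical-cong h ((t , Ut , Wt , Ct) , (y , Uy , Cy) , (x , z , x≢z , (Ux , Cx) , (Uz , Cz)) , ¬g) =
      (t , Ut , Wt , trans (sym (h t)) Ct) , (y , Uy , trans (sym (h y)) Cy) ,
      (x , z , x≢z , (Ux , trans (sym (h x)) Cx) , (Uz , trans (sym (h z)) Cz)) ,
      λ g → ¬g (good-cong N (λ v → sym (h v)) g)

    uncritical⇒slack : (∀ C → ¬ Critical C) → Slack N
    uncritical⇒slack ¬crit C h m mm =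
      decidable-stable (goodAt? N k k C) (λ ¬g → ¬crit C (h , m , mm , ¬g))

    outer-smaller : ∀ B β → U β ≡ true → (Bβ : B β ≡ true) → Multi B →
      count (Net.U (outerNet N B β)) < count U
    outer-smaller B β Uβ Bβ (x , y , x≢y , (Ux , Bx) , (Uy , By)) with x ≟F β
    ... | no x≢β   = count-mono-< (outer⊆ N B β Uβ Bβ) x Ux
            (trans (cong₂ (λ p q → U x ∧ (not p ∨ q)) Bx (≢⇒¬is x≢β)) (∧-zeroʳ (U x)))
    ... | yes refl = count-mono-< (outer⊆ N B β Uβ Bβ) y Uy
            (trans (cong₂ (λ p q → U y ∧ (not p ∨ q)) By (≢⇒¬is (x≢y ∘ sym))) (∧-zeroʳ (U y)))

    inner-smaller : ∀ B → Misses B → count (meet B U) < count U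
    inner-smaller B (y , Uy , By) = count-mono-< (λ x h → proj₁ (∧-true h)) y Uy (cong₂ _∧_ Uy By)

  -- All edges are loops, and each adds one to the out-degree in either direction, so `total` is the
  -- whole demand.
  solve-single : ∀ N → Valid N → ∀ t → (∀ u → Net.U N u ≡ true → u ≡ t) → Sol (Net.E N) (Net.R N)
  solve-single N valid t sole = E , orients-refl E , final
    where
    open Net N
    open Valid valid
    out-agree : ∀ {C D} → (∀ v → U v ≡ true → C v ≡ D v) → out E C ≡ out E D
    out-agree h = tot-cong-All (λ (u , v) (Uu , _) → cong χ (h u Uu)) supE
    final : ∀ v → out E (is v) ≋ wt R (is v)
    final v with t ≟F v
    ... | yes refl = ≋-trans (≡⇒≋ (out-agree here)) (≋-trans (≋-sym total)
            (≡⇒≋ (sym (wt-agree N supE supa supb supR here supR))))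
      where
      here : ∀ u → U u ≡ true → is t u ≡ true
      here u Uu rewrite sole u Uu = is-refl t
    ... | no t≢v = ≡⇒≋ (trans (trans (out-agree away) (tot-0 E))
            (sym (trans (wt-agree N supE supa supb supR away supR) (tot-0 R))))
      where
      away : ∀ u → U u ≡ true → is v u ≡ false
      away u Uu rewrite sole u Uu = ≢⇒¬is t≢v

  module _ (N : Net) (valid : Valid N) (below : Below N) where
    open Net N
    open Valid valid

    -- Both parts have fewer vertices: `Multi` shrinks the outside and `Misses` the inside. The
    -- inner net is known only once the outside is oriented.
    reduce-critical : ∀ C → Critical N C → Sol E R
    reduce-critical C (h@(t , Ut , Wt , Ct) , m , mm , ¬g) = glue C {R = R} t Ct
      (below (outerNet N C t) (fewer-vertices (outer-smaller N C t Ut Ct mm)) (valid-outer N C t Ut Ct valid h))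
      (λ O o hO → below (innerNet N C O) (fewer-vertices (inner-smaller N C m))
        (valid-inner N C o supE supa supb supR hO ¬g
          (λ D hits (y , Uy , Cy , Dy) → sets (meet C D) hits (y , Uy , cong₂ _∧_ Dy Cy)) bals h))

    -- Declaring x exempt only drops cut conditions; y stays as the vertex that is not exempt.
    -- Elimination follows at once, so the induction makes progress.
    exempt-one : Slack N → (∀ v → U v ≡ true → W v ≡ false) → ∀ x y → U x ≡ true → U y ≡ true → x ≢ y →
      BalAt (is x) → Sol E R
    exempt-one slack noW x y Ux Uy x≢y bal = eliminate 1≤K M
      (mkValid supE supa supb supR total root
        (λ C (t , Ut , _ , Ct) m → sets C (t , Ut , noW t Ut , Ct) m)
        (λ w _ xw → subst (λ z → BalAt (is z)) (sym (is⇒≡ xw)) bal)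
        (y , Uy , ≢⇒¬is (x≢y ∘ sym)))
      (λ C (t , Ut , _ , Ct) m mm → slack C (t , Ut , noW t Ut , Ct) m mm)
      below′ x Ux (is-refl x)
      where
      M : Net
      M = mkNet U (is x) E a b R
      below′ : Below M
      below′ L (fewer-vertices p) = below L (fewer-vertices p)
      below′ L (fewer-edges e p)  = below L (fewer-edges e p)
      below′ L (fewer-root e f p) = below L (fewer-root e f p)

    solve-slack : Slack N → Sol E R
    solve-slack slack = go₁ (any? λ w → (U w ≟B true) ×-dec (W w ≟B true))
      where
      t = proj₁ term
      Ut = proj₁ (proj₂ term)
      module _ (noW : ∀ v → U v ≡ true → W v ≡ false) where
        go₃ : ∀ u → U u ≡ true → u ≢ t → Dec (∃ λ x → U x ≡ true × BalAt (is x)) → Sol E R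
        go₃ u Uu u≢t (no none) = settle 1≤K N valid slack below noW u t u≢t Uu Ut (λ x Ux b → none (x , Ux , b))
        go₃ u Uu u≢t (yes (x , Ux , b)) with x ≟F t
        ... | yes refl = exempt-one slack noW x u Ux Uu (u≢t ∘ sym) b
        ... | no x≢t   = exempt-one slack noW x t Ux Ut x≢t b
        go₂ : Dec (∃ λ u → U u ≡ true × u ≢ t) → Sol E R
        go₂ (no none) = solve-single N valid t
          (λ u Uu → decidable-stable (u ≟F t) (λ u≢t → none (u , Uu , u≢t)))
        go₂ (yes (u , Uu , u≢t)) = go₃ u Uu u≢t
          (any? λ x → (U x ≟B true) ×-dec bal? (size (is x)) (ins E (is x)) (dem (is x)))
      go₁ : Dec (∃ λ w → U w ≡ true × W w ≡ true) → Sol E R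
      go₁ (yes (w , Uw , Ww)) = eliminate 1≤K N valid slack below w Uw Ww
      go₁ (no none) = go₂ noW (any? λ u → (U u ≟B true) ×-dec ¬? (u ≟F t))
        where
        noW : ∀ v → U v ≡ true → W v ≡ false
        noW v Uv with W v in Wv
        ... | false = refl
        ... | true  = contradiction (v , Uv , Wv) none

    solve-step : Sol E R
    solve-step with search (critical? N) (critical-cong N)
    ... | yes (C , crit) = reduce-critical C crit
    ... | no none        = solve-slack (uncritical⇒slack N (λ C crit → none (C , crit)))

  Solvable : Net → Set
  Solvable N = Valid N → Sol (Net.E N) (Net.R N)

  vertices edges roots : Net → ℕ
  vertices N = count (Net.U N)
  edges N    = length (Net.E N)
  roots N    = wt (Net.a N) full + wt (Net.b N) full

  by-roots : ∀ {u e r} → (∀ M → vertices M < u → Solvable M) →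
    (∀ M → vertices M ≡ u → edges M < e → Solvable M) → Acc _<_ r →
    ∀ N → vertices N ≡ u → edges N ≡ e → roots N ≡ r → Solvable N
  by-roots ih₁ ih₂ (acc rs) N refl refl refl valid = solve-step N valid λ where
    M (fewer-vertices p)   → ih₁ M p
    M (fewer-edges p q)    → ih₂ M p q
    M (fewer-root p q lt)  → by-roots ih₁ ih₂ (rs lt) M p q refl

  by-edges : ∀ {u e} → (∀ M → vertices M < u → Solvable M) → Acc _<_ e →
    ∀ N → vertices N ≡ u → edges N ≡ e → Solvable N
  by-edges ih (acc rs) N p q =
    by-roots ih (λ M p lt → by-edges ih (rs lt) M p refl) (<-wellFounded _) N p q refl

  by-vertices : ∀ {u} → Acc _<_ u → ∀ N → vertices N ≡ u → Solvable N
  by-vertices (acc rs) N p =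
    by-edges (λ M lt → by-vertices (rs lt) M refl) (<-wellFounded _) N p refl

  solve : ∀ N → Valid N → Sol (Net.E N) (Net.R N)
  solve N = by-vertices (<-wellFounded _) N refl

-- Graphs without a root

halve : ∀ {x y z} → x + y ≡ z + z → x ≤ 1 + y → y ≤ 1 + x → x ≡ z
halve {x} {y} {z} e p q = ≤-antisym (≮⇒≥ λ z<x → <-irrefl (sym e) (lower z<x)) (≮⇒≥ λ x<z → <-irrefl e (upper x<z))
  where
  lower : z < x → z + z < x + y
  lower z<x = +-mono-<-≤ z<x (≤-pred (≤-trans z<x p))
  upper : x < z → x + y < z + z
  upper x<z = +-mono-<-≤ x<z (≤-trans q x<z)

module Rootless (K n : ℕ) (1≤K : 1 ≤ K) where

  open Solve K n 1≤K public

  module _ {P : VSet → Set} (P? : ∀ C → Dec (P C)) (resp : ∀ {C D} → C ≗ D → P C → P D)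
           (U : VSet) where

    minimal : ∀ C → P C → ∃ λ M → P M × (∀ D → P D → count (meet M U) ≤ count (meet D U))
    minimal C p = go C p (<-wellFounded _)
      where
      go : ∀ C → P C → Acc _<_ (count (meet C U)) → ∃ λ M → P M × (∀ D → P D → count (meet M U) ≤ count (meet D U))
      go C p (acc rs) with search (λ D → P? D ×-dec (count (meet D U) <? count (meet C U)))
                             (λ h (q , lt) → resp h q ,
                               subst (_< count (meet C U)) (count-cong λ v → cong (U v ∧_) (h v)) lt)
      ... | yes (D , q , lt) = go D q (rs lt)
      ... | no none          = C , p , λ D q → ≮⇒≥ λ lt → none (D , q , lt)

  bare : VSet → VSet → List Edge → List V → Net
  bare U W E R = mkNet U W E [] [] R

  -- No root; a cut need not be large if the demand can be met by p = q.
  record ValidBare (U : VSet) (E : List Edge) (R : List V) : Set where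
    open Net (bare U U E R) using (Misses; GoodAt; BalAt)
    field
      supE  : All (Both {On U}) E
      supR  : All (On U) R
      total : wt R full ≋ ins E full
      cuts  : ∀ C → (∃ λ x → U x ≡ true × C x ≡ true) → Misses C → GoodAt K K C ⊎ BalAt C

  solve-bare : ∀ {c} → Acc _<_ c → ∀ U E R → count U ≡ c → ValidBare U E R → Sol E R
  solve-bare {c} (acc rs) U E R refl valid = go (any? λ t → (U t ≟B true) ×-dec ¬? (bal-at t))
    where
    open ValidBare valid
    bal-at : ∀ t → Dec (Net.BalAt (bare U U E R) (is t))
    bal-at t = bal? _ _ _
    -- Exempting every vertex with a balanced split rules out the weaker alternative of `cuts` at
    -- all other single vertices.
    N : Net
    N = bare U (λ v → ⌊ bal-at v ⌋) E R
    open Net N using (W; Hits; Misses; Multi; GoodAt; BalAt)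

    -- All degrees are even, so a nearly even orientation splits each of them exactly in half, which
    -- is what balance demands.
    euler : (∀ t → U t ≡ true → BalAt (is t)) → Sol E R
    euler bal = O , o , final
      where
      O = proj₁ (even-orientation E)
      o = proj₁ (proj₂ (even-orientation E))
      even = proj₂ (proj₂ (even-orientation E))
      final : ∀ v → out O (is v) ≋ wt R (is v)
      final v with U v in Uv
      ... | true = ≋-trans (≡⇒≋ (halve (begin
              out O (is v) + inn O (is v)                             ≡⟨ out+inn o (is v) ⟩
              cut E (is v) + (ins E (is v) + ins E (is v))            ≡⟨ cong (_+ (ins E (is v) + ins E (is v))) (trans (sym (+-identityʳ _)) (sym (Bal.size b))) ⟩
              Bal.c b + Bal.c b + (ins E (is v) + ins E (is v))       ≡⟨ interchange (Bal.c b) (Bal.c b) _ _ ⟩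
              (Bal.c b + ins E (is v)) + (Bal.c b + ins E (is v))     ∎)
              (proj₁ (even v)) (proj₂ (even v))))
              (≋-trans (Bal.res b) (≡⇒≋ (+-identityʳ _)))
        where
        open ≡-Reasoning
        b = bal v Uv
      ... | false = ≡⇒≋ (trans out≡0 (sym (trans (wt-agree N supE [] [] supR away supR) (tot-0 R))))
        where
        away : ∀ u → U u ≡ true → is v u ≡ false
        away u Uu = ≢⇒¬is λ { refl → true≢false Uu Uv }
        out≡0 : out O (is v) ≡ 0
        out≡0 = trans (tot-cong-All (λ (u , w) (Uu , _) → cong χ (away u Uu)) (All-~ (orients⇒~ o) supE)) (tot-0 O)

    bals : ∀ w → U w ≡ true → W w ≡ true → BalAt (is w)
    bals w _ Ww = ⌊⌋⇒ (bal-at w) Ww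

    small-good : ∀ C → Hits C → Misses C → (Multi C → GoodAt k k C) → GoodAt K K C
    small-good C (t , Ut , Wt , Ct) m large = by-multi (multi? N C)
      where
      by-cut : ¬ Multi C → GoodAt K K C ⊎ BalAt C → GoodAt K K C
      by-cut _  (inj₁ g) = g
      by-cut ¬m (inj₂ b) = contradiction
        (bal-agree N supE [] [] supR (singleton N C ¬m t Ut Ct) b) (⌊⌋⇒¬ (bal-at t) Wt)
      by-multi : Dec (Multi C) → GoodAt K K C
      by-multi (yes mm) = weaken (n≤1+n K) (n≤1+n K) (large mm)
      by-multi (no ¬m)  = by-cut ¬m (cuts C (t , Ut , Ct) m)

    -- By minimality, the sets inside C satisfy the cut condition of a net with a root.
    contract : ∀ C → Critical N C → (∀ D → Critical N D → count (meet C U) ≤ count (meet D U)) → Sol E R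
    contract C (h@(t , Ut , Wt , Ct) , m@(y , Uy , Cy) , mm , ¬g) min = glue C {R = R} t Ct
      -- The outside still has no root, and `cuts` pulls back along the contraction.
      (solve-bare (rs (outer-smaller N C t Ut Ct mm)) _ _ _ refl (record
        { supE  = all-mapE N C t Ut Ct supE
        ; supR  = all-map N C t Ut Ct supR
        ; total = subst₂ _≋_ (sym (wt-map φ R full)) (sym (ins-mapE φ E full)) total
        ; cuts  = λ D (x , Ux , Dx) (z , Uz , Dz) → Sum.map (good-outer N C t Ut Ct D) (bal-outer N C t Ut Ct D)
                    (cuts (D ∘ φ)
                      (x , outer⊆ N C t Ut Ct x Ux , trans (cong D (φ-fix N C t Ut Ct x Ux)) Dx)
                      (z , outer⊆ N C t Ut Ct z Uz , trans (cong D (φ-fix N C t Ut Ct z Uz)) Dz)) }))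
      (λ O o hO → solve (innerNet N C O) (valid-inner N C o supE [] [] supR hO ¬g inner bals h))
      where
      φ = collapse C t
      inner : ∀ D → Hits (meet C D) → (∃ λ z → U z ≡ true × C z ≡ true × D z ≡ false) → GoodAt K K (meet C D)
      inner D hD (z , Uz , Cz , Dz) = small-good (meet C D) hD missesD
        (λ mmD → decidable-stable (goodAt? N k k (meet C D)) λ ¬gD →
          <⇒≱ (count-mono-< (λ v e → ∧-intro (proj₁ (∧-true e)) (proj₂ (∧-true {D v} (proj₂ (∧-true {U v} e)))))
                 z (∧-intro Uz Cz) (trans (cong (λ p → U z ∧ (p ∧ C z)) Dz) (∧-zeroʳ (U z))))
              (min (meet C D) (hD , missesD , mmD , ¬gD)))
        where
        missesD : Misses (meet C D)
        missesD = z , Uz , cong (_∧ C z) Dz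

    go : Dec (∃ λ t → U t ≡ true × ¬ BalAt (is t)) → Sol E R
    go (no all) = euler λ t Ut → decidable-stable (bal-at t) λ ¬b → all (t , Ut , ¬b)
    go (yes (t , Ut , ¬b)) = by-critical (search (critical? N) (critical-cong N))
      where
      by-critical : Dec (∃ (Critical N)) → Sol E R
      by-critical (yes (C , crit)) =
        let (M , critM , min) = minimal (critical? N) (critical-cong N) U C crit in contract M critM min
      by-critical (no none) = solve N (mkValid supE [] [] supR total (z≤n , z≤n , inj₁ z≤n)
        (λ C h m → small-good C h m (uncritical⇒slack N (λ D crit → none (D , crit)) C h m))
        bals (t , Ut , ⌊⌋-false (bal-at t) ¬b))

-- Colouring bipartite graphs

ΣF : ∀ {k} → (Fin k → ℕ) → ℕ
ΣF {zero}  f = 0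
ΣF {suc k} f = f Fin.zero + ΣF (f ∘ Fin.suc)

ΣF-cong : ∀ {k} {f g : Fin k → ℕ} → f ≗ g → ΣF f ≡ ΣF g
ΣF-cong {zero}  h = refl
ΣF-cong {suc k} h = cong₂ _+_ (h Fin.zero) (ΣF-cong (h ∘ Fin.suc))

ΣF-+ : ∀ {k} (f g : Fin k → ℕ) → ΣF (λ i → f i + g i) ≡ ΣF f + ΣF g
ΣF-+ {zero}  f g = refl
ΣF-+ {suc k} f g = trans (cong (f Fin.zero + g Fin.zero +_) (ΣF-+ (f ∘ Fin.suc) (g ∘ Fin.suc)))
  (interchange (f Fin.zero) (g Fin.zero) _ _)

ΣF-0 : ∀ k → ΣF {k} (λ _ → 0) ≡ 0
ΣF-0 zero    = refl
ΣF-0 (suc k) = ΣF-0 k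

ΣF-lower : ∀ {k} (f : Fin k → ℕ) m → (∀ i → m ≤ f i) → k * m ≤ ΣF f
ΣF-lower {zero}  f m h = z≤n
ΣF-lower {suc k} f m h = +-mono-≤ (h Fin.zero) (ΣF-lower (f ∘ Fin.suc) m (h ∘ Fin.suc))

ΣF-upper : ∀ {k} (f : Fin k → ℕ) m → (∀ i → f i ≤ m) → ΣF f ≤ k * m
ΣF-upper {zero}  f m h = z≤n
ΣF-upper {suc k} f m h = +-mono-≤ (h Fin.zero) (ΣF-upper (f ∘ Fin.suc) m (h ∘ Fin.suc))

ΣF-tight : ∀ {k} (f : Fin k → ℕ) m → (∀ i → f i ≤ m) → k * m ≤ ΣF f → ∀ i → f i ≡ m
ΣF-tight {suc k} f m h t Fin.zero = ≤-antisym (h Fin.zero)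
  (+-cancelʳ-≤ (k * m) _ _ (≤-trans t (+-monoʳ-≤ (f Fin.zero) (ΣF-upper (f ∘ Fin.suc) m (h ∘ Fin.suc)))))
ΣF-tight {suc k} f m h t (Fin.suc i) = ΣF-tight (f ∘ Fin.suc) m (h ∘ Fin.suc)
  (+-cancelˡ-≤ m _ _ (≤-trans t (+-monoˡ-≤ _ (h Fin.zero)))) i

ΣF-pick : ∀ {k} (c : Fin k) m → ΣF (λ i → if ⌊ c ≟F i ⌋ then m else 0) ≡ m
ΣF-pick {suc k} Fin.zero m = trans (cong (m +_) (ΣF-0 k)) (+-identityʳ m)
ΣF-pick {suc k} (Fin.suc c) m = trans (ΣF-cong (λ i → cong (λ b → if b then m else 0) (lem i))) (ΣF-pick c m)
  where
  lem : ∀ i → ⌊ Fin.suc c ≟F Fin.suc i ⌋ ≡ ⌊ c ≟F i ⌋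
  lem i with c ≟F i
  ... | yes _ = refl
  ... | no _  = refl

-- If a exceeded m, then b would be at least m, and the sum would exceed 2m.
even-split-bound : ∀ {a b m} → a + b ≤ m + m → a ≤ 1 + b → a ≤ m
even-split-bound {a} {b} {m} s d = ≮⇒≥ λ m<a →
  <⇒≱ (+-mono-<-≤ m<a (≤-pred (≤-trans m<a d))) s

module Colouring (W : Set) (_≟W_ : DecidableEquality W) (side : W → Bool) (k : ℕ) where

  open Edges W
  open Even W _≟W_

  Item : Set
  Item = Edge × Fin k

  unit : Edge → W → ℕ
  unit (p , q) x = χ (at x p) + χ (at x q)

  degree : List Edge → W → ℕ
  degree E x = tot (λ e → unit e x) E

  colDeg : List Item → Fin k → W → ℕ
  colDeg L i x = tot (λ (e , c) → if ⌊ c ≟F i ⌋ then unit e x else 0) L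

  ΣF-colDeg : ∀ L x → ΣF (λ i → colDeg L i x) ≡ degree (map proj₁ L) x
  ΣF-colDeg []            x = ΣF-0 k
  ΣF-colDeg ((e , c) ∷ L) x =
    trans (ΣF-+ (λ i → if ⌊ c ≟F i ⌋ then unit e x else 0) (λ i → colDeg L i x))
      (cong₂ _+_ (ΣF-pick c (unit e x)) (ΣF-colDeg L x))

  Bipartite : Edge → Set
  Bipartite (p , q) = side p ≡ true × side q ≡ false

  module _ (i j : Fin k) (i≢j : i ≢ j) where

    selected : List Item → List Edge
    selected []            = []
    selected ((e , c) ∷ L) = if ⌊ c ≟F i ⌋ ∨ ⌊ c ≟F j ⌋ then e ∷ selected L else selected L

    -- Selected edges directed from left to right get colour i, the others j. So at a left vertex
    -- the two colour degrees are the out- and in-degree in `O`, and at a right vertex the in- and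
    -- out-degree.
    record Recoloured (L : List Item) (O : List Edge) : Set where
      field
        L′     : List Item
        edges  : map proj₁ L′ ≡ map proj₁ L
        others : ∀ h → h ≢ i → h ≢ j → ∀ x → colDeg L′ h x ≡ colDeg L h x
        sums   : ∀ x → colDeg L′ i x + colDeg L′ j x ≡ colDeg L i x + colDeg L j x
        left   : ∀ x → side x ≡ true → colDeg L′ i x ≡ out O (at x) × colDeg L′ j x ≡ inn O (at x)
        right  : ∀ x → side x ≡ false → colDeg L′ i x ≡ inn O (at x) × colDeg L′ j x ≡ out O (at x)

    private
      diag : ∀ (h : Fin k) → ⌊ h ≟F h ⌋ ≡ true
      diag h = ⌊⌋-true (h ≟F h) refl
      off : ∀ {g h : Fin k} → g ≢ h → ⌊ g ≟F h ⌋ ≡ false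
      off {g} {h} = ⌊⌋-false (g ≟F h)
      apart : ∀ {y z} → side y ≡ true → side z ≡ false → y ≢ z
      apart sy sz refl = true≢false sy sz

    add-i : ∀ {L O p q c} → Bipartite (p , q) → c ≡ i ⊎ c ≡ j → Recoloured L O →
      Recoloured (((p , q) , c) ∷ L) ((p , q) ∷ O)
    add-i {L} {O} {p} {q} {c} (sp , sq) c∈ r = record
      { L′ = ((p , q) , i) ∷ L′ ; edges = cong ((p , q) ∷_) edges
      ; others = oth c∈ ; sums = sm c∈ ; left = lft ; right = rgt }
      where
      open Recoloured r
      oth : c ≡ i ⊎ c ≡ j → ∀ h → h ≢ i → h ≢ j → ∀ x →
        colDeg (((p , q) , i) ∷ L′) h x ≡ colDeg (((p , q) , c) ∷ L) h x
      oth (inj₁ refl) h h≢i h≢j x rewrite off (h≢i ∘ sym) = others h h≢i h≢j x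
      oth (inj₂ refl) h h≢i h≢j x rewrite off (h≢i ∘ sym) | off (h≢j ∘ sym) = others h h≢i h≢j x
      sm : c ≡ i ⊎ c ≡ j → ∀ x →
        colDeg (((p , q) , i) ∷ L′) i x + colDeg (((p , q) , i) ∷ L′) j x ≡ colDeg (((p , q) , c) ∷ L) i x + colDeg (((p , q) , c) ∷ L) j x
      sm (inj₁ refl) x rewrite diag i | off i≢j = trans (+-assoc (unit (p , q) x) _ _)
        (trans (cong (unit (p , q) x +_) (sums x)) (sym (+-assoc (unit (p , q) x) _ _)))
      sm (inj₂ refl) x rewrite diag i | diag j | off i≢j | off (i≢j ∘ sym) = trans (+-assoc (unit (p , q) x) _ _)
        (trans (cong (unit (p , q) x +_) (sums x)) (x+y+z≡y+x+z (unit (p , q) x) (colDeg L i x) (colDeg L j x)))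
      lft : ∀ x → side x ≡ true →
        colDeg (((p , q) , i) ∷ L′) i x ≡ out ((p , q) ∷ O) (at x) × colDeg (((p , q) , i) ∷ L′) j x ≡ inn ((p , q) ∷ O) (at x)
      lft x sx rewrite diag i | off i≢j | at-≢ (apart sx sq ∘ sym) =
        cong₂ _+_ (+-identityʳ _) (proj₁ (left x sx)) , proj₂ (left x sx)
      rgt : ∀ x → side x ≡ false →
        colDeg (((p , q) , i) ∷ L′) i x ≡ inn ((p , q) ∷ O) (at x) × colDeg (((p , q) , i) ∷ L′) j x ≡ out ((p , q) ∷ O) (at x)
      rgt x sx rewrite diag i | off i≢j | at-≢ (apart sp sx) =
        cong (χ (at x q) +_) (proj₁ (right x sx)) , proj₂ (right x sx)

    add-j : ∀ {L O p q c} → Bipartite (p , q) → c ≡ i ⊎ c ≡ j → Recoloured L O →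
      Recoloured (((p , q) , c) ∷ L) ((q , p) ∷ O)
    add-j {L} {O} {p} {q} {c} (sp , sq) c∈ r = record
      { L′ = ((p , q) , j) ∷ L′ ; edges = cong ((p , q) ∷_) edges
      ; others = oth c∈ ; sums = sm c∈ ; left = lft ; right = rgt }
      where
      open Recoloured r
      oth : c ≡ i ⊎ c ≡ j → ∀ h → h ≢ i → h ≢ j → ∀ x →
        colDeg (((p , q) , j) ∷ L′) h x ≡ colDeg (((p , q) , c) ∷ L) h x
      oth (inj₁ refl) h h≢i h≢j x rewrite off (h≢i ∘ sym) | off (h≢j ∘ sym) = others h h≢i h≢j x
      oth (inj₂ refl) h h≢i h≢j x rewrite off (h≢j ∘ sym) = others h h≢i h≢j x
      sm : c ≡ i ⊎ c ≡ j → ∀ x →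
        colDeg (((p , q) , j) ∷ L′) i x + colDeg (((p , q) , j) ∷ L′) j x ≡ colDeg (((p , q) , c) ∷ L) i x + colDeg (((p , q) , c) ∷ L) j x
      sm (inj₁ refl) x rewrite diag i | diag j | off i≢j | off (i≢j ∘ sym) = trans (x+y+z≡y+x+z (colDeg L′ i x) (unit (p , q) x) (colDeg L′ j x))
        (trans (cong (unit (p , q) x +_) (sums x)) (sym (+-assoc (unit (p , q) x) _ _)))
      sm (inj₂ refl) x rewrite diag j | off (i≢j ∘ sym) = trans (x+y+z≡y+x+z (colDeg L′ i x) (unit (p , q) x) (colDeg L′ j x))
        (trans (cong (unit (p , q) x +_) (sums x)) (x+y+z≡y+x+z (unit (p , q) x) (colDeg L i x) (colDeg L j x)))
      lft : ∀ x → side x ≡ true →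
        colDeg (((p , q) , j) ∷ L′) i x ≡ out ((q , p) ∷ O) (at x) × colDeg (((p , q) , j) ∷ L′) j x ≡ inn ((q , p) ∷ O) (at x)
      lft x sx rewrite diag j | off (i≢j ∘ sym) | at-≢ (apart sx sq ∘ sym) =
        proj₁ (left x sx) , cong₂ _+_ (+-identityʳ _) (proj₂ (left x sx))
      rgt : ∀ x → side x ≡ false →
        colDeg (((p , q) , j) ∷ L′) i x ≡ inn ((q , p) ∷ O) (at x) × colDeg (((p , q) , j) ∷ L′) j x ≡ out ((q , p) ∷ O) (at x)
      rgt x sx rewrite diag j | off (i≢j ∘ sym) | at-≢ (apart sp sx) =
        proj₁ (right x sx) , cong (χ (at x q) +_) (proj₂ (right x sx))

    skip : ∀ {L O e c} → c ≢ i → c ≢ j → Recoloured L O → Recoloured ((e , c) ∷ L) O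
    skip {L} {O} {e} {c} c≢i c≢j r = record
      { L′ = (e , c) ∷ L′ ; edges = cong (e ∷_) edges
      ; others = λ h h≢i h≢j x → cong ((if ⌊ c ≟F h ⌋ then unit e x else 0) +_) (others h h≢i h≢j x)
      ; sums = sm ; left = lft ; right = rgt }
      where
      open Recoloured r
      sm : ∀ x → colDeg ((e , c) ∷ L′) i x + colDeg ((e , c) ∷ L′) j x ≡ colDeg ((e , c) ∷ L) i x + colDeg ((e , c) ∷ L) j x
      sm x rewrite off c≢i | off c≢j = sums x
      lft : ∀ x → side x ≡ true → colDeg ((e , c) ∷ L′) i x ≡ out O (at x) × colDeg ((e , c) ∷ L′) j x ≡ inn O (at x)
      lft x sx rewrite off c≢i | off c≢j = left x sx
      rgt : ∀ x → side x ≡ false → colDeg ((e , c) ∷ L′) i x ≡ inn O (at x) × colDeg ((e , c) ∷ L′) j x ≡ out O (at x)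
      rgt x sx rewrite off c≢i | off c≢j = right x sx

    recolour : ∀ L → All Bipartite (map proj₁ L) → ∀ {O} → Orients (selected L) O → Recoloured L O
    recolour [] [] [] = record
      { L′ = [] ; edges = refl ; others = λ _ _ _ _ → refl ; sums = λ _ → refl
      ; left = λ _ _ → refl , refl ; right = λ _ _ → refl , refl }
    recolour ((e , c) ∷ L) (b ∷ bs) o with c ≟F i | c ≟F j
    recolour ((e , c) ∷ L) (b ∷ bs) (keep o) | yes c≡i | _       = add-i b (inj₁ c≡i) (recolour L bs o)
    recolour ((e , c) ∷ L) (b ∷ bs) (flip o) | yes c≡i | _       = add-j b (inj₁ c≡i) (recolour L bs o)
    recolour ((e , c) ∷ L) (b ∷ bs) (keep o) | no _    | yes c≡j = add-i b (inj₂ c≡j) (recolour L bs o)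
    recolour ((e , c) ∷ L) (b ∷ bs) (flip o) | no _    | yes c≡j = add-j b (inj₂ c≡j) (recolour L bs o)
    recolour ((e , c) ∷ L) (b ∷ bs) o        | no c≢i  | no c≢j  = skip c≢i c≢j (recolour L bs o)

    -- A nearly even orientation of the two colour classes makes their degrees differ by at most 1
    -- at every vertex, so a joint bound of 2m bounds each by m.
    rebalance : ∀ L → All Bipartite (map proj₁ L) → (m : W → ℕ) →
      (∀ h → h ≢ i → h ≢ j → ∀ x → colDeg L h x ≤ m x) →
      (∀ x → colDeg L i x + colDeg L j x ≤ m x + m x) →
      ∃ λ L′ → map proj₁ L′ ≡ map proj₁ L × (∀ h x → colDeg L′ h x ≤ m x)
    rebalance L bs m oth two with even-orientation (selected L)
    ... | O , o , ev = L′ , edges , bound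
      where
      open Recoloured (recolour L bs o)
      close : ∀ x → colDeg L′ i x ≤ 1 + colDeg L′ j x × colDeg L′ j x ≤ 1 + colDeg L′ i x
      close x with side x in sx
      ... | true  rewrite proj₁ (left x sx) | proj₂ (left x sx) = ev x
      ... | false rewrite proj₁ (right x sx) | proj₂ (right x sx) = proj₂ (ev x) , proj₁ (ev x)
      two′ : ∀ x → colDeg L′ i x + colDeg L′ j x ≤ m x + m x
      two′ x = subst (_≤ m x + m x) (sym (sums x)) (two x)
      bound : ∀ h x → colDeg L′ h x ≤ m x
      bound h x with h ≟F i | h ≟F j
      ... | yes refl | _        = even-split-bound (two′ x) (proj₁ (close x))
      ... | no _     | yes refl = even-split-bound {b = colDeg L′ i x}
              (subst (_≤ m x + m x) (+-comm (colDeg L′ i x) _) (two′ x)) (proj₂ (close x))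
      ... | no h≢i   | no h≢j   = subst (_≤ m x) (sym (others h h≢i h≢j x)) (oth h h≢i h≢j x)

  -- König: the edge (p , q) gets a colour i with room at p; if i has no room at q, the edges
  -- coloured i or j are redistributed evenly, where j has room at q.
  colouring : ∀ E → All Bipartite E → (m : W → ℕ) → (∀ x → degree E x ≤ k * m x) →
    ∃ λ L → map proj₁ L ≡ E × (∀ i x → colDeg L i x ≤ m x)
  colouring [] _ m h = [] , refl , λ i x → z≤n
  colouring ((p , q) ∷ E) ((sp , sq) ∷ bs) m h with colouring E bs m (λ x → ≤-trans (m≤n+m _ (unit (p , q) x)) (h x))
  ... | L , refl , bound = insert (room p p-met) (room q q-met)
    where
    p≢q : p ≢ q
    p≢q refl with trans (sym sp) sq
    ... | ()
    p-met : 1 ≤ unit (p , q) p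
    p-met rewrite at-refl p = s≤s z≤n
    q-met : 1 ≤ unit (p , q) q
    q-met rewrite at-refl q = m≤n+m 1 _
    -- If all k colours were full at x, the old edges alone would exhaust the degree bound k * m x,
    -- and the new edge would exceed it.
    room : ∀ x → 1 ≤ unit (p , q) x → ∃ λ i → colDeg L i x < m x
    room x met with any? (λ i → colDeg L i x <? m x)
    ... | yes r = r
    ... | no full = contradiction (≤-trans (+-monoˡ-≤ (degree (map proj₁ L) x) met) (h x))
            (≤⇒≯ (≤-trans (ΣF-lower (λ i → colDeg L i x) (m x) (λ i → ≮⇒≥ λ lt → full (i , lt)))
              (≤-reflexive (ΣF-colDeg L x))))
    insert : (∃ λ i → colDeg L i p < m p) → (∃ λ j → colDeg L j q < m q) →
      ∃ λ L′ → map proj₁ L′ ≡ (p , q) ∷ map proj₁ L × (∀ i x → colDeg L′ i x ≤ m x)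
    insert (i , hi) (j , hj) with i ≟F j
    ... | yes refl = ((p , q) , i) ∷ L , refl , bound′
      where
      bound′ : ∀ h x → colDeg (((p , q) , i) ∷ L) h x ≤ m x
      bound′ h x with i ≟F h
      ... | no _ = bound h x
      ... | yes refl with p ≟W x | q ≟W x
      ...   | yes refl | yes refl = contradiction refl p≢q
      ...   | yes refl | no _     = hi
      ...   | no _     | yes refl = hj
      ...   | no _     | no _     = bound i x
    -- Colour i may now exceed its bound at q by one, but the room of j at q keeps the sum of both
    -- within twice the bound.
    ... | no i≢j = rebalance i j i≢j (((p , q) , i) ∷ L) ((sp , sq) ∷ bs) m oth two
      where
      oth : ∀ h → h ≢ i → h ≢ j → ∀ x → colDeg (((p , q) , i) ∷ L) h x ≤ m x
      oth h h≢i _ x rewrite ⌊⌋-false (i ≟F h) (h≢i ∘ sym) = bound h x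
      two : ∀ x → colDeg (((p , q) , i) ∷ L) i x + colDeg (((p , q) , i) ∷ L) j x ≤ m x + m x
      two x rewrite ⌊⌋-true (i ≟F i) refl | ⌊⌋-false (i ≟F j) i≢j with p ≟W x | q ≟W x
      ... | yes refl | yes refl = contradiction refl p≢q
      ... | yes refl | no _     = +-mono-≤ hi (bound j x)
      ... | no _     | yes refl = ≤-trans (≤-reflexive (sym (+-suc (colDeg L i x) (colDeg L j x)))) (+-mono-≤ (bound i x) hj)
      ... | no _     | no _     = +-mono-≤ (bound i x) (bound j x)

-- Cuts and factors of the given graph

count-tabulate : {A : Set} → ∀ {m} (f : A → Bool) (g : Fin m → A) → tot (χ ∘ f) (tabulate g) ≡ count (f ∘ g)
count-tabulate {m = zero}  f g = refl
count-tabulate {m = suc m} f g = cong (χ (f (g Fin.zero)) +_) (count-tabulate f (g ∘ Fin.suc))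

even-or-odd : ∀ s → (∃ λ h → s ≡ h + h) ⊎ parity s ≡ 1ℙ
even-or-odd zero          = inj₁ (0 , refl)
even-or-odd (suc zero)    = inj₂ refl
even-or-odd (suc (suc s)) with even-or-odd s
... | inj₁ (h , refl) = inj₁ (suc h , cong suc (sym (+-suc h h)))
... | inj₂ p          = inj₂ p

-- Even terms vanish modulo 2. This links the size of X ∩ Q to a sum of degrees divided by k.
parity-count : ∀ {m} (C : Fin m → Bool) (f : Fin m → ℕ) →
  parity (count (λ v → C v ∧ ⌊ parity (f v) ≟ℙ 1ℙ ⌋)) ≡ parity (ΣF (λ v → if C v then f v else 0))
parity-count {zero}  C f = refl
parity-count {suc m} C f = trans (+-homo-+ (χ (C z ∧ ⌊ parity (f z) ≟ℙ 1ℙ ⌋)) _)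
  (trans (cong₂ _+ℙ_ (lem (C z) (f z)) (parity-count (C ∘ Fin.suc) (f ∘ Fin.suc)))
    (sym (+-homo-+ (if C z then f z else 0) _)))
  where
  z = Fin.zero
  lem : ∀ b x → parity (χ (b ∧ ⌊ parity x ≟ℙ 1ℙ ⌋)) ≡ parity (if b then x else 0)
  lem false x = refl
  lem true  x with parity x
  ... | 0ℙ = refl
  ... | 1ℙ = refl

ΣF-* : ∀ {m} c (f : Fin m → ℕ) → ΣF (λ i → c * f i) ≡ c * ΣF f
ΣF-* {zero}  c f = sym (*-zeroʳ c)
ΣF-* {suc m} c f = trans (cong (c * f Fin.zero +_) (ΣF-* c (f ∘ Fin.suc))) (sym (*-distribˡ-+ c _ _))

module Final (K : ℕ) (1≤K : 1 ≤ K) (G : Graph) where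

  n = nV G

  open Rootless K n 1≤K

  E : List Edge
  E = tabulate (ends G)

  degree-sum : VSet → ℕ
  degree-sum C = cut E C + (ins E C + ins E C)

  deg≡ : ∀ v → deg G v ≡ degree-sum (is v)
  deg≡ v = trans (sym (cong₂ _+_ (count-tabulate (is v ∘ proj₁) (ends G)) (count-tabulate (is v ∘ proj₂) (ends G))))
    (out+inn (orients-refl E) (is v))

  -- Double counting, with a projection `f` so as to serve tails and heads alike.
  wt-by-vertex : {A : Set} (f : A → V) (L : List A) (C : VSet) →
    ΣF (λ v → if C v then tot (λ x → χ (is v (f x))) L else 0) ≡ tot (λ x → χ (C (f x))) L
  wt-by-vertex f []      C = trans (ΣF-cong (λ v → pt (C v))) (ΣF-0 n)
    where
    pt : ∀ b → (if b then 0 else 0) ≡ 0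
    pt true  = refl
    pt false = refl
  wt-by-vertex f (x ∷ L) C = trans (ΣF-cong pt) (trans
    (ΣF-+ {n} (λ v → if ⌊ f x ≟F v ⌋ then χ (C (f x)) else 0) (λ v → if C v then tot (λ x → χ (is v (f x))) L else 0))
    (cong₂ _+_ (ΣF-pick (f x) (χ (C (f x)))) (wt-by-vertex f L C)))
    where
    pt : ∀ v → (if C v then χ (is v (f x)) + tot (λ x → χ (is v (f x))) L else 0) ≡
      (if ⌊ f x ≟F v ⌋ then χ (C (f x)) else 0) + (if C v then tot (λ x → χ (is v (f x))) L else 0)
    pt v with f x ≟F v
    pt v | yes refl with C v
    ... | true  = refl
    ... | false = refl
    pt v | no _ with C v
    ... | true  = refl
    ... | false = refl

  module _ (k∣E : k ∣ |E| G) (k∣deg : ∀ v → k ∣ deg G v)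
           (odd-cuts : ∀ X → Odd (count (λ v → X v ∧ inQ G k v)) → 3 * k ∸ 2 ≤ degSet G X) where

    -- The degree sum of C divided by k. Its parity is that of C ∩ Q and selects the alternative in
    -- `cuts`.
    share : VSet → ℕ
    share C = ΣF (λ v → if C v then deg G v / k else 0)

    degree-sum≡ : ∀ C → degree-sum C ≡ k * share C
    degree-sum≡ C = begin
      degree-sum C
        ≡⟨ out+inn (orients-refl E) C ⟨
      out E C + inn E C
        ≡⟨ cong₂ _+_ (wt-by-vertex proj₁ E C) (wt-by-vertex proj₂ E C) ⟨
      ΣF (λ v → if C v then out E (is v) else 0) + ΣF (λ v → if C v then inn E (is v) else 0)
        ≡⟨ ΣF-+ {n} (λ v → if C v then out E (is v) else 0) (λ v → if C v then inn E (is v) else 0) ⟨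
      ΣF (λ v → (if C v then out E (is v) else 0) + (if C v then inn E (is v) else 0))
        ≡⟨ ΣF-cong pt ⟩
      ΣF (λ v → k * (if C v then deg G v / k else 0))
        ≡⟨ ΣF-* {n} k (λ v → if C v then deg G v / k else 0) ⟩
      k * share C ∎
      where
      open ≡-Reasoning
      pt : ∀ v → (if C v then out E (is v) else 0) + (if C v then inn E (is v) else 0) ≡
        k * (if C v then deg G v / k else 0)
      pt v with C v
      ... | false = sym (*-zeroʳ k)
      ... | true  = trans (trans (out+inn (orients-refl E) (is v)) (sym (deg≡ v)))
                      (trans (sym (m/n*n≡m (k∣deg v))) (*-comm (deg G v / k) k))

    cuts : ∀ C → Net.GoodAt (bare (λ _ → true) (λ _ → true) E []) K K C ⊎
      Net.BalAt (bare (λ _ → true) (λ _ → true) E []) C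
    cuts C with even-or-odd (share C)
    -- The cut plus twice the inner edges is 2kh, so half of the cut plus the inner edges is kh ≡ 0.
    ... | inj₁ (h , eq) = inj₂ (mkBal c
            (trans (+-cancelʳ-≡ (i + i) _ _ (trans (interchange c c i i) (trans (cong₂ _+_ c+i c+i) (sym 2kh))))
              (sym (+-identityʳ _)))
            (≋-trans (≡⇒≋ (trans c+i (*-comm k h))) (k*≋0 h)))
      where
      i = ins E C
      c = k * h ∸ i
      2kh : cut E C + (i + i) ≡ k * h + k * h
      2kh = trans (degree-sum≡ C) (trans (cong (k *_) eq) (*-distribˡ-+ k h h))
      c+i : c + i ≡ k * h
      c+i = m∸n+n≡m {k * h} {i} (≮⇒≥ λ lt → <⇒≱ (+-mono-< lt lt) (≤-trans (m≤n+m (i + i) (cut E C)) (≤-reflexive 2kh)))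
    -- As 3k - 2 = 3K + 1 and p ≤ 2K, at least K edges are left for q.
    ... | inj₂ odd = inj₁ (mkGood p (cut E C ∸ p) (m≤m+n K r)
            (m+n≤o⇒m≤o∸n K (≤-trans (+-monoʳ-≤ K (+-monoʳ-≤ K (≤-pred (m%n<n (K * (K + i)) k)))) big))
            (trans (m+[n∸m]≡n (≤-trans (+-monoʳ-≤ K (≤-pred (m%n<n (K * (K + i)) k)))
              (≤-trans (m≤n+m (K + K) K) big))) (sym (+-identityʳ _)))
            (≋-trans (≋-sym (≋-drop (K * (K + i) / k))) (≋-trans (≡⇒≋ (begin
              K + r + i + K * (K + i) / k * k      ≡⟨ ring₁ K r i (K * (K + i) / k * k) ⟩
              K + i + (r + K * (K + i) / k * k)    ≡⟨ cong (K + i +_) (m≡m%n+[m/n]*n (K * (K + i)) k) ⟨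
              K + i + K * (K + i)                  ≡⟨ *-comm k (K + i) ⟩
              (K + i) * k                          ∎)) (k*≋0 (K + i)))))
      where
      open ≡-Reasoning
      i = ins E C
      -- the least p ≥ K with p + i ≡ 0 mod k
      r = (K * (K + i)) % k
      p = K + r
      ring₁ : ∀ K r i w → K + r + i + w ≡ K + i + (r + w)
      ring₁ = solve-∀
      big : K + (K + K) ≤ cut E C
      big = ≤-trans (≤-trans (n≤1+n _) (≤-reflexive (trans (sym (m+n∸n≡m (1 + (K + (K + K))) 2)) (cong (_∸ 2) (ring₂ K)))))
        (≤-trans (odd-cuts C (trans (parity-count C (λ v → deg G v / k)) odd))
          (≤-reflexive (sym (count-tabulate (λ e → C (proj₁ e) xor C (proj₂ e)) (ends G)))))
        where
        ring₂ : ∀ K → 1 + (K + (K + K)) + 2 ≡ 3 * suc K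
        ring₂ = solve-∀

    orientation : Sol E []
    orientation = solve-bare (<-wellFounded _) (λ _ → true) E [] refl (record
      { supE  = universal (λ _ → refl , refl) E
      ; supR  = []
      ; total = ≋-sym (≋-trans (≡⇒≋ (trans (tot-const E) (trans (length-tabulate (ends G)) (_∣_.equality k∣E))))
                  (k*≋0 (_∣_.quotient k∣E)))
      ; cuts  = λ C _ _ → cuts C })

    multiple : ∀ {x} → x ≋ 0 → ∃ λ q → x ≡ k * q
    multiple {x} (cong-by i j eq) = j ∸ i , trans (sym (m+n∸n≡m x (i * k)))
      (trans (cong (_∸ i * k) eq) (trans (sym (*-distribʳ-∸ k j i)) (*-comm (j ∸ i) k)))

    module _ (O : List Edge) (o : Orients E O) (balanced : ∀ v → out O (is v) ≋ 0) where

      out-share : ∀ v → ∃ λ q → out O (is v) ≡ k * q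
      out-share v = multiple (balanced v)

      both-share : ∀ v → out O (is v) + inn O (is v) ≡ k * (deg G v / k)
      both-share v = trans (out+inn o (is v)) (trans (sym (deg≡ v))
        (trans (sym (m/n*n≡m (k∣deg v))) (*-comm (deg G v / k) k)))

      inn-share : ∀ v → ∃ λ q → inn O (is v) ≡ k * q
      inn-share v = deg G v / k ∸ proj₁ (out-share v) , trans (sym (m+n∸m≡n (out O (is v)) _))
        (trans (cong₂ _∸_ (both-share v) (proj₂ (out-share v)))
          (sym (*-distribˡ-∸ k (deg G v / k) (proj₁ (out-share v)))))

      W : Set
      W = V ⊎ V

      _≟W_ : DecidableEquality W
      _≟W_ = ≡-dec _≟F_ _≟F_

      side : W → Bool
      side (inj₁ _) = true
      side (inj₂ _) = false

      open Colouring W _≟W_ side k using (colDeg; colouring; unit; degree; ΣF-colDeg)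

      split : Edge → W × W
      split (s , t) = inj₁ s , inj₂ t

      cap : W → ℕ
      cap (inj₁ v) = proj₁ (out-share v)
      cap (inj₂ v) = proj₁ (inn-share v)

      unit₁ : ∀ v e → unit (split e) (inj₁ v) ≡ χ (is v (proj₁ e))
      unit₁ v (s , t) with s ≟F v
      ... | yes refl = refl
      ... | no _     = refl

      unit₂ : ∀ v e → unit (split e) (inj₂ v) ≡ χ (is v (proj₂ e))
      unit₂ v (s , t) with t ≟F v
      ... | yes refl = refl
      ... | no _     = refl

      degree≡ : ∀ x → degree (map split O) x ≡ k * cap x
      degree≡ (inj₁ v) = trans (tot-map _ split O) (trans (tot-cong (unit₁ v) O) (proj₂ (out-share v)))
      degree≡ (inj₂ v) = trans (tot-map _ split O) (trans (tot-cong (unit₂ v) O) (proj₂ (inn-share v)))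

      -- Orientation and colouring keep the positions of the edges, so colours are read off in
      -- order. Since tails and heads are added up, a reversed edge contributes the same.
      assign : ∀ {m} (g : Fin m → Edge) {O} → Orients (tabulate g) O → ∀ L → map proj₁ L ≡ map split O →
        ∃ λ (c : Fin m → Fin k) → ∀ i v →
          count (λ e → ⌊ c e ≟F i ⌋ ∧ is v (proj₁ (g e))) + count (λ e → ⌊ c e ≟F i ⌋ ∧ is v (proj₂ (g e))) ≡
          colDeg L i (inj₁ v) + colDeg L i (inj₂ v)
      assign {zero} g [] [] eq = (λ ()) , λ i v → refl
      assign {suc m} g (keep o) ((e , c₀) ∷ L) eq with ∷-injectiveˡ eq | assign (g ∘ Fin.suc) o L (∷-injectiveʳ eq)
      ... | refl | c , h = (λ { Fin.zero → c₀ ; (Fin.suc x) → c x }) , λ i v →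
        trans (interchange (χ (⌊ c₀ ≟F i ⌋ ∧ is v (proj₁ (g Fin.zero)))) _ _ _)
          (trans (cong₂ _+_ (head i v) (h i v))
            (interchange (if ⌊ c₀ ≟F i ⌋ then unit (split (g Fin.zero)) (inj₁ v) else 0) _ _ _))
        where
        head : ∀ i v → χ (⌊ c₀ ≟F i ⌋ ∧ is v (proj₁ (g Fin.zero))) + χ (⌊ c₀ ≟F i ⌋ ∧ is v (proj₂ (g Fin.zero))) ≡
          (if ⌊ c₀ ≟F i ⌋ then unit (split (g Fin.zero)) (inj₁ v) else 0) +
          (if ⌊ c₀ ≟F i ⌋ then unit (split (g Fin.zero)) (inj₂ v) else 0)
        head i v with c₀ ≟F i
        ... | yes _ = sym (cong₂ _+_ (unit₁ v (g Fin.zero)) (unit₂ v (g Fin.zero)))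
        ... | no _  = refl
      assign {suc m} g (flip o) ((e , c₀) ∷ L) eq with ∷-injectiveˡ eq | assign (g ∘ Fin.suc) o L (∷-injectiveʳ eq)
      ... | refl | c , h = (λ { Fin.zero → c₀ ; (Fin.suc x) → c x }) , λ i v →
        trans (interchange (χ (⌊ c₀ ≟F i ⌋ ∧ is v (proj₁ (g Fin.zero)))) _ _ _)
          (trans (cong₂ _+_ (head i v) (h i v))
            (interchange (if ⌊ c₀ ≟F i ⌋ then unit (split e′) (inj₁ v) else 0) _ _ _))
        where
        e′ : Edge
        e′ = proj₂ (g Fin.zero) , proj₁ (g Fin.zero)
        head : ∀ i v → χ (⌊ c₀ ≟F i ⌋ ∧ is v (proj₁ (g Fin.zero))) + χ (⌊ c₀ ≟F i ⌋ ∧ is v (proj₂ (g Fin.zero))) ≡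
          (if ⌊ c₀ ≟F i ⌋ then unit (split e′) (inj₁ v) else 0) +
          (if ⌊ c₀ ≟F i ⌋ then unit (split e′) (inj₂ v) else 0)
        head i v with c₀ ≟F i
        ... | yes _ = trans (+-comm (χ (is v (proj₁ (g Fin.zero)))) _) (sym (cong₂ _+_ (unit₁ v e′) (unit₂ v e′)))
        ... | no _  = refl

      factors : Σ (Fin (nE G) → Fin k) λ c →
        (i : Fin k) (v : Fin (nV G)) → degIn G (λ e → ⌊ c e ≟F i ⌋) v ≡ deg G v / k
      factors with colouring (map split O) (bip O) cap (λ x → ≤-reflexive (degree≡ x))
        where
        bip : ∀ O → All (λ (p , q) → side p ≡ true × side q ≡ false) (map split O)
        bip []      = []
        bip (e ∷ O) = (refl , refl) ∷ bip O
      ... | L , eq , bound with assign (ends G) o L eq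
      ... | c , h = c , λ i v → trans (h i v) (trans (cong₂ _+_ (exact (inj₁ v) i) (exact (inj₂ v) i)) (caps v))
        where
        -- The k colour degrees at x are at most `cap x` and sum to k times it, so none can be
        -- smaller.
        exact : ∀ x i → colDeg L i x ≡ cap x
        exact x = ΣF-tight (λ i → colDeg L i x) (cap x) (λ i → bound i x)
          (≤-reflexive (sym (trans (ΣF-colDeg L x) (trans (cong (λ l → degree l x) eq) (degree≡ x)))))
        caps : ∀ v → cap (inj₁ v) + cap (inj₂ v) ≡ deg G v / k
        caps v = *-cancelˡ-≡ _ _ k (trans (*-distribˡ-+ k (cap (inj₁ v)) (cap (inj₂ v)))
          (trans (sym (cong₂ _+_ (proj₂ (out-share v)) (proj₂ (inn-share v)))) (both-share v)))

    factorisation : Σ (Fin (nE G) → Fin k) λ c →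
      (i : Fin k) (v : Fin (nV G)) → degIn G (λ e → ⌊ c e ≟F i ⌋) v ≡ deg G v / k
    factorisation = let (O , o , balanced) = orientation in factors O o balanced

theorem4p6 : (k : ℕ) .{{_ : NonZero k}} (G : Graph) →
    k ∣ |E| G →
    ((v : Fin (nV G)) → k ∣ deg G v) →
    ((X : Fin (nV G) → Bool) → Odd (count (λ v → X v ∧ inQ G k v)) → 3 * k ∸ 2 ≤ degSet G X) →
    Σ (Fin (nE G) → Fin k) λ c →
    (i : Fin k) (v : Fin (nV G)) → degIn G (λ e → ⌊ c e ≟F i ⌋) v ≡ deg G v / k
theorem4p6 zero {{nz}} = contradiction refl (≢-nonZero⁻¹ 0 {{nz}})
-- The graph itself is the single factor; the general argument is for K ≥ 1.
theorem4p6 1 G _ _ _ = (λ _ → Fin.zero) , λ { Fin.zero v → sym (n/1≡n (deg G v)) }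
theorem4p6 (suc (suc K)) G k∣E k∣deg odd-cuts = Final.factorisation (suc K) (s≤s z≤n) G k∣E k∣deg odd-cuts
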